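{- Let $p$ be an odd prime, $a\in\mathbb Z_p$ with $a\not\equiv 0,-1\pmod p$, and $a'=(a-\langle a\rangle_p)/p$. (1) If $2\mid\langle a\rangle_p$ and $\langle a\rangle_p=2n$, then $$S_p(a)\equiv \frac{\binom{(a-1)/2}{n}^2}{\binom{a/2}{n}^2}\Big(1-2a'(2^{p-1}-1)+a'(2a'+1)(2^{p-1}-1)^2\Big)$$ $$\equiv\binom{(p-1)/2}{n}^2\Big(1+p\big((2a'+2)H_{2n}-(2a'+1)H_n-2a'q_p(2)\big)+\frac{p^2}{2}\Big(2a'q_p(2)^2+\big((2a'+2)H_{2n}-(2a'+1)H_n-2a'q_p(2)\big)^2+\frac12(2a'^2-1)H_n^{(2)}+2(1-a'^2)H_{2n}^{(2)}\Big)\Big)\pmod{p^3}.$$ (2) If $2\nmid\langle a\rangle_p$, then $$S_p(a)\equiv\frac{4^{\langle a\rangle_p-1}\,a'(a'+1)p^2}{a^2\binom{\langle a\rangle_p-1}{(\langle a\rangle_p-1)/2}^2}\equiv\frac{a'(a'+1)p^2}{a^2\binom{(p-1)/2}{(\langle a\rangle_p-1)/2}^2}\pmod{p^3}.$$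
   Context: For a prime $p$, $\mathbb Z_p$ denotes the set of rational numbers whose denominator is not divisible by $p$, and congruences modulo powers of $p$ are between elements of $\mathbb Z_p$ (the difference divided by that power of $p$ lies in $\mathbb Z_p$). For $a\in\mathbb Z_p$, $\langle a\rangle_p\in\{0,1,\ldots,p-1\}$ is determined by $a\equiv\langle a\rangle_p\pmod p$. For rational $a$ and integer $k\ge0$, $\binom ak=a(a-1)\cdots(a-k+1)/k!$. Define $S_n(a)=\sum_{k=0}^{n-1}\binom ak\binom{ -1-a}k\binom{2k}k\frac1{4^k}$ for $n\ge1$. Also $q_p(2)=(2^{p-1}-1)/p$, $H_n=\sum_{k=1}^n\frac1k$, $H_n^{(2)}=\sum_{k=1}^n\frac1{k^2}$, $H_0=H_0^{(2)}=0$. -}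

module Defs where

open import Agda.Builtin.FromNat using (Number; fromNat) public
open import Agda.Builtin.Unit using (tt) public
open import Data.Nat.Base as ℕ using (ℕ; zero; suc; _!)
open import Data.Nat.Combinatorics using (_C_; nCk+nC[k+1]≡[n+1]C[k+1])
open import Data.Nat.Divisibility using (_∣_; divides; >⇒∤)
import Data.Nat.Literals as ℕLit
open import Data.Nat.Primality using (Prime; euclidsLemma)
import Data.Nat.Properties as ℕ
open import Data.Integer.Base as ℤ using (ℤ; +_)
import Data.Integer.Properties as ℤ
open import Data.Rational.Base
open import Data.Rational.Literals as ℚLit using (fromℤ)
open import Data.Rational.Properties
import Data.Rational.Unnormalised.Base as ℚᵘ
import Data.Rational.Unnormalised.Properties as ℚᵘ
open import Algebra.Properties.Group +-0-group using (x∙y⁻¹≈ε⇒x≈y)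
open import Data.Sum.Base using (inj₁; inj₂)
open import Relation.Nullary.Negation.Core using (¬_; contradiction)
open import Relation.Binary.PropositionalEquality

instance
  ℕ-literals : Number ℕ
  ℕ-literals = ℕLit.number

  ℚ-literals : Number ℚ
  ℚ-literals = ℚLit.number

fromℕ : ℕ → ℚ
fromℕ n = fromℤ (+ n)

infixl 8 _²

_² : ℚ → ℚ
x ² = x * x

-- ∑ n f = f 0 + … + f (n - 1)
∑ : ℕ → (ℕ → ℚ) → ℚ
∑ zero    f = 0
∑ (suc n) f = ∑ n f + f n

infix 4 _∈ℤ₍_₎ _≡_[mod_^_]

-- The denominator ↧ₙ x is the one of the reduced fraction.
_∈ℤ₍_₎ : ℚ → ℕ → Set
x ∈ℤ₍ p ₎ = ¬ (p ∣ ↧ₙ x)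

record _≡_[mod_^_] (x y : ℚ) (p k : ℕ) .{{_ : ℕ.NonZero p}} : Set where
  constructor congruent
  field
    integralˡ : x ∈ℤ₍ p ₎
    integralʳ : y ∈ℤ₍ p ₎
    quotient  : ((x - y) ÷ fromℕ (p ℕ.^ k)) {{ℕ.m^n≢0 p k}} ∈ℤ₍ p ₎

-- r = ⟨ a ⟩ₚ; such an r exists and is unique for p prime and a ∈ ℤ₍ p ₎.
record _IsResidueOf_Mod_ (r : ℕ) (a : ℚ) (p : ℕ) .{{_ : ℕ.NonZero p}} : Set where
  constructor isResidue
  field
    bounded : r ℕ.< p
    residue : a ≡ fromℕ r [mod p ^ 1 ]

fallingFactorial : ℚ → ℕ → ℚ
fallingFactorial a zero    = 1
fallingFactorial a (suc k) = fallingFactorial a k * (a - fromℕ k)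

binom : ℚ → ℕ → ℚ
binom a k = (fallingFactorial a k ÷ fromℕ (k !)) {{k ℕ.!≢0}}

S : ℕ → ℚ → ℚ
S n a = ∑ n λ k →
  (binom a k * binom (- 1 - a) k * fromℕ ((2 ℕ.* k) C k) ÷ fromℕ (4 ℕ.^ k)) {{ℕ.m^n≢0 4 k}}

H : ℕ → ℚ
H n = ∑ n λ k → 1 ÷ fromℕ (suc k)

H⁽²⁾ : ℕ → ℚ
H⁽²⁾ n = ∑ n λ k → 1 ÷ fromℕ (suc k ℕ.^ 2)

q₂ : (p : ℕ) → .{{ℕ.NonZero p}} → ℚ
q₂ p = (fromℕ (2 ℕ.^ (p ℕ.∸ 1)) - 1) ÷ fromℕ p

-- The remaining lemmas show that the denominators of the theorem do not vanish.

private
  *-≢0 : ∀ {x y} → x ≢ 0ℚ → y ≢ 0ℚ → x * y ≢ 0ℚ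
  *-≢0 {x} {y} x≢0 y≢0 xy≡0 = y≢0 (begin
    y                ≡⟨ *-identityˡ y ⟨
    1ℚ * y           ≡⟨ cong (_* y) (*-inverseˡ x) ⟨
    1/ x * x * y     ≡⟨ *-assoc (1/ x) x y ⟩
    1/ x * (x * y)   ≡⟨ cong (1/ x *_) xy≡0 ⟩
    1/ x * 0ℚ        ≡⟨ *-zeroʳ (1/ x) ⟩
    0ℚ               ∎)
    where
    open ≡-Reasoning
    instance _ = ≢-nonZero x≢0

  ÷-cancel : ∀ x y .{{_ : NonZero y}} → (x ÷ y) * y ≡ x
  ÷-cancel x y = begin
    x * 1/ y * y    ≡⟨ *-assoc x (1/ y) y ⟩
    x * (1/ y * y)  ≡⟨ cong (x *_) (*-inverseˡ y) ⟩
    x * 1ℚ          ≡⟨ *-identityʳ x ⟩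
    x               ∎
    where open ≡-Reasoning

  ÷-≢0 : ∀ {x} y .{{_ : NonZero y}} → x ≢ 0ℚ → x ÷ y ≢ 0ℚ
  ÷-≢0 {x} y x≢0 x/y≡0 = x≢0 (begin
    x            ≡⟨ ÷-cancel x y ⟨
    (x ÷ y) * y  ≡⟨ cong (_* y) x/y≡0 ⟩
    0ℚ * y       ≡⟨ *-zeroˡ y ⟩
    0ℚ           ∎)
    where open ≡-Reasoning

  fromℤ-+ : ∀ i j → fromℤ (i ℤ.+ j) ≡ fromℤ i + fromℤ j
  fromℤ-+ i j = begin
    fromℤ (i ℤ.+ j)                    ≡⟨ ↥p/↧p≡p (fromℤ (i ℤ.+ j)) ⟨
    (i ℤ.+ j) / 1                      ≡⟨ cong₂ (λ m n → (m ℤ.+ n) / 1) (ℤ.*-identityʳ i) (ℤ.*-identityʳ j) ⟨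
    (i ℤ.* + 1 ℤ.+ j ℤ.* + 1) / 1  ≡⟨⟩
    fromℤ i + fromℤ j                  ∎
    where open ≡-Reasoning

  fromℤ-* : ∀ i j → fromℤ (i ℤ.* j) ≡ fromℤ i * fromℤ j
  fromℤ-* i j = sym (↥p/↧p≡p (fromℤ (i ℤ.* j)))

  fromℤ-neg : ∀ i → fromℤ (ℤ.- i) ≡ - fromℤ i
  fromℤ-neg (+ zero)     = refl
  fromℤ-neg ℤ.+[1+ n ]   = refl
  fromℤ-neg ℤ.-[1+ n ]   = refl

  multiple⇒∣ : ∀ {p} x i → Prime p → x ∈ℤ₍ p ₎ → x * fromℕ p ≡ fromℤ i → p ∣ ℤ.∣ i ∣
  multiple⇒∣ {p} x@record{} i pr x∈ xp≡i with euclidsLemma ℤ.∣ i ∣ (↧ₙ x) pr p∣i*↧x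
    where
    open ≡-Reasoning
    cross : ↥ x ℤ.* + p ℤ.* + 1 ≡ i ℤ.* (↧ x ℤ.* + 1)
    cross = ℚᵘ.drop-*≡* (ℚᵘ.≃-trans (ℚᵘ.≃-sym (toℚᵘ-homo-* x (fromℕ p))) (ℚᵘ.≃-reflexive (cong toℚᵘ xp≡i)))
    p∣i*↧x : p ∣ ℤ.∣ i ∣ ℕ.* ↧ₙ x
    p∣i*↧x = divides ℤ.∣ ↥ x ∣ (begin
      ℤ.∣ i ∣ ℕ.* ↧ₙ x            ≡⟨ ℤ.abs-* i (↧ x) ⟨
      ℤ.∣ i ℤ.* ↧ x ∣             ≡⟨ cong (λ d → ℤ.∣ i ℤ.* d ∣) (ℤ.*-identityʳ (↧ x)) ⟨
      ℤ.∣ i ℤ.* (↧ x ℤ.* + 1) ∣   ≡⟨ cong ℤ.∣_∣ cross ⟨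
      ℤ.∣ ↥ x ℤ.* + p ℤ.* + 1 ∣   ≡⟨ cong ℤ.∣_∣ (ℤ.*-identityʳ (↥ x ℤ.* + p)) ⟩
      ℤ.∣ ↥ x ℤ.* + p ∣           ≡⟨ ℤ.abs-* (↥ x) (+ p) ⟩
      ℤ.∣ ↥ x ∣ ℕ.* p             ∎)
  ... | inj₁ p∣i = p∣i
  ... | inj₂ p∣↧x = contradiction p∣↧x x∈

  residue≢smaller : ∀ {p a r} .{{_ : ℕ.NonZero p}} → Prime p → r IsResidueOf a Mod p →
                    ∀ m → m ℕ.< r → a ≢ fromℕ m
  residue≢smaller {p} {a} {r} pr (isResidue r<p (congruent _ _ quotient)) m m<r refl =
    >⇒∤ {{ℕ.>-nonZero (ℕ.m<n⇒0<n∸m m<r)}} (ℕ.≤-<-trans (ℕ.m∸n≤m r m) r<p)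
      (subst (p ∣_) abs (multiple⇒∣ x (+ m ℤ.- + r) pr quotient xp≡m-r))
    where
    open ≡-Reasoning
    nz : ℕ.NonZero (p ℕ.^ 1)
    nz = ℕ.m^n≢0 p 1
    x : ℚ
    x = ((fromℕ m - fromℕ r) ÷ fromℕ (p ℕ.^ 1)) {{nz}}
    xp≡m-r : x * fromℕ p ≡ fromℤ (+ m ℤ.- + r)
    xp≡m-r = begin
      x * fromℕ p             ≡⟨ cong (λ d → x * fromℕ d) (ℕ.*-identityʳ p) ⟨
      x * fromℕ (p ℕ.^ 1)     ≡⟨ ÷-cancel (fromℕ m - fromℕ r) (fromℕ (p ℕ.^ 1)) {{nz}} ⟩
      fromℕ m - fromℕ r       ≡⟨ cong (λ y → fromℕ m + y) (fromℤ-neg (+ r)) ⟨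
      fromℕ m + fromℤ (ℤ.- + r)  ≡⟨ fromℤ-+ (+ m) (ℤ.- + r) ⟨
      fromℤ (+ m ℤ.- + r)     ∎
    abs : ℤ.∣ + m ℤ.- + r ∣ ≡ r ℕ.∸ m
    abs = trans (cong ℤ.∣_∣ (ℤ.m-n≡m⊖n m r)) (ℤ.∣⊖∣-≤ (ℕ.<⇒≤ m<r))

  C-nonZero : ∀ n k → k ℕ.≤ n → ℕ.NonZero (n C k)
  C-nonZero n       zero    _            = _
  C-nonZero (suc n) (suc k) (ℕ.s≤s k≤n) =
    subst ℕ.NonZero (nCk+nC[k+1]≡[n+1]C[k+1] n k) (ℕ.>-nonZero (ℕ.<-≤-trans C>0 (ℕ.m≤m+n (n C k) _)))
    where
    C>0 : 0 ℕ.< n C k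
    C>0 = ℕ.>-nonZero⁻¹ (n C k) {{C-nonZero n k k≤n}}

binom[½a,n]²-nonZero : ∀ {p a r} n .{{_ : ℕ.NonZero p}} → Prime p → r IsResidueOf a Mod p →
                        r ≡ 2 ℕ.* n → NonZero (binom (½ * a) n ²)
binom[½a,n]²-nonZero {p} {a} n pr res refl = ≢-nonZero (*-≢0 binom≢0 binom≢0)
  where
  open ≡-Reasoning
  factor≢0 : ∀ i → i ℕ.< n → ½ * a - fromℕ i ≢ 0ℚ
  factor≢0 i i<n eq = residue≢smaller pr res (i ℕ.* 2) i*2<2*n (begin
    a                    ≡⟨ *-identityˡ a ⟨
    2 * ½ * a            ≡⟨ *-assoc 2 ½ a ⟩
    2 * (½ * a)          ≡⟨ *-comm 2 (½ * a) ⟩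
    ½ * a * 2            ≡⟨ cong (_* 2) (x∙y⁻¹≈ε⇒x≈y (½ * a) (fromℕ i) eq) ⟩
    fromℕ i * 2          ≡⟨ fromℤ-* (+ i) (+ 2) ⟨
    fromℤ (+ i ℤ.* + 2)  ≡⟨ cong fromℤ (ℤ.pos-* i 2) ⟨
    fromℕ (i ℕ.* 2)      ∎)
    where
    i*2<2*n : i ℕ.* 2 ℕ.< 2 ℕ.* n
    i*2<2*n = subst (ℕ._< 2 ℕ.* n) (ℕ.*-comm 2 i) (ℕ.*-monoʳ-< 2 {{ℕ.nonZero}} i<n)
  falling≢0 : ∀ k → k ℕ.≤ n → fallingFactorial (½ * a) k ≢ 0ℚ
  falling≢0 zero    _   ()
  falling≢0 (suc k) k<n = *-≢0 (falling≢0 k (ℕ.<⇒≤ k<n)) (factor≢0 k k<n)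
  binom≢0 : binom (½ * a) n ≢ 0ℚ
  binom≢0 = ÷-≢0 (fromℕ (n !)) {{n ℕ.!≢0}} (falling≢0 n ℕ.≤-refl)

a²C²-nonZero : ∀ {p a} n k .{{_ : ℕ.NonZero p}} → a ∈ℤ₍ p ₎ →
               ¬ (a ≡ 0 [mod p ^ 1 ]) → k ℕ.≤ n → NonZero (a ² * fromℕ (n C k) ²)
a²C²-nonZero {p} {a} n k a∈ a≢0 k≤n = ≢-nonZero (*-≢0 (*-≢0 a≢0ℚ a≢0ℚ) (*-≢0 C≢0 C≢0))
  where
  a≢0ℚ : a ≢ 0ℚ
  a≢0ℚ refl = a≢0 (congruent a∈ a∈ (subst (_∈ℤ₍ p ₎) (sym (*-zeroˡ ((1/ fromℕ (p ℕ.^ 1)) {{ℕ.m^n≢0 p 1}}))) a∈))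
  C≢0 : fromℕ (n C k) ≢ 0ℚ
  C≢0 eq = ℕ.≢-nonZero⁻¹ (n C k) {{C-nonZero n k k≤n}} (ℤ.+-injective (cong ↥_ eq))

⌊[r∸1]/2⌋≤⌊[p∸1]/2⌋ : ∀ {p a r} .{{_ : ℕ.NonZero p}} → r IsResidueOf a Mod p →
                       ℕ.⌊ r ℕ.∸ 1 /2⌋ ℕ.≤ ℕ.⌊ p ℕ.∸ 1 /2⌋
⌊[r∸1]/2⌋≤⌊[p∸1]/2⌋ res = ℕ.⌊n/2⌋-mono (ℕ.∸-monoˡ-≤ 1 (ℕ.<⇒≤ (_IsResidueOf_Mod_.bounded res)))

{-# OPTIONS --safe #-}
module Submission where

open import Defs
open import Data.Integer.Base as ℤ using (ℤ; +_; -[1+_])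
import Data.Integer.Divisibility.Signed as ℤ
import Data.Integer.Properties as ℤ
open import Data.Nat.Base as ℕ using (ℕ; zero; suc; _!)
open import Data.Nat.Combinatorics using (_C_; nCk≡n!/k![n-k]!; k![n∸k]!∣n!)
open import Data.Nat.Coprimality as Coprime using (coprime-divisor)
open import Data.Nat.DivMod using (m/n*n≡m)
open import Data.Nat.Divisibility using (_∣_; divides; ∣-trans; >⇒∤; ∣1⇒≡1)
open import Data.Nat.Primality using (Prime; euclidsLemma; ¬prime[1])
open import Data.Nat.Properties using (⌊n/2⌋≤n)
import Data.Nat.Properties as ℕ
import Data.Nat.Tactic.RingSolver as ℕ
open import Data.Product.Base using (∃; _×_; _,_; proj₁; proj₂)
open import Data.Rational.Base
open import Data.Rational.Literals using (fromℤ)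
open import Data.Rational.Properties hiding (module ≤-Reasoning)
import Data.Rational.Unnormalised.Base as ℚᵘ
import Data.Rational.Unnormalised.Properties as ℚᵘ
open import Data.Sum.Base using (inj₁; inj₂; [_,_]′)
open import Function.Base using (_∘_)
open import Level using (0ℓ)
open import Relation.Binary.Bundles using (Setoid)
open import Relation.Binary.PropositionalEquality
import Relation.Binary.Reasoning.Setoid as SetoidReasoning
open import Relation.Nullary.Decidable.Core using (dec⇒maybe)
open import Relation.Nullary.Negation.Core using (¬_; contradiction)
import Tactic.RingSolver as Ring
open import Tactic.RingSolver.Core.AlmostCommutativeRing using (AlmostCommutativeRing; fromCommutativeRing)

-- With F(a, k) the k-th term of S, the difference a² F(a, k) − (a − 1)² F(a − 2, k) telescopes, and for n = p
-- the remainder (2a − 1) V a (p − 1) is divisible by p³ whenever 2 ≤ ⟨a⟩ₚ. So S_p(a) descends to S_p(pt)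
-- when ⟨a⟩ₚ is even, and to S_p(1 + pt) when it is odd; there one more step, with V ≡ p²t, leads to S_p(−pt) ≡ 1.
-- Modulo p³, S_p(pt) is a quadratic polynomial in t with constant term 1, so it is determined by t = −1, where
-- descent from S_p(p − 1) = S_p(−p) gives Morley's 4^(p−1), and by t = 1, where S_p vanishes at the odd numbers
-- below p and S_p(p) = (C(2p, p) / 2)² / 4^(p−1) exactly.
-- The second congruence of part (1) compares products of factors 1 + p x by means of their logarithms modulo p³.

-- In rising factorials, V(a, n) = (a)ₙ (1 - a)ₙ (3/2)ₙ / n!³. One such product serves both sums
-- because F(a, k) is invariant under a ↦ -1 - a: hence F(a - 2, k) = F(1 - a, k), and V is
-- invariant under a ↦ 1 - a. The coefficients of the quadratic polynomial in t are sums of C(2k, k)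
-- / (4^k k) and of C(2k, k) / (4^k k²); interpolation avoids evaluating them. The outcome is the
-- truncation of (1 + u)^(-2t) with u = 2^(p-1) - 1, which explains the coefficients -2a′ and a′(2a′
-- + 1) in the statement. The prime 3 is the obstacle: the congruences for C(p - 1, (p - 1)/2) and
-- C(2p, p)/2 modulo p³ rest on the sum of the 1/k² being 0 modulo p, which fails for p = 3. They
-- enter only when ⟨a⟩ₚ is even, and then 0 < ⟨a⟩ₚ < p - 1 forces p ≥ 5. When ⟨a⟩ₚ is odd a factor
-- p² stands in front, its cofactors matter only modulo p, and p = 3 is covered.

ℚ-ring : AlmostCommutativeRing 0ℓ 0ℓ
ℚ-ring = fromCommutativeRing +-*-commutativeRing λ x → dec⇒maybe (0ℚ ≟ x)

-- Casts into the rationals, and reciprocals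

fromℤ-+ : ∀ i j → fromℤ (i ℤ.+ j) ≡ fromℤ i + fromℤ j
fromℤ-+ i j = begin
  fromℤ (i ℤ.+ j)                ≡⟨ ↥p/↧p≡p (fromℤ (i ℤ.+ j)) ⟨
  (i ℤ.+ j) / 1                  ≡⟨ cong₂ (λ m n → (m ℤ.+ n) / 1) (ℤ.*-identityʳ i) (ℤ.*-identityʳ j) ⟨
  (i ℤ.* + 1 ℤ.+ j ℤ.* + 1) / 1  ∎
  where open ≡-Reasoning

fromℤ-* : ∀ i j → fromℤ (i ℤ.* j) ≡ fromℤ i * fromℤ j
fromℤ-* i j = sym (↥p/↧p≡p (fromℤ (i ℤ.* j)))

fromℤ-neg : ∀ i → fromℤ (ℤ.- i) ≡ - fromℤ i
fromℤ-neg (+ zero)    = refl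
fromℤ-neg ℤ.+[1+ n ]  = refl
fromℤ-neg ℤ.-[1+ n ]  = refl

fromℕ-+ : ∀ m n → fromℕ (m ℕ.+ n) ≡ fromℕ m + fromℕ n
fromℕ-+ m n = fromℤ-+ (+ m) (+ n)

fromℕ-* : ∀ m n → fromℕ (m ℕ.* n) ≡ fromℕ m * fromℕ n
fromℕ-* m n = trans (cong fromℤ (ℤ.pos-* m n)) (fromℤ-* (+ m) (+ n))

fromℕ-suc : ∀ n → fromℕ (suc n) ≡ 1 + fromℕ n
fromℕ-suc = fromℕ-+ 1

fromℕ-double : ∀ n → fromℕ (2 ℕ.* n) ≡ 2 * fromℕ n
fromℕ-double = fromℕ-* 2

÷-*-cancel : ∀ x y .{{_ : NonZero y}} → (x ÷ y) * y ≡ x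
÷-*-cancel x y = begin
  x * 1/ y * y    ≡⟨ *-assoc x (1/ y) y ⟩
  x * (1/ y * y)  ≡⟨ cong (x *_) (*-inverseˡ y) ⟩
  x * 1ℚ          ≡⟨ *-identityʳ x ⟩
  x               ∎
  where open ≡-Reasoning

÷-unique : ∀ {x y z} .{{_ : NonZero y}} → z * y ≡ x → x ÷ y ≡ z
÷-unique {x} {y} {z} refl = begin
  z * y * 1/ y    ≡⟨ *-assoc z y (1/ y) ⟩
  z * (y * 1/ y)  ≡⟨ cong (z *_) (*-inverseʳ y) ⟩
  z * 1ℚ          ≡⟨ *-identityʳ z ⟩
  z               ∎
  where open ≡-Reasoning

*-cancelʳ : ∀ {x z} y .{{_ : NonZero y}} → x * y ≡ z * y → x ≡ z
*-cancelʳ y eq = trans (sym (÷-unique eq)) (÷-unique refl)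

-- The shift by one makes this the summand of `H`, so that `H n` is `∑ n inv` by computation.
inv : ℕ → ℚ
inv k = 1 ÷ fromℕ (suc k)

inv-* : ∀ k → inv k * fromℕ (suc k) ≡ 1
inv-* k = ÷-*-cancel 1 (fromℕ (suc k))

inv-*′ : ∀ k → inv k * (1 + fromℕ k) ≡ 1
inv-*′ k = trans (cong (inv k *_) (sym (fromℕ-suc k))) (inv-* k)

inv-² : ∀ k → 1 ÷ fromℕ (suc k ℕ.^ 2) ≡ inv k * inv k
inv-² k = ÷-unique (begin
  inv k * inv k * fromℕ (suc k ℕ.^ 2)
    ≡⟨ cong (inv k * inv k *_) (fromℕ-* (suc k) (suc k ℕ.* 1)) ⟩
  inv k * inv k * (fromℕ (suc k) * fromℕ (suc k ℕ.* 1))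
    ≡⟨ cong (λ n → inv k * inv k * (fromℕ (suc k) * fromℕ n)) (ℕ.*-identityʳ (suc k)) ⟩
  inv k * inv k * (fromℕ (suc k) * fromℕ (suc k))
    ≡⟨ rearrange (inv k) (fromℕ (suc k)) ⟩
  inv k * fromℕ (suc k) * (inv k * fromℕ (suc k))
    ≡⟨ cong₂ _*_ (inv-* k) (inv-* k) ⟩
  1 ∎)
  where
  open ≡-Reasoning
  rearrange : ∀ i x → i * i * (x * x) ≡ i * x * (i * x)
  rearrange = Ring.solve-∀ ℚ-ring

inv-double : ∀ k → inv (2 ℕ.* k ℕ.+ 1) ≡ ½ * inv k
inv-double k = ÷-unique (begin
  ½ * inv k * fromℕ (suc (2 ℕ.* k ℕ.+ 1))  ≡⟨ cong (λ n → ½ * inv k * fromℕ n) (twice k) ⟩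
  ½ * inv k * fromℕ (2 ℕ.* suc k)          ≡⟨ cong (½ * inv k *_) (fromℕ-double (suc k)) ⟩
  ½ * inv k * (2 * fromℕ (suc k))          ≡⟨ rearrange (inv k) (fromℕ (suc k)) ⟩
  inv k * fromℕ (suc k)                    ≡⟨ inv-* k ⟩
  1                                        ∎)
  where
  open ≡-Reasoning
  twice : ∀ k → suc (2 ℕ.* k ℕ.+ 1) ≡ 2 ℕ.* suc k
  twice = ℕ.solve-∀
  rearrange : ∀ i x → ½ * i * (2 * x) ≡ i * x
  rearrange = Ring.solve-∀ ℚ-ring

odd : ℕ → ℚ
odd k = 2 * fromℕ k + 1

-- Finite products and sums

∏ : ℕ → (ℕ → ℚ) → ℚ
∏ zero    f = 1
∏ (suc n) f = ∏ n f * f n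

∏-cong : ∀ n {f g} → (∀ i → i ℕ.< n → f i ≡ g i) → ∏ n f ≡ ∏ n g
∏-cong zero    f≡g = refl
∏-cong (suc n) f≡g = cong₂ _*_ (∏-cong n λ i i<n → f≡g i (ℕ.m<n⇒m<1+n i<n)) (f≡g n ℕ.≤-refl)

∏-* : ∀ n f g → ∏ n (λ i → f i * g i) ≡ ∏ n f * ∏ n g
∏-* zero    f g = refl
∏-* (suc n) f g = trans (cong (_* (f n * g n)) (∏-* n f g)) (swap (∏ n f) (∏ n g) (f n) (g n))
  where
  swap : ∀ a b c d → a * b * (c * d) ≡ a * c * (b * d)
  swap = Ring.solve-∀ ℚ-ring

∏-head : ∀ n f → ∏ (suc n) f ≡ f 0 * ∏ n (f ∘ suc)
∏-head zero    f = trans (*-identityˡ (f 0)) (sym (*-identityʳ (f 0)))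
∏-head (suc n) f = trans (cong (_* f (suc n)) (∏-head n f)) (*-assoc (f 0) _ (f (suc n)))

-- Mirror indices are tied by 1 + i + j = n instead of j = n - 1 - i. This keeps truncated
-- subtraction out: the caller replaces n by 1 + i + j and is left with a polynomial identity.
∏-reverse : ∀ n f g → (∀ i j → suc (i ℕ.+ j) ≡ n → f i ≡ g j) → ∏ n f ≡ ∏ n g
∏-reverse zero    f g f≡g = refl
∏-reverse (suc n) f g f≡g = begin
  ∏ n f * f n             ≡⟨ cong₂ _*_ ih (f≡g n 0 (cong suc (ℕ.+-identityʳ n))) ⟩
  ∏ n (g ∘ suc) * g 0     ≡⟨ *-comm _ (g 0) ⟩
  g 0 * ∏ n (g ∘ suc)     ≡⟨ ∏-head n g ⟨
  ∏ (suc n) g             ∎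
  where
  open ≡-Reasoning
  ih = ∏-reverse n f (g ∘ suc) λ i j eq → f≡g i (suc j) (cong suc (trans (ℕ.+-suc i j) eq))

∏-one : ∀ n {f} → (∀ i → i ℕ.< n → f i ≡ 1) → ∏ n f ≡ 1
∏-one zero    f≡1 = refl
∏-one (suc n) f≡1 = cong₂ _*_ (∏-one n λ i i<n → f≡1 i (ℕ.m<n⇒m<1+n i<n)) (f≡1 n ℕ.≤-refl)

∏-² : ∀ n f → ∏ n f * ∏ n f ≡ ∏ n (λ i → f i * f i)
∏-² n f = sym (∏-* n f f)

∏-const : ∀ n c → ∏ n (λ _ → fromℕ c) ≡ fromℕ (c ℕ.^ n)
∏-const zero    c = refl
∏-const (suc n) c = begin
  ∏ n (λ _ → fromℕ c) * fromℕ c  ≡⟨ cong (_* fromℕ c) (∏-const n c) ⟩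
  fromℕ (c ℕ.^ n) * fromℕ c      ≡⟨ *-comm (fromℕ (c ℕ.^ n)) (fromℕ c) ⟩
  fromℕ c * fromℕ (c ℕ.^ n)      ≡⟨ fromℕ-* c (c ℕ.^ n) ⟨
  fromℕ (c ℕ.^ suc n)            ∎
  where open ≡-Reasoning

∏-double-const : ∀ n f → ∏ (2 ℕ.* n) (λ _ → f) ≡ ∏ n (λ _ → f * f)
∏-double-const zero f = refl
∏-double-const (suc n) f rewrite ℕ.+-suc n (n ℕ.+ 0) =
  trans (*-assoc (∏ (2 ℕ.* n) (λ _ → f)) f f) (cong (_* (f * f)) (∏-double-const n f))

∑-cong : ∀ n {f g} → (∀ i → i ℕ.< n → f i ≡ g i) → ∑ n f ≡ ∑ n g
∑-cong zero    f≡g = refl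
∑-cong (suc n) f≡g = cong₂ _+_ (∑-cong n λ i i<n → f≡g i (ℕ.m<n⇒m<1+n i<n)) (f≡g n ℕ.≤-refl)

∑-+ : ∀ n f g → ∑ n (λ i → f i + g i) ≡ ∑ n f + ∑ n g
∑-+ zero    f g = refl
∑-+ (suc n) f g = trans (cong (_+ (f n + g n)) (∑-+ n f g)) (swap (∑ n f) (∑ n g) (f n) (g n))
  where
  swap : ∀ a b c d → a + b + (c + d) ≡ a + c + (b + d)
  swap = Ring.solve-∀ ℚ-ring

∑-*ˡ : ∀ n c f → ∑ n (λ i → c * f i) ≡ c * ∑ n f
∑-*ˡ zero    c f = sym (*-zeroʳ c)
∑-*ˡ (suc n) c f = trans (cong (_+ c * f n) (∑-*ˡ n c f)) (sym (*-distribˡ-+ c (∑ n f) (f n)))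

∑-head : ∀ n f → ∑ (suc n) f ≡ f 0 + ∑ n (f ∘ suc)
∑-head zero    f = trans (+-identityˡ (f 0)) (sym (+-identityʳ (f 0)))
∑-head (suc n) f = trans (cong (_+ f (suc n)) (∑-head n f)) (+-assoc (f 0) _ (f (suc n)))

∑-append : ∀ m n f → ∑ (n ℕ.+ m) f ≡ ∑ m f + ∑ n (λ i → f (i ℕ.+ m))
∑-append m zero    f = sym (+-identityʳ (∑ m f))
∑-append m (suc n) f = trans (cong (_+ f (n ℕ.+ m)) (∑-append m n f)) (+-assoc (∑ m f) _ (f (n ℕ.+ m)))

∑-parity : ∀ n f → ∑ (2 ℕ.* n) f ≡ ∑ n (λ i → f (2 ℕ.* i)) + ∑ n (λ i → f (2 ℕ.* i ℕ.+ 1))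
∑-parity zero    f = refl
∑-parity (suc n) f rewrite ℕ.+-suc n (n ℕ.+ 0) | ℕ.+-comm 1 (2 ℕ.* n) =
  trans (cong (λ s → s + f (2 ℕ.* n) + f (2 ℕ.* n ℕ.+ 1)) (∑-parity n f))
        (swap (∑ n (λ i → f (2 ℕ.* i))) (∑ n (λ i → f (2 ℕ.* i ℕ.+ 1))) (f (2 ℕ.* n)) (f (2 ℕ.* n ℕ.+ 1)))
  where
  swap : ∀ a b c d → a + b + c + d ≡ a + c + (b + d)
  swap = Ring.solve-∀ ℚ-ring

-- (2m)! / m! computed in two ways
∏-upper-half : ∀ m → ∏ m (λ k → 1 + fromℕ m + fromℕ k) ≡ ∏ m (λ k → 2 * odd k)
∏-upper-half zero    = refl
∏-upper-half (suc m) = begin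
  ∏ m (λ k → 1 + fromℕ (suc m) + fromℕ k) * (1 + fromℕ (suc m) + fromℕ m)
    ≡⟨ cong₂ _*_ (∏-cong m λ k _ → shift k) (cong (λ x → 1 + x + fromℕ m) (fromℕ-suc m)) ⟩
  g * (1 + (1 + fromℕ m) + fromℕ m)
    ≡⟨ rearrange g (fromℕ m) ⟩
  2 * ((1 + fromℕ m + 0) * g)
    ≡⟨ cong (2 *_) (∏-head m (λ k → 1 + fromℕ m + fromℕ k)) ⟨
  2 * (∏ m (λ k → 1 + fromℕ m + fromℕ k) * (1 + fromℕ m + fromℕ m))
    ≡⟨ cong (λ x → 2 * (x * (1 + fromℕ m + fromℕ m))) (∏-upper-half m) ⟩
  2 * (∏ m (λ k → 2 * odd k) * (1 + fromℕ m + fromℕ m))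
    ≡⟨ rearrange′ (∏ m (λ k → 2 * odd k)) (fromℕ m) ⟩
  ∏ m (λ k → 2 * odd k) * (2 * odd m) ∎
  where
  open ≡-Reasoning
  g = ∏ m (λ k → 1 + fromℕ m + fromℕ (suc k))
  shift : ∀ k → 1 + fromℕ (suc m) + fromℕ k ≡ 1 + fromℕ m + fromℕ (suc k)
  shift k = trans (cong (λ x → 1 + x + fromℕ k) (fromℕ-suc m))
              (trans (assoc (fromℕ m) (fromℕ k)) (cong (λ x → 1 + fromℕ m + x) (sym (fromℕ-suc k))))
    where
    assoc : ∀ x y → 1 + (1 + x) + y ≡ 1 + x + (1 + y)
    assoc = Ring.solve-∀ ℚ-ring
  rearrange : ∀ g x → g * (1 + (1 + x) + x) ≡ 2 * ((1 + x + 0) * g)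
  rearrange = Ring.solve-∀ ℚ-ring
  rearrange′ : ∀ g x → 2 * (g * (1 + x + x)) ≡ g * (2 * (2 * x + 1))
  rearrange′ = Ring.solve-∀ ℚ-ring

∏-zero : ∀ n {f} j → j ℕ.< n → f j ≡ 0 → ∏ n f ≡ 0
∏-zero (suc n) {f} j j<1+n fj≡0 with ℕ.m≤n⇒m<n∨m≡n (ℕ.s≤s⁻¹ j<1+n)
... | inj₁ j<n  = trans (cong (_* f n) (∏-zero n j j<n fj≡0)) (*-zeroˡ (f n))
... | inj₂ refl = trans (cong (∏ n f *_) fj≡0) (*-zeroʳ (∏ n f))

-- The sum and its recurrence in a

-- With the upper index written as a sum, the factorial formula contains no truncated subtraction;
-- `central-suc` and `C-suc` follow by cancelling factorials.
C-*-!! : ∀ n k → ((n ℕ.+ k) C k) ℕ.* (k ! ℕ.* n !) ≡ (n ℕ.+ k) !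
C-*-!! n k = begin
  ((n ℕ.+ k) C k) ℕ.* (k ! ℕ.* n !)
    ≡⟨ cong (λ m → ((n ℕ.+ k) C k) ℕ.* (k ! ℕ.* m !)) (ℕ.m+n∸n≡m n k) ⟨
  ((n ℕ.+ k) C k) ℕ.* (k ! ℕ.* (n ℕ.+ k ℕ.∸ k) !)
    ≡⟨ cong (ℕ._* (k ! ℕ.* (n ℕ.+ k ℕ.∸ k) !)) (nCk≡n!/k![n-k]! k≤n+k) ⟩
  ((n ℕ.+ k) ! ℕ./ (k ! ℕ.* (n ℕ.+ k ℕ.∸ k) !)) ℕ.* (k ! ℕ.* (n ℕ.+ k ℕ.∸ k) !)
    ≡⟨ m/n*n≡m (k![n∸k]!∣n! k≤n+k) ⟩
  (n ℕ.+ k) ! ∎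
  where
  open ≡-Reasoning
  k≤n+k = ℕ.m≤n+m k n
  instance _ = k ℕ.!* (n ℕ.+ k ℕ.∸ k) !≢0

central-suc : ∀ k → ((2 ℕ.* suc k) C suc k) ℕ.* suc k ≡ 2 ℕ.* (2 ℕ.* k ℕ.+ 1) ℕ.* ((2 ℕ.* k) C k)
central-suc k = ℕ.*-cancelʳ-≡ _ _ (suc k ℕ.* (k ! ℕ.* k !)) {{nz}} (begin
  ((2 ℕ.* suc k) C suc k) ℕ.* suc k ℕ.* (suc k ℕ.* (k ! ℕ.* k !))
    ≡⟨ r₁ ((2 ℕ.* suc k) C suc k) (suc k) (k !) ⟩
  ((2 ℕ.* suc k) C suc k) ℕ.* (suc k ! ℕ.* suc k !)
    ≡⟨ cong (λ n → (n C suc k) ℕ.* (suc k ! ℕ.* suc k !)) (dbl (suc k)) ⟩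
  ((suc k ℕ.+ suc k) C suc k) ℕ.* (suc k ! ℕ.* suc k !)
    ≡⟨ C-*-!! (suc k) (suc k) ⟩
  (suc k ℕ.+ suc k) !
    ≡⟨ cong (λ n → suc n !) (ℕ.+-suc k k) ⟩
  suc (suc (k ℕ.+ k)) ℕ.* (suc (k ℕ.+ k) ℕ.* (k ℕ.+ k) !)
    ≡⟨ cong (λ n → suc (suc (k ℕ.+ k)) ℕ.* (suc (k ℕ.+ k) ℕ.* n)) (C-*-!! k k) ⟨
  suc (suc (k ℕ.+ k)) ℕ.* (suc (k ℕ.+ k) ℕ.* (((k ℕ.+ k) C k) ℕ.* (k ! ℕ.* k !)))
    ≡⟨ r₂ k ((k ℕ.+ k) C k) (k ! ℕ.* k !) ⟩
  2 ℕ.* (2 ℕ.* k ℕ.+ 1) ℕ.* ((k ℕ.+ k) C k) ℕ.* (suc k ℕ.* (k ! ℕ.* k !))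
    ≡⟨ cong (λ n → 2 ℕ.* (2 ℕ.* k ℕ.+ 1) ℕ.* (n C k) ℕ.* (suc k ℕ.* (k ! ℕ.* k !))) (dbl k) ⟨
  2 ℕ.* (2 ℕ.* k ℕ.+ 1) ℕ.* ((2 ℕ.* k) C k) ℕ.* (suc k ℕ.* (k ! ℕ.* k !)) ∎)
  where
  open ≡-Reasoning
  nz : ℕ.NonZero (suc k ℕ.* (k ! ℕ.* k !))
  nz = ℕ.m*n≢0 (suc k) (k ! ℕ.* k !) {{_}} {{k ℕ.!* k !≢0}}
  dbl : ∀ n → 2 ℕ.* n ≡ n ℕ.+ n
  dbl = ℕ.solve-∀
  r₁ : ∀ c s f → c ℕ.* s ℕ.* (s ℕ.* (f ℕ.* f)) ≡ c ℕ.* (s ℕ.* f ℕ.* (s ℕ.* f))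
  r₁ = ℕ.solve-∀
  r₂ : ∀ k c f → suc (suc (k ℕ.+ k)) ℕ.* (suc (k ℕ.+ k) ℕ.* (c ℕ.* f)) ≡
       2 ℕ.* (2 ℕ.* k ℕ.+ 1) ℕ.* c ℕ.* (suc k ℕ.* f)
  r₂ = ℕ.solve-∀

-- This is (1/2)ₖ / k!, the product of (2i + 1)/(2i + 2) over i < k; hence it is p-integral for k <
-- p and a p-unit for k ≤ (p - 1)/2.
central : ℕ → ℚ
central k = (fromℕ ((2 ℕ.* k) C k) ÷ fromℕ (4 ℕ.^ k)) {{ℕ.m^n≢0 4 k}}

central-rec : ∀ k → central (suc k) ≡ central k * (odd k * ½ * inv k)
central-rec k = ÷-unique {{ℕ.m^n≢0 4 (suc k)}} (begin
  central k * (odd k * ½ * inv k) * fromℕ (4 ℕ.* 4 ℕ.^ k)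
    ≡⟨ cong (λ n → central k * (odd k * ½ * inv k) * n) (fromℕ-* 4 (4 ℕ.^ k)) ⟩
  central k * (odd k * ½ * inv k) * (4 * fromℕ (4 ℕ.^ k))
    ≡⟨ r₁ (central k) (odd k) (inv k) (fromℕ (4 ℕ.^ k)) ⟩
  2 * odd k * (central k * fromℕ (4 ℕ.^ k)) * inv k
    ≡⟨ cong (λ x → 2 * odd k * x * inv k) (÷-*-cancel _ (fromℕ (4 ℕ.^ k)) {{ℕ.m^n≢0 4 k}}) ⟩
  2 * odd k * fromℕ ((2 ℕ.* k) C k) * inv k
    ≡⟨ cong (λ x → 2 * x * fromℕ ((2 ℕ.* k) C k) * inv k) odd-fromℕ ⟨
  2 * fromℕ (2 ℕ.* k ℕ.+ 1) * fromℕ ((2 ℕ.* k) C k) * inv k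
    ≡⟨ cong (λ x → x * fromℕ ((2 ℕ.* k) C k) * inv k) (fromℕ-double (2 ℕ.* k ℕ.+ 1)) ⟨
  fromℕ (2 ℕ.* (2 ℕ.* k ℕ.+ 1)) * fromℕ ((2 ℕ.* k) C k) * inv k
    ≡⟨ cong (_* inv k) (fromℕ-* (2 ℕ.* (2 ℕ.* k ℕ.+ 1)) ((2 ℕ.* k) C k)) ⟨
  fromℕ (2 ℕ.* (2 ℕ.* k ℕ.+ 1) ℕ.* ((2 ℕ.* k) C k)) * inv k
    ≡⟨ cong (λ n → fromℕ n * inv k) (central-suc k) ⟨
  fromℕ (((2 ℕ.* suc k) C suc k) ℕ.* suc k) * inv k
    ≡⟨ cong (_* inv k) (fromℕ-* ((2 ℕ.* suc k) C suc k) (suc k)) ⟩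
  fromℕ ((2 ℕ.* suc k) C suc k) * fromℕ (suc k) * inv k
    ≡⟨ r₂ (fromℕ ((2 ℕ.* suc k) C suc k)) (fromℕ (suc k)) (inv k) ⟩
  fromℕ ((2 ℕ.* suc k) C suc k) * (inv k * fromℕ (suc k))
    ≡⟨ cong (fromℕ ((2 ℕ.* suc k) C suc k) *_) (inv-* k) ⟩
  fromℕ ((2 ℕ.* suc k) C suc k) * 1
    ≡⟨ *-identityʳ _ ⟩
  fromℕ ((2 ℕ.* suc k) C suc k) ∎)
  where
  open ≡-Reasoning
  odd-fromℕ : fromℕ (2 ℕ.* k ℕ.+ 1) ≡ odd k
  odd-fromℕ = trans (fromℕ-+ (2 ℕ.* k) 1) (cong (_+ 1) (fromℕ-double k))
  r₁ : ∀ c o i f → c * (o * ½ * i) * (4 * f) ≡ 2 * o * (c * f) * i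
  r₁ = Ring.solve-∀ ℚ-ring
  r₂ : ∀ c s i → c * s * i ≡ c * (i * s)
  r₂ = Ring.solve-∀ ℚ-ring

central-∏ : ∀ n → central n ≡ ∏ n (λ i → odd i * ½ * inv i)
central-∏ zero    = refl
central-∏ (suc n) = trans (central-rec n) (cong (_* (odd n * ½ * inv n)) (central-∏ n))

binom-suc : ∀ a k → binom a (suc k) ≡ binom a k * ((a - fromℕ k) * inv k)
binom-suc a k = ÷-unique {{suc k ℕ.!≢0}} (begin
  binom a k * ((a - fromℕ k) * inv k) * fromℕ (suc k ℕ.* k !)
    ≡⟨ cong (binom a k * ((a - fromℕ k) * inv k) *_) (fromℕ-* (suc k) (k !)) ⟩
  binom a k * ((a - fromℕ k) * inv k) * (fromℕ (suc k) * fromℕ (k !))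
    ≡⟨ rearrange (binom a k) (a - fromℕ k) (inv k) (fromℕ (suc k)) (fromℕ (k !)) ⟩
  binom a k * fromℕ (k !) * (a - fromℕ k) * (inv k * fromℕ (suc k))
    ≡⟨ cong₂ (λ x y → x * (a - fromℕ k) * y) (÷-*-cancel (fallingFactorial a k) (fromℕ (k !)) {{k ℕ.!≢0}}) (inv-* k) ⟩
  fallingFactorial a (suc k) * 1
    ≡⟨ *-identityʳ _ ⟩
  fallingFactorial a (suc k) ∎)
  where
  open ≡-Reasoning
  rearrange : ∀ b x i s f → b * (x * i) * (s * f) ≡ b * f * x * (i * s)
  rearrange = Ring.solve-∀ ℚ-ring

binom-∏ : ∀ a n → binom a n ≡ ∏ n (λ i → (a - fromℕ i) * inv i)
binom-∏ a zero    = refl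
binom-∏ a (suc n) = trans (binom-suc a n) (cong (_* ((a - fromℕ n) * inv n)) (binom-∏ a n))

F : ℚ → ℕ → ℚ
F a k = binom a k * binom (- 1 - a) k * central k

S-F : ∀ n a → S n a ≡ ∑ n (F a)
S-F n a = ∑-cong n λ k _ → *-assoc (binom a k * binom (- 1 - a) k) _ _

F-rec : ∀ a k → F a (suc k) ≡ F a k * ((a - fromℕ k) * (- 1 - a - fromℕ k) * odd k * ½ * (inv k * inv k * inv k))
F-rec a k = begin
  F a (suc k)
    ≡⟨ cong₂ _*_ (cong₂ _*_ (binom-suc a k) (binom-suc (- 1 - a) k)) (central-rec k) ⟩
  binom a k * ((a - fromℕ k) * inv k) * (binom (- 1 - a) k * ((- 1 - a - fromℕ k) * inv k)) * (central k * (odd k * ½ * inv k))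
    ≡⟨ rearrange (binom a k) (a - fromℕ k) (inv k) (binom (- 1 - a) k) (- 1 - a - fromℕ k) (central k) (odd k) ⟩
  F a k * ((a - fromℕ k) * (- 1 - a - fromℕ k) * odd k * ½ * (inv k * inv k * inv k)) ∎
  where
  open ≡-Reasoning
  rearrange : ∀ b x i b′ x′ c o → b * (x * i) * (b′ * (x′ * i)) * (c * (o * ½ * i)) ≡
              b * b′ * c * (x * x′ * o * ½ * (i * i * i))
  rearrange = Ring.solve-∀ ℚ-ring

F-symmetric : ∀ a k → F (- 1 - a) k ≡ F a k
F-symmetric a k = begin
  binom (- 1 - a) k * binom (- 1 - (- 1 - a)) k * central k
    ≡⟨ cong (λ x → binom (- 1 - a) k * binom x k * central k) (involutive a) ⟩
  binom (- 1 - a) k * binom a k * central k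
    ≡⟨ cong (_* central k) (*-comm (binom (- 1 - a) k) (binom a k)) ⟩
  F a k ∎
  where
  open ≡-Reasoning
  involutive : ∀ a → - 1 - (- 1 - a) ≡ a
  involutive = Ring.solve-∀ ℚ-ring

S-symmetric : ∀ n a → S n (- 1 - a) ≡ S n a
S-symmetric n a = begin
  S n (- 1 - a)        ≡⟨ S-F n (- 1 - a) ⟩
  ∑ n (F (- 1 - a))    ≡⟨ ∑-cong n (λ k _ → F-symmetric a k) ⟩
  ∑ n (F a)            ≡⟨ S-F n a ⟨
  S n a                ∎
  where open ≡-Reasoning

-- (2 a - 1) * V a n is the remainder of the telescoping sum in S-recurrence.
V : ℚ → ℕ → ℚ
V a n = ∏ n λ j → (a + fromℕ j) * (fromℕ j + 1 - a) * (2 * fromℕ j + 3) * (½ * (inv j * inv j * inv j))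

-- Up to sign, the numerators of the two binomials multiply to a(a + 1)...(a + j + 1) times (a -
-- 1)...(a - j). `V a j` contains all of these except the last two ascending factors.
F-V : ∀ a j → F a (suc j) ≡ - ½ * (inv j * inv j * inv j) * ((a + fromℕ j + 1) * (a + fromℕ j)) * V a j
F-V a zero = trans (F-rec a 0) (base a)
  where
  base : ∀ a → 1 * ((a - 0) * (- 1 - a - 0) * 1 * ½ * 1) ≡ - ½ * 1 * ((a + 0 + 1) * (a + 0)) * 1
  base = Ring.solve-∀ ℚ-ring
F-V a (suc j) = begin
  F a (suc (suc j))
    ≡⟨ F-rec a (suc j) ⟩
  F a (suc j) * step (fromℕ (suc j))
    ≡⟨ cong₂ _*_ (F-V a j) (cong step (fromℕ-suc j)) ⟩
  - ½ * (inv j * inv j * inv j) * ((a + fromℕ j + 1) * (a + fromℕ j)) * V a j * step (1 + fromℕ j)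
    ≡⟨ rearrange a (fromℕ j) (inv j) (inv (suc j)) (V a j) ⟩
  rhs (1 + fromℕ j)
    ≡⟨ cong rhs (fromℕ-suc j) ⟨
  rhs (fromℕ (suc j)) ∎
  where
  open ≡-Reasoning
  step rhs : ℚ → ℚ
  step x = (a - x) * (- 1 - a - x) * (2 * x + 1) * ½ * (inv (suc j) * inv (suc j) * inv (suc j))
  rhs x = - ½ * (inv (suc j) * inv (suc j) * inv (suc j)) * ((a + x + 1) * (a + x)) * V a (suc j)
  rearrange : ∀ a x i i′ v →
    - ½ * (i * i * i) * ((a + x + 1) * (a + x)) * v * ((a - (1 + x)) * (- 1 - a - (1 + x)) * (2 * (1 + x) + 1) * ½ * (i′ * i′ * i′)) ≡
    - ½ * (i′ * i′ * i′) * ((a + (1 + x) + 1) * (a + (1 + x))) * (v * ((a + x) * (x + 1 - a) * (2 * x + 3) * (½ * (i * i * i))))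
  rearrange = Ring.solve-∀ ℚ-ring

V-reflect : ∀ a n → V (1 - a) n ≡ V a n
V-reflect a n = ∏-cong n λ j _ → factor a (fromℕ j) (½ * (inv j * inv j * inv j))
  where
  factor : ∀ a x i → (1 - a + x) * (x + 1 - (1 - a)) * (2 * x + 3) * i ≡ (a + x) * (x + 1 - a) * (2 * x + 3) * i
  factor = Ring.solve-∀ ℚ-ring

-- The symmetry of F carries a - 2 to 1 - a, where `F-V` applies, and `V-reflect` brings its V back
-- to parameter a.
F-shift-V : ∀ a j → F (a - 2) (suc j) ≡ - ½ * (inv j * inv j * inv j) * ((a - fromℕ j - 1) * (a - fromℕ j - 2)) * V a j
F-shift-V a j = begin
  F (a - 2) (suc j)
    ≡⟨ F-symmetric (a - 2) (suc j) ⟨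
  F (- 1 - (a - 2)) (suc j)
    ≡⟨ cong (λ b → F b (suc j)) (reflect a) ⟩
  F (1 - a) (suc j)
    ≡⟨ F-V (1 - a) j ⟩
  - ½ * (inv j * inv j * inv j) * ((1 - a + fromℕ j + 1) * (1 - a + fromℕ j)) * V (1 - a) j
    ≡⟨ cong₂ (λ x y → - ½ * (inv j * inv j * inv j) * x * y) (flip a (fromℕ j)) (V-reflect a j) ⟩
  - ½ * (inv j * inv j * inv j) * ((a - fromℕ j - 1) * (a - fromℕ j - 2)) * V a j ∎
  where
  open ≡-Reasoning
  reflect : ∀ a → - 1 - (a - 2) ≡ 1 - a
  reflect = Ring.solve-∀ ℚ-ring
  flip : ∀ a x → (1 - a + x + 1) * (1 - a + x) ≡ (a - x - 1) * (a - x - 2)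
  flip = Ring.solve-∀ ℚ-ring

-- The increments of both sums are multiples of `V a m` by the two preceding formulas. What remains
-- is a² F(a, m + 1) - (a - 1)² F(a - 2, m + 1) = (2a - 1)(V(a, m + 1) - V(a, m)), a polynomial
-- identity after division by `V a m`.
∑F-recurrence : ∀ a m → a * a * ∑ (suc m) (F a) ≡ (a - 1) * (a - 1) * ∑ (suc m) (F (a - 2)) + (2 * a - 1) * V a m
∑F-recurrence a zero = base a
  where
  base : ∀ a → a * a * (0 + 1) ≡ (a - 1) * (a - 1) * (0 + 1) + (2 * a - 1) * 1
  base = Ring.solve-∀ ℚ-ring
∑F-recurrence a (suc m) = begin
  a * a * (∑ (suc m) (F a) + F a (suc m))
    ≡⟨ *-distribˡ-+ (a * a) _ _ ⟩
  a * a * ∑ (suc m) (F a) + a * a * F a (suc m)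
    ≡⟨ cong₂ (λ x y → x + a * a * y) (∑F-recurrence a m) (F-V a m) ⟩
  (a - 1) * (a - 1) * s + (2 * a - 1) * V a m + a * a * (- ½ * (i * i * i) * ((a + x + 1) * (a + x)) * V a m)
    ≡⟨ cong (λ v → (a - 1) * (a - 1) * s + (2 * a - 1) * v + a * a * (- ½ * (i * i * i) * ((a + x + 1) * (a + x)) * V a m)) V-unit ⟩
  (a - 1) * (a - 1) * s + (2 * a - 1) * (V a m * (i * (1 + x) * (i * (1 + x)) * (i * (1 + x)))) + a * a * (- ½ * (i * i * i) * ((a + x + 1) * (a + x)) * V a m)
    ≡⟨ rearrange a x i (V a m) s ⟩
  (a - 1) * (a - 1) * (s + - ½ * (i * i * i) * ((a - x - 1) * (a - x - 2)) * V a m) + (2 * a - 1) * V a (suc m)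
    ≡⟨ cong (λ y → (a - 1) * (a - 1) * (s + y) + (2 * a - 1) * V a (suc m)) (F-shift-V a m) ⟨
  (a - 1) * (a - 1) * (s + F (a - 2) (suc m)) + (2 * a - 1) * V a (suc m) ∎
  where
  open ≡-Reasoning
  x = fromℕ m
  i = inv m
  s = ∑ (suc m) (F (a - 2))
  -- The old remainder lacks the denominator (m + 1)³ of the other terms. Inserting ((m + 1)/(m +
  -- 1))³ puts i³ into every term, and the ring solver can then treat i as a variable.
  V-unit : V a m ≡ V a m * (i * (1 + x) * (i * (1 + x)) * (i * (1 + x)))
  V-unit = sym (trans (cong (λ y → V a m * (y * y * y)) (inv-*′ m)) (*-identityʳ (V a m)))
  rearrange : ∀ a x i v s →
    (a - 1) * (a - 1) * s + (2 * a - 1) * (v * (i * (1 + x) * (i * (1 + x)) * (i * (1 + x)))) + a * a * (- ½ * (i * i * i) * ((a + x + 1) * (a + x)) * v) ≡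
    (a - 1) * (a - 1) * (s + - ½ * (i * i * i) * ((a - x - 1) * (a - x - 2)) * v) + (2 * a - 1) * (v * ((a + x) * (x + 1 - a) * (2 * x + 3) * (½ * (i * i * i))))
  rearrange = Ring.solve-∀ ℚ-ring

S-recurrence : ∀ a m → a * a * S (suc m) a ≡ (a - 1) * (a - 1) * S (suc m) (a - 2) + (2 * a - 1) * V a m
S-recurrence a m = begin
  a * a * S (suc m) a              ≡⟨ cong (a * a *_) (S-F (suc m) a) ⟩
  a * a * ∑ (suc m) (F a)          ≡⟨ ∑F-recurrence a m ⟩
  (a - 1) * (a - 1) * ∑ (suc m) (F (a - 2)) + (2 * a - 1) * V a m
    ≡⟨ cong (λ s → (a - 1) * (a - 1) * s + (2 * a - 1) * V a m) (S-F (suc m) (a - 2)) ⟨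
  (a - 1) * (a - 1) * S (suc m) (a - 2) + (2 * a - 1) * V a m ∎
  where open ≡-Reasoning

-- The numerators are regrouped into pairs (a - i)(a + i), leaving a and a + j + 1 unpaired. For a =
-- P t every pair, divided by -i², is then 1 modulo P².
F-∏ : ∀ a j → F a (suc j) ≡
      - a * (a + (1 + fromℕ j)) * (central (suc j) * (inv j * inv j)) * ∏ j (λ i → 1 - a * a * (inv i * inv i))
F-∏ a zero = trans (F-rec a 0) (base a)
  where
  base : ∀ a → 1 * ((a - 0) * (- 1 - a - 0) * 1 * ½ * 1) ≡ - a * (a + (1 + 0)) * (½ * 1) * 1
  base = Ring.solve-∀ ℚ-ring
F-∏ a (suc j) = begin
  F a (suc (suc j))
    ≡⟨ F-rec a (suc j) ⟩
  F a (suc j) * ((a - fromℕ (suc j)) * (- 1 - a - fromℕ (suc j)) * o * ½ * (i′ * i′ * i′))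
    ≡⟨ cong₂ (λ f y → f * ((a - y) * (- 1 - a - y) * o * ½ * (i′ * i′ * i′))) (F-∏ a j) (fromℕ-suc j) ⟩
  - a * (a + (1 + x)) * (c * (i * i)) * Π * ((a - (1 + x)) * (- 1 - a - (1 + x)) * o * ½ * (i′ * i′ * i′))
    ≡⟨ rearrange a x i i′ c o Π ⟩
  - a * (a + (1 + (1 + x))) * (c * (o * ½ * i′) * (i′ * i′)) * (Π * (i * (1 + x) * (i * (1 + x)) - a * a * (i * i)))
    ≡⟨ cong (λ y → - a * (a + (1 + (1 + x))) * (c * (o * ½ * i′) * (i′ * i′)) * (Π * (y * y - a * a * (i * i)))) (inv-*′ j) ⟩
  - a * (a + (1 + (1 + x))) * (c * (o * ½ * i′) * (i′ * i′)) * (Π * (1 - a * a * (i * i)))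
    ≡⟨ cong₂ (λ y z → - a * (a + (1 + y)) * (z * (i′ * i′)) * (Π * (1 - a * a * (i * i)))) (fromℕ-suc j) (central-rec (suc j)) ⟨
  - a * (a + (1 + fromℕ (suc j))) * (central (suc (suc j)) * (i′ * i′)) * (Π * (1 - a * a * (i * i))) ∎
  where
  open ≡-Reasoning
  x = fromℕ j
  i = inv j
  i′ = inv (suc j)
  c = central (suc j)
  o = odd (suc j)
  Π = ∏ j (λ i → 1 - a * a * (inv i * inv i))
  rearrange : ∀ a x i i′ c o Π →
    - a * (a + (1 + x)) * (c * (i * i)) * Π * ((a - (1 + x)) * (- 1 - a - (1 + x)) * o * ½ * (i′ * i′ * i′)) ≡
    - a * (a + (1 + (1 + x))) * (c * (o * ½ * i′) * (i′ * i′)) * (Π * (i * (1 + x) * (i * (1 + x)) - a * a * (i * i)))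
  rearrange = Ring.solve-∀ ℚ-ring

-- Reduced denominators

*-fromℕ⇒cross : ∀ x d i → x * fromℕ d ≡ fromℤ i → ↥ x ℤ.* + d ≡ i ℤ.* ↧ x
*-fromℕ⇒cross x@record{} d i eq = begin
  ↥ x ℤ.* + d            ≡⟨ ℤ.*-identityʳ _ ⟨
  ↥ x ℤ.* + d ℤ.* + 1    ≡⟨ ℚᵘ.drop-*≡* (ℚᵘ.≃-trans (ℚᵘ.≃-sym (toℚᵘ-homo-* x (fromℕ d))) (ℚᵘ.≃-reflexive (cong toℚᵘ eq))) ⟩
  i ℤ.* (↧ x ℤ.* + 1)    ≡⟨ cong (i ℤ.*_) (ℤ.*-identityʳ (↧ x)) ⟩
  i ℤ.* ↧ x              ∎
  where open ≡-Reasoning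

x*↧x≡↥x : ∀ x → x * fromℕ (↧ₙ x) ≡ fromℤ (↥ x)
x*↧x≡↥x x@record{} = toℚᵘ-injective (ℚᵘ.≃-trans (toℚᵘ-homo-* x (fromℕ (↧ₙ x)))
  (ℚᵘ.*≡* (trans (ℤ.*-identityʳ _) (cong (↥ x ℤ.*_) (sym (ℤ.*-identityʳ (↧ x)))))))

-- Cross-multiplication shows that the reduced denominator divides numerator times d, and
-- coprimality removes the numerator. So any clearing integer prime to p certifies membership in ℤ₍
-- p ₎.
↧∣ : ∀ x d i → x * fromℕ d ≡ fromℤ i → ↧ₙ x ∣ d
↧∣ x@(mkℚ _ _ coprime) d i eq = coprime-divisor (Coprime.sym (Coprime.recompute coprime)) (divides ℤ.∣ i ∣ (begin
  ℤ.∣ ↥ x ∣ ℕ.* d        ≡⟨ ℤ.abs-* (↥ x) (+ d) ⟨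
  ℤ.∣ ↥ x ℤ.* + d ∣      ≡⟨ cong ℤ.∣_∣ (*-fromℕ⇒cross x d i eq) ⟩
  ℤ.∣ i ℤ.* ↧ x ∣        ≡⟨ ℤ.abs-* i (↧ x) ⟩
  ℤ.∣ i ∣ ℕ.* ↧ₙ x       ∎))
  where open ≡-Reasoning

-- p-integral rationals, units and congruences

module Congruences (p : ℕ) (p-prime : Prime p) where

  P : ℚ
  P = fromℕ p

  -- Any clearing denominator prime to p is accepted, not only the reduced one, so sums and products
  -- only multiply denominators and never reduce fractions.
  record Integral (x : ℚ) : Set where
    constructor integral
    field
      {numerator}   : ℤ
      {denominator} : ℕ
      p∤denominator : ¬ (p ∣ denominator)
      cleared       : x * fromℕ denominator ≡ fromℤ numerator

  fromIntegral : ∀ {x} → Integral x → x ∈ℤ₍ p ₎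
  fromIntegral {x} (integral {i} {d} p∤d eq) p∣↧x = p∤d (∣-trans p∣↧x (↧∣ x d i eq))

  toIntegral : ∀ {x} → x ∈ℤ₍ p ₎ → Integral x
  toIntegral {x} x∈ = integral x∈ (x*↧x≡↥x x)

  private
    p∤* : ∀ {m n} → ¬ (p ∣ m) → ¬ (p ∣ n) → ¬ (p ∣ m ℕ.* n)
    p∤* {m} {n} p∤m p∤n = [ p∤m , p∤n ]′ ∘ euclidsLemma m n p-prime

  p∤1 : ¬ (p ∣ 1)
  p∤1 p∣1 = ¬prime[1] (subst Prime (∣1⇒≡1 p∣1) p-prime)

  fromℕ-integral : ∀ n → Integral (fromℕ n)
  fromℕ-integral n = integral {numerator = + n} p∤1 (*-identityʳ (fromℕ n))

  *-integral : ∀ {x y} → Integral x → Integral y → Integral (x * y)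
  *-integral {x} {y} (integral {i} {d} p∤d eq) (integral {j} {e} p∤e eq′) =
    integral {numerator = i ℤ.* j} (p∤* p∤d p∤e) (begin
      x * y * fromℕ (d ℕ.* e)          ≡⟨ cong (x * y *_) (fromℕ-* d e) ⟩
      x * y * (fromℕ d * fromℕ e)      ≡⟨ swap x y (fromℕ d) (fromℕ e) ⟩
      x * fromℕ d * (y * fromℕ e)      ≡⟨ cong₂ _*_ eq eq′ ⟩
      fromℤ i * fromℤ j                ≡⟨ fromℤ-* i j ⟨
      fromℤ (i ℤ.* j)                  ∎)
    where
    open ≡-Reasoning
    swap : ∀ a b c d → a * b * (c * d) ≡ a * c * (b * d)
    swap = Ring.solve-∀ ℚ-ring

  +-integral : ∀ {x y} → Integral x → Integral y → Integral (x + y)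
  +-integral {x} {y} (integral {i} {d} p∤d eq) (integral {j} {e} p∤e eq′) =
    integral {numerator = i ℤ.* + e ℤ.+ j ℤ.* + d} (p∤* p∤d p∤e) (begin
      (x + y) * fromℕ (d ℕ.* e)                        ≡⟨ cong ((x + y) *_) (fromℕ-* d e) ⟩
      (x + y) * (fromℕ d * fromℕ e)                    ≡⟨ expand x y (fromℕ d) (fromℕ e) ⟩
      x * fromℕ d * fromℕ e + y * fromℕ e * fromℕ d    ≡⟨ cong₂ (λ u v → u * fromℕ e + v * fromℕ d) eq eq′ ⟩
      fromℤ i * fromℕ e + fromℤ j * fromℕ d            ≡⟨ cong₂ _+_ (fromℤ-* i (+ e)) (fromℤ-* j (+ d)) ⟨
      fromℤ (i ℤ.* + e) + fromℤ (j ℤ.* + d)            ≡⟨ fromℤ-+ (i ℤ.* + e) (j ℤ.* + d) ⟨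
      fromℤ (i ℤ.* + e ℤ.+ j ℤ.* + d)                  ∎)
    where
    open ≡-Reasoning
    expand : ∀ x y c d → (x + y) * (c * d) ≡ x * c * d + y * d * c
    expand = Ring.solve-∀ ℚ-ring

  neg-integral : ∀ {x} → Integral x → Integral (- x)
  neg-integral {x} (integral {i} {d} p∤d eq) = integral {numerator = ℤ.- i} p∤d (begin
    - x * fromℕ d      ≡⟨ neg-distribˡ-* x (fromℕ d) ⟨
    - (x * fromℕ d)    ≡⟨ cong -_ eq ⟩
    - fromℤ i          ≡⟨ fromℤ-neg i ⟨
    fromℤ (ℤ.- i)      ∎)
    where open ≡-Reasoning

  1-integral : Integral 1
  1-integral = fromℕ-integral 1

  P-integral : Integral P
  P-integral = fromℕ-integral p

  inv-integral : ∀ {k} → ¬ (p ∣ suc k) → Integral (inv k)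
  inv-integral {k} p∤k = integral {numerator = + 1} p∤k (inv-* k)

  inv-integral-< : ∀ {k} → suc k ℕ.< p → Integral (inv k)
  inv-integral-< k<p = inv-integral (>⇒∤ k<p)

  ∏-integral : ∀ n {f} → (∀ i → i ℕ.< n → Integral (f i)) → Integral (∏ n f)
  ∏-integral zero    f∈ = 1-integral
  ∏-integral (suc n) f∈ = *-integral (∏-integral n λ i i<n → f∈ i (ℕ.m<n⇒m<1+n i<n)) (f∈ n ℕ.≤-refl)

  ∑-integral : ∀ n {f} → (∀ i → i ℕ.< n → Integral (f i)) → Integral (∑ n f)
  ∑-integral zero    f∈ = fromℕ-integral 0
  ∑-integral (suc n) f∈ = +-integral (∑-integral n λ i i<n → f∈ i (ℕ.m<n⇒m<1+n i<n)) (f∈ n ℕ.≤-refl)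

  -- The inverse is carried as data, so that cancelling a unit is a multiplication and needs no
  -- instance of `NonZero`.
  record Unit (x : ℚ) : Set where
    constructor unit
    field
      unit-integral    : Integral x
      {inverse}        : ℚ
      inverse-integral : Integral inverse
      inverse-*        : inverse * x ≡ 1
  open Unit public using (unit-integral)

  *-unit : ∀ {x y} → Unit x → Unit y → Unit (x * y)
  *-unit {x} {y} (unit x∈ {x′} x′∈ eq) (unit y∈ {y′} y′∈ eq′) =
    unit (*-integral x∈ y∈) {x′ * y′} (*-integral x′∈ y′∈) (trans (swap x′ y′ x y) (cong₂ _*_ eq eq′))
    where
    swap : ∀ a b c d → a * b * (c * d) ≡ a * c * (b * d)
    swap = Ring.solve-∀ ℚ-ring

  fromℕ-unit : ∀ {n} → ¬ (p ∣ n) → Unit (fromℕ n)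
  fromℕ-unit {zero}  p∤0 = contradiction (divides 0 refl) p∤0
  fromℕ-unit {suc n} p∤n = unit (fromℕ-integral (suc n)) (inv-integral p∤n) (inv-* n)

  inv-unit : ∀ {k} → ¬ (p ∣ suc k) → Unit (inv k)
  inv-unit {k} p∤k = unit (inv-integral p∤k) (fromℕ-integral (suc k)) (trans (*-comm (fromℕ (suc k)) (inv k)) (inv-* k))

  ∏-unit : ∀ n {f} → (∀ i → i ℕ.< n → Unit (f i)) → Unit (∏ n f)
  ∏-unit zero    f∈ = fromℕ-unit p∤1
  ∏-unit (suc n) f∈ = *-unit (∏-unit n λ i i<n → f∈ i (ℕ.m<n⇒m<1+n i<n)) (f∈ n ℕ.≤-refl)

  infix 4 _≈_[_] _∼exp[_,_]

  -- The modulus is a rational and the quotient a witness of an equation without division. Moduli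
  -- such as P, P² and P³ can therefore be scaled and weakened by ring identities.
  record _≈_[_] (x y m : ℚ) : Set where
    constructor mod
    field
      {quotient}        : ℚ
      quotient-integral : Integral quotient
      difference        : x ≡ y + m * quotient

  ≈-reflexive : ∀ {m x y} → x ≡ y → x ≈ y [ m ]
  ≈-reflexive {m} {x} refl = mod (fromℕ-integral 0) (sym (trans (cong (λ z → x + z) (*-zeroʳ m)) (+-identityʳ x)))

  ≈-refl : ∀ {m x} → x ≈ x [ m ]
  ≈-refl = ≈-reflexive refl

  ≈-sym : ∀ {m x y} → x ≈ y [ m ] → y ≈ x [ m ]
  ≈-sym {m} {y = y} (mod {z} z∈ refl) = mod (neg-integral z∈) (cancel y m z)
    where
    cancel : ∀ y m z → y ≡ y + m * z + m * - z
    cancel = Ring.solve-∀ ℚ-ring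

  ≈-trans : ∀ {m x y z} → x ≈ y [ m ] → y ≈ z [ m ] → x ≈ z [ m ]
  ≈-trans {m} {z = z} (mod {u} u∈ refl) (mod {v} v∈ refl) = mod (+-integral v∈ u∈) (collect z m v u)
    where
    collect : ∀ z m v u → z + m * v + m * u ≡ z + m * (v + u)
    collect = Ring.solve-∀ ℚ-ring

  ≈-setoid : ℚ → Setoid _ _
  ≈-setoid m = record
    { Carrier       = ℚ
    ; _≈_           = λ x y → x ≈ y [ m ]
    ; isEquivalence = record { refl = ≈-refl ; sym = ≈-sym ; trans = ≈-trans }
    }

  +-cong : ∀ {m x y u v} → x ≈ y [ m ] → u ≈ v [ m ] → x + u ≈ y + v [ m ]
  +-cong {m} {y = y} {v = v} (mod {s} s∈ refl) (mod {t} t∈ refl) = mod (+-integral s∈ t∈) (collect y v m s t)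
    where
    collect : ∀ y v m s t → y + m * s + (v + m * t) ≡ y + v + m * (s + t)
    collect = Ring.solve-∀ ℚ-ring

  *-congˡ : ∀ {m c x y} → Integral c → x ≈ y [ m ] → c * x ≈ c * y [ m ]
  *-congˡ {m} {c} {y = y} c∈ (mod {s} s∈ refl) = mod (*-integral c∈ s∈) (expand c y m s)
    where
    expand : ∀ c y m s → c * (y + m * s) ≡ c * y + m * (c * s)
    expand = Ring.solve-∀ ℚ-ring

  *-congʳ : ∀ {m c x y} → Integral c → x ≈ y [ m ] → x * c ≈ y * c [ m ]
  *-congʳ {m} {c} {x} {y} c∈ x≈y =
    ≈-trans (≈-reflexive (*-comm x c)) (≈-trans (*-congˡ c∈ x≈y) (≈-reflexive (*-comm c y)))

  *-cong : ∀ {m x y u v} → Integral x → Integral v → x ≈ y [ m ] → u ≈ v [ m ] → x * u ≈ y * v [ m ]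
  *-cong x∈ v∈ x≈y u≈v = ≈-trans (*-congˡ x∈ u≈v) (*-congʳ v∈ x≈y)

  -- The gain of precision used throughout: after multiplication by P², a congruence modulo P holds
  -- modulo P³.
  *-scale : ∀ {m x y} c → x ≈ y [ m ] → c * x ≈ c * y [ c * m ]
  *-scale {m} {y = y} c (mod {s} s∈ refl) = mod s∈ (expand c y m s)
    where
    expand : ∀ c y m s → c * (y + m * s) ≡ c * y + c * m * s
    expand = Ring.solve-∀ ℚ-ring

  ≈-weaken : ∀ {m c x y} → Integral c → x ≈ y [ m * c ] → x ≈ y [ m ]
  ≈-weaken {m} {c} {y = y} c∈ (mod {s} s∈ refl) = mod (*-integral c∈ s∈) (cong (λ z → y + z) (*-assoc m c s))

  *-cancelˡ : ∀ {m c x y} → Unit c → c * x ≈ c * y [ m ] → x ≈ y [ m ]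
  *-cancelˡ {m} {c} {x} {y} (unit c∈ {d} d∈ eq) cx≈cy = ≈-trans (≈-reflexive (undo x)) (≈-trans (*-congˡ d∈ cx≈cy) (≈-reflexive (sym (undo y))))
    where
    undo : ∀ z → z ≡ d * (c * z)
    undo z = sym (trans (sym (*-assoc d c z)) (trans (cong (_* z) eq) (*-identityˡ z)))

  ≈-integral : ∀ {m x y} → Integral m → x ≈ y [ m ] → Integral y → Integral x
  ≈-integral m∈ (mod s∈ refl) y∈ = +-integral y∈ (*-integral m∈ s∈)

  *-≈0 : ∀ {m n x y} → x ≈ 0 [ m ] → y ≈ 0 [ n ] → x * y ≈ 0 [ m * n ]
  *-≈0 {m} {n} (mod {s} s∈ refl) (mod {t} t∈ refl) = mod (*-integral s∈ t∈) (expand m n s t)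
    where
    expand : ∀ m n s t → (0 + m * s) * (0 + n * t) ≡ 0 + m * n * (s * t)
    expand = Ring.solve-∀ ℚ-ring

  ∏-≈ : ∀ {m} n {f g} → (∀ i → i ℕ.< n → Integral (f i)) → (∀ i → i ℕ.< n → Integral (g i)) →
        (∀ i → i ℕ.< n → f i ≈ g i [ m ]) → ∏ n f ≈ ∏ n g [ m ]
  ∏-≈ zero    f∈ g∈ f≈g = ≈-refl
  ∏-≈ (suc n) f∈ g∈ f≈g = *-cong
    (∏-integral n λ i i<n → f∈ i (ℕ.m<n⇒m<1+n i<n)) (g∈ n ℕ.≤-refl)
    (∏-≈ n (λ i i<n → f∈ i (ℕ.m<n⇒m<1+n i<n)) (λ i i<n → g∈ i (ℕ.m<n⇒m<1+n i<n)) λ i i<n → f≈g i (ℕ.m<n⇒m<1+n i<n))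
    (f≈g n ℕ.≤-refl)

  ∑-≈ : ∀ {m} n {f g} → (∀ i → i ℕ.< n → f i ≈ g i [ m ]) → ∑ n f ≈ ∑ n g [ m ]
  ∑-≈ zero    f≈g = ≈-refl
  ∑-≈ (suc n) f≈g = +-cong (∑-≈ n λ i i<n → f≈g i (ℕ.m<n⇒m<1+n i<n)) (f≈g n ℕ.≤-refl)

  ∏-≈0 : ∀ {m} n {f} j → j ℕ.< n → (∀ i → i ℕ.< n → Integral (f i)) → f j ≈ 0 [ m ] → ∏ n f ≈ 0 [ m ]
  ∏-≈0 (suc n) {f} j j<1+n f∈ fj≈0 with ℕ.m≤n⇒m<n∨m≡n (ℕ.s≤s⁻¹ j<1+n)
  ... | inj₁ j<n  = ≈-trans (*-congʳ (f∈ n ℕ.≤-refl) (∏-≈0 n j j<n (λ i i<n → f∈ i (ℕ.m<n⇒m<1+n i<n)) fj≈0))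
                            (≈-reflexive (*-zeroˡ (f n)))
  ... | inj₂ refl = ≈-trans (*-congˡ (∏-integral n λ i i<n → f∈ i (ℕ.m<n⇒m<1+n i<n)) fj≈0)
                            (≈-reflexive (*-zeroʳ (∏ n f)))

  exp : ℚ → ℚ → ℚ
  exp x y = 1 + P * x + P * P * (½ * (x * x) + y)

  -- X is exp (P x + P² y) up to terms of order P³.
  record _∼exp[_,_] (X x y : ℚ) : Set where
    constructor expansion
    field
      x∈ : Integral x
      y∈ : Integral y
      expand : X ≈ exp x y [ P * P * P ]

-- Product formulas for V and the binomial coefficients

fromℕ-reflect : ∀ i j {n} → suc (i ℕ.+ j) ≡ n → fromℕ n ≡ 1 + fromℕ i + fromℕ j
fromℕ-reflect i j refl = trans (fromℕ-+ (suc i) j) (cong (_+ fromℕ j) (fromℕ-suc i))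

H₂ : ℕ → ℚ
H₂ n = ∑ n λ k → inv k * inv k

H⁽²⁾≡H₂ : ∀ n → H⁽²⁾ n ≡ H₂ n
H⁽²⁾≡H₂ n = ∑-cong n λ k _ → inv-² k

∏-neg1² : ∀ n → ∏ n (λ _ → - 1) * ∏ n (λ _ → - 1) ≡ 1
∏-neg1² n = trans (∏-² n (λ _ → - 1)) (∏-one n λ _ _ → refl)

V-split : ∀ a n → V a n ≡ ∏ n (λ j → a + fromℕ j) * ∏ n (λ j → fromℕ j + 1 - a) * ∏ n (λ j → 2 * fromℕ j + 3) *
                          ∏ n (λ j → ½ * (inv j * inv j * inv j))
V-split a n =
  trans (∏-* n _ (λ j → ½ * (inv j * inv j * inv j)))
    (cong (_* ∏ n (λ j → ½ * (inv j * inv j * inv j)))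
      (trans (∏-* n _ (λ j → 2 * fromℕ j + 3)) (cong (_* ∏ n (λ j → 2 * fromℕ j + 3)) (∏-* n _ _))))

-- C(2n, n)/4^n is the double factorial (2n - 1)!! divided by (2n)!!.
central-*-evens : ∀ n → central n * ∏ n (λ j → 2 * (1 + fromℕ j)) ≡ ∏ n odd
central-*-evens n = trans (cong (_* ∏ n (λ j → 2 * (1 + fromℕ j))) (central-∏ n))
  (trans (sym (∏-* n _ _)) (∏-cong n λ j _ → begin
    odd j * ½ * inv j * (2 * (1 + fromℕ j))  ≡⟨ rearrange (odd j) (inv j) (1 + fromℕ j) ⟩
    odd j * (inv j * (1 + fromℕ j))          ≡⟨ cong (odd j *_) (inv-*′ j) ⟩
    odd j * 1                                ≡⟨ *-identityʳ (odd j) ⟩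
    odd j                                    ∎))
  where
  open ≡-Reasoning
  rearrange : ∀ o i s → o * ½ * i * (2 * s) ≡ o * (i * s)
  rearrange = Ring.solve-∀ ℚ-ring

-- For a = 2n + x this reads the descending product of the a - 2i from its small end. With x = P t
-- every factor becomes a fixed even number plus a multiple of P.
∏-evens-reverse : ∀ n x → ∏ n (λ i → 2 * fromℕ n + x - 2 * fromℕ i) ≡ ∏ n (λ j → 2 * (1 + fromℕ j) + x)
∏-evens-reverse n x = ∏-reverse n _ _ λ i j eq →
  trans (cong (λ y → 2 * y + x - 2 * fromℕ i) (fromℕ-reflect i j eq)) (arith (fromℕ i) (fromℕ j) x)
  where
  arith : ∀ i j x → 2 * (1 + i + j) + x - 2 * i ≡ 2 * (1 + j) + x
  arith = Ring.solve-∀ ℚ-ring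

∏-odds-reverse : ∀ n x → ∏ n (λ i → 2 * fromℕ n + x - 1 - 2 * fromℕ i) ≡ ∏ n (λ j → odd j + x)
∏-odds-reverse n x = ∏-reverse n _ _ λ i j eq →
  trans (cong (λ y → 2 * y + x - 1 - 2 * fromℕ i) (fromℕ-reflect i j eq)) (arith (fromℕ i) (fromℕ j) x)
  where
  arith : ∀ i j x → 2 * (1 + i + j) + x - 1 - 2 * i ≡ 2 * j + 1 + x
  arith = Ring.solve-∀ ℚ-ring

C-suc : ∀ m n → ((m ℕ.+ suc n) C suc n) ℕ.* suc n ≡ ((m ℕ.+ suc n) C n) ℕ.* suc m
C-suc m n = ℕ.*-cancelʳ-≡ _ _ (n ! ℕ.* m !) {{n ℕ.!* m !≢0}} (begin
  ((m ℕ.+ suc n) C suc n) ℕ.* suc n ℕ.* (n ! ℕ.* m !)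
    ≡⟨ r₁ ((m ℕ.+ suc n) C suc n) (suc n) (n !) (m !) ⟩
  ((m ℕ.+ suc n) C suc n) ℕ.* (suc n ! ℕ.* m !)
    ≡⟨ C-*-!! m (suc n) ⟩
  (m ℕ.+ suc n) !
    ≡⟨ cong _! (ℕ.+-suc m n) ⟩
  (suc m ℕ.+ n) !
    ≡⟨ C-*-!! (suc m) n ⟨
  ((suc m ℕ.+ n) C n) ℕ.* (n ! ℕ.* suc m !)
    ≡⟨ cong (λ k → (k C n) ℕ.* (n ! ℕ.* suc m !)) (ℕ.+-suc m n) ⟨
  ((m ℕ.+ suc n) C n) ℕ.* (n ! ℕ.* suc m !)
    ≡⟨ r₂ ((m ℕ.+ suc n) C n) (suc m) (n !) (m !) ⟩
  ((m ℕ.+ suc n) C n) ℕ.* suc m ℕ.* (n ! ℕ.* m !) ∎)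
  where
  open ≡-Reasoning
  r₁ : ∀ c s f g → c ℕ.* s ℕ.* (f ℕ.* g) ≡ c ℕ.* (s ℕ.* f ℕ.* g)
  r₁ = ℕ.solve-∀
  r₂ : ∀ c s f g → c ℕ.* (f ℕ.* (s ℕ.* g)) ≡ c ℕ.* s ℕ.* (f ℕ.* g)
  r₂ = ℕ.solve-∀

C-∏ : ∀ h n → n ℕ.≤ h → fromℕ (h C n) ≡ ∏ n (λ i → (fromℕ h - fromℕ i) * inv i)
C-∏ h zero    _   = refl
C-∏ h (suc n) n<h = begin
  fromℕ (h C suc n)
    ≡⟨ trans (sym (*-identityʳ _)) (cong (fromℕ (h C suc n) *_) (sym (inv-* n))) ⟩
  fromℕ (h C suc n) * (inv n * fromℕ (suc n))
    ≡⟨ r₁ (fromℕ (h C suc n)) (inv n) (fromℕ (suc n)) ⟩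
  fromℕ (h C suc n) * fromℕ (suc n) * inv n
    ≡⟨ cong (_* inv n) cleared ⟩
  fromℕ (h C n) * (fromℕ h - fromℕ n) * inv n
    ≡⟨ cong (λ x → x * (fromℕ h - fromℕ n) * inv n) (C-∏ h n (ℕ.<⇒≤ n<h)) ⟩
  ∏ n (λ i → (fromℕ h - fromℕ i) * inv i) * (fromℕ h - fromℕ n) * inv n
    ≡⟨ *-assoc (∏ n (λ i → (fromℕ h - fromℕ i) * inv i)) _ (inv n) ⟩
  ∏ (suc n) (λ i → (fromℕ h - fromℕ i) * inv i) ∎
  where
  open ≡-Reasoning
  m = h ℕ.∸ suc n
  m+1+n≡h : m ℕ.+ suc n ≡ h
  m+1+n≡h = ℕ.m∸n+n≡m n<h
  r₁ : ∀ c i s → c * (i * s) ≡ c * s * i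
  r₁ = Ring.solve-∀ ℚ-ring
  r₂ : ∀ x y → x ≡ x + y - y
  r₂ = Ring.solve-∀ ℚ-ring
  complement : fromℕ (suc m) ≡ fromℕ h - fromℕ n
  complement = trans (r₂ (fromℕ (suc m)) (fromℕ n))
    (cong (_- fromℕ n) (trans (sym (fromℕ-+ (suc m) n)) (cong fromℕ (trans (sym (ℕ.+-suc m n)) m+1+n≡h))))
  cleared : fromℕ (h C suc n) * fromℕ (suc n) ≡ fromℕ (h C n) * (fromℕ h - fromℕ n)
  cleared = begin
    fromℕ (h C suc n) * fromℕ (suc n)     ≡⟨ fromℕ-* (h C suc n) (suc n) ⟨
    fromℕ ((h C suc n) ℕ.* suc n)         ≡⟨ cong fromℕ (subst (λ k → (k C suc n) ℕ.* suc n ≡ (k C n) ℕ.* suc m) m+1+n≡h (C-suc m n)) ⟩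
    fromℕ ((h C n) ℕ.* suc m)             ≡⟨ fromℕ-* (h C n) (suc m) ⟩
    fromℕ (h C n) * fromℕ (suc m)         ≡⟨ cong (fromℕ (h C n) *_) complement ⟩
    fromℕ (h C n) * (fromℕ h - fromℕ n)   ∎

-- The factor 1/(2^n n!) is the same for b = a and b = a - 1, so it cancels from the quotient in the
-- statement and leaves the products met in the descent.
binom-½ : ∀ b n → binom (½ * b) n ≡ ∏ n (λ i → ½ * inv i) * ∏ n (λ i → b - 2 * fromℕ i)
binom-½ b n = trans (binom-∏ (½ * b) n) (trans (∏-cong n λ i _ → r b (fromℕ i) (inv i)) (∏-* n _ _))
  where
  r : ∀ b x i → (½ * b - x) * i ≡ ½ * i * (b - 2 * x)
  r = Ring.solve-∀ ℚ-ring

inv-even-* : ∀ i → inv (2 ℕ.* i) * odd i ≡ 1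
inv-even-* i = trans (cong (inv (2 ℕ.* i) *_) (trans (+-comm (2 * fromℕ i) 1) (cong (λ x → 1 + x) (sym (fromℕ-double i))))) (inv-*′ (2 ℕ.* i))

fromℕ-1+2* : ∀ m → fromℕ (suc (2 ℕ.* m)) ≡ 1 + 2 * fromℕ m
fromℕ-1+2* m = trans (fromℕ-suc (2 ℕ.* m)) (cong (λ x → 1 + x) (fromℕ-double m))

⌊2*n/2⌋ : ∀ n → ℕ.⌊ 2 ℕ.* n /2⌋ ≡ n
⌊2*n/2⌋ n = trans (cong (λ k → ℕ.⌊ n ℕ.+ k /2⌋) (ℕ.+-identityʳ n)) (sym (ℕ.n≡⌊n+n/2⌋ n))

odd⇒1+2* : ∀ n → ¬ (2 ∣ n) → ∃ λ m → n ≡ suc (2 ℕ.* m)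
odd⇒1+2* zero          2∤n = contradiction (divides 0 refl) 2∤n
odd⇒1+2* (suc zero)    2∤n = 0 , refl
odd⇒1+2* (suc (suc n)) 2∤n with odd⇒1+2* n (λ { (divides k refl) → 2∤n (divides (suc k) refl) })
... | m , refl = suc m , cong (suc ∘ suc) (sym (ℕ.+-suc m (m ℕ.+ 0)))

-- Arithmetic modulo p = 2h + 1

module OddPrime (h : ℕ) (p-prime : Prime (suc (2 ℕ.* h))) where

  open Congruences (suc (2 ℕ.* h)) p-prime public

  p : ℕ
  p = suc (2 ℕ.* h)

  P³ : ℚ
  P³ = P * P * P

  P-odd : P ≡ 1 + 2 * fromℕ h
  P-odd = trans (fromℕ-suc (2 ℕ.* h)) (cong (λ x → 1 + x) (fromℕ-double h))

  P-reflect : ∀ i j → suc (i ℕ.+ j) ≡ h → P ≡ 1 + 2 * (1 + fromℕ i + fromℕ j)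
  P-reflect i j eq = trans P-odd (cong (λ x → 1 + 2 * x) (fromℕ-reflect i j eq))

  0<h : 0 ℕ.< h
  0<h = ℕ.n≢0⇒n>0 λ { refl → ¬prime[1] p-prime }

  p∤2 : ¬ (p ∣ 2)
  p∤2 = >⇒∤ (ℕ.s≤s (ℕ.*-monoʳ-≤ 2 0<h))

  ½-integral : Integral ½
  ½-integral = inv-integral p∤2

  2-unit : Unit 2
  2-unit = fromℕ-unit p∤2

  P³-integral : Integral P³
  P³-integral = *-integral (*-integral P-integral P-integral) P-integral

  invᵢ : ∀ {k} → k ℕ.< 2 ℕ.* h → Integral (inv k)
  invᵢ k<2h = inv-integral-< (ℕ.s≤s k<2h)

  double-< : ∀ {i} → i ℕ.< h → i ℕ.< 2 ℕ.* h
  double-< i<h = ℕ.≤-trans i<h (ℕ.m≤m+n h _)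

  invₕ : ∀ {k} → k ℕ.< h → Integral (inv k)
  invₕ k<h = invᵢ (double-< k<h)

  -integral : ∀ {x y} → Integral x → Integral y → Integral (x - y)
  -integral x∈ y∈ = +-integral x∈ (neg-integral y∈)

  odd-integral : ∀ k → Integral (odd k)
  odd-integral k = +-integral (*-integral (fromℕ-integral 2) (fromℕ-integral k)) 1-integral

  odd-unit : ∀ {k} → k ℕ.< h → Unit (odd k)
  odd-unit {k} k<h = subst Unit eq (fromℕ-unit (>⇒∤ (ℕ.s≤s (ℕ.*-monoʳ-< 2 k<h))))
    where
    eq : fromℕ (suc (2 ℕ.* k)) ≡ odd k
    eq = trans (fromℕ-suc (2 ℕ.* k)) (trans (cong (λ x → 1 + x) (fromℕ-double k)) (+-comm 1 (2 * fromℕ k)))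

  central-unit : ∀ n → n ℕ.≤ h → Unit (central n)
  central-unit n n≤h = subst Unit (sym (central-∏ n)) (∏-unit n λ i i<n →
    let i<h = ℕ.≤-trans i<n n≤h in
    *-unit (*-unit (odd-unit i<h) (inv-unit p∤2)) (inv-unit (>⇒∤ (ℕ.s≤s (double-< i<h)))))

  unit-factor : ∀ {c x} → Integral c → Integral x → Unit (c * x) → Unit x
  unit-factor {c} {x} c∈ x∈ (unit _ {d} d∈ eq) = unit x∈ (*-integral d∈ c∈) (trans (*-assoc d c x) eq)

  -- Truncated exponentials

  ∼exp-* : ∀ {X Y x y x′ y′} → X ∼exp[ x , y ] → Y ∼exp[ x′ , y′ ] → X * Y ∼exp[ x + x′ , y + y′ ]
  ∼exp-* {X} {Y} {x} {y} {x′} {y′} (expansion x∈ y∈ X≈) (expansion x′∈ y′∈ Y≈) =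
    expansion (+-integral x∈ x′∈) (+-integral y∈ y′∈)
      (≈-trans (*-cong (≈-integral P³-integral X≈ (exp-integral x∈ y∈)) (exp-integral x′∈ y′∈) X≈ Y≈)
        (mod (+-integral (+-integral (*-integral x∈ w′∈) (*-integral x′∈ w∈)) (*-integral (*-integral P-integral w∈) w′∈))
          (remainder P x y x′ y′)))
    where
    half² : ∀ {x y} → Integral x → Integral y → Integral (½ * (x * x) + y)
    half² x∈ y∈ = +-integral (*-integral ½-integral (*-integral x∈ x∈)) y∈
    exp-integral : ∀ {x y} → Integral x → Integral y → Integral (exp x y)
    exp-integral x∈ y∈ = +-integral (+-integral 1-integral (*-integral P-integral x∈))
      (*-integral (*-integral P-integral P-integral) (half² x∈ y∈))
    w∈ = half² x∈ y∈
    w′∈ = half² x′∈ y′∈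
    remainder : ∀ P x y x′ y′ →
      (1 + P * x + P * P * (½ * (x * x) + y)) * (1 + P * x′ + P * P * (½ * (x′ * x′) + y′)) ≡
      1 + P * (x + x′) + P * P * (½ * ((x + x′) * (x + x′)) + (y + y′)) +
      P * P * P * (x * (½ * (x′ * x′) + y′) + x′ * (½ * (x * x) + y) + P * (½ * (x * x) + y) * (½ * (x′ * x′) + y′))
    remainder = Ring.solve-∀ ℚ-ring

  -- log (1 + P t) = P t - ½ P² t² + ...
  ∼exp-linear : ∀ {t} → Integral t → (1 + P * t) ∼exp[ t , - ½ * (t * t) ]
  ∼exp-linear {t} t∈ = expansion t∈ (*-integral (neg-integral ½-integral) (*-integral t∈ t∈)) (≈-reflexive (exact P t))
    where
    exact : ∀ P t → 1 + P * t ≡ 1 + P * t + P * P * (½ * (t * t) + - ½ * (t * t))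
    exact = Ring.solve-∀ ℚ-ring

  ∼exp-cong : ∀ {X x y x′ y′} → x ≡ x′ → y ≡ y′ → X ∼exp[ x , y ] → X ∼exp[ x′ , y′ ]
  ∼exp-cong refl refl X∼ = X∼

  -- The second-order coefficient is multiplied by P², so it matters only modulo P. This is where
  -- harmonic sums that vanish modulo p are discarded.
  ∼exp-≈ : ∀ {X x y y′} → Integral y′ → y ≈ y′ [ P ] → X ∼exp[ x , y ] → X ∼exp[ x , y′ ]
  ∼exp-≈ {x = x} {y′ = y′} y′∈ (mod {s} s∈ refl) (expansion x∈ _ X≈) =
    expansion x∈ y′∈ (≈-trans X≈ (mod s∈ (split P x y′ s)))
    where
    split : ∀ P x y s → 1 + P * x + P * P * (½ * (x * x) + (y + P * s)) ≡
      1 + P * x + P * P * (½ * (x * x) + y) + P * P * P * s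
    split = Ring.solve-∀ ℚ-ring

  ∼exp-unique : ∀ {X Y x y} → X ∼exp[ x , y ] → Y ∼exp[ x , y ] → X ≈ Y [ P³ ]
  ∼exp-unique (expansion _ _ X≈) (expansion _ _ Y≈) = ≈-trans X≈ (≈-sym Y≈)

  1-∼exp : 1 ∼exp[ 0 , 0 ]
  1-∼exp = expansion (fromℕ-integral 0) (fromℕ-integral 0) (≈-reflexive (exact P))
    where
    exact : ∀ P → 1 ≡ 1 + P * 0 + P * P * (½ * (0 * 0) + 0)
    exact = Ring.solve-∀ ℚ-ring

  ∏-∼exp : ∀ n {f x y} → (∀ i → i ℕ.< n → f i ∼exp[ x i , y i ]) → ∏ n f ∼exp[ ∑ n x , ∑ n y ]
  ∏-∼exp zero    f∼ = 1-∼exp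
  ∏-∼exp (suc n) f∼ = ∼exp-* (∏-∼exp n λ i i<n → f∼ i (ℕ.m<n⇒m<1+n i<n)) (f∼ n ℕ.≤-refl)

  -- Harmonic sums of order two vanish modulo p

  -- 1/x + 1/y = (x + y)/(xy), and here x + y = p.
  inv-reflect : ∀ {i j} → suc i ℕ.+ suc j ≡ p → i ℕ.< 2 ℕ.* h → j ℕ.< 2 ℕ.* h → inv i ≈ - inv j [ P ]
  inv-reflect {i} {j} eq i<2h j<2h = mod (*-integral (invᵢ i<2h) (invᵢ j<2h)) (sym (begin
    - inv j + P * (inv i * inv j)
      ≡⟨ cong (λ x → - inv j + x * (inv i * inv j)) (trans (cong fromℕ (sym eq)) (fromℕ-+ (suc i) (suc j))) ⟩
    - inv j + (fromℕ (suc i) + fromℕ (suc j)) * (inv i * inv j)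
      ≡⟨ rearrange (inv i) (inv j) (fromℕ (suc i)) (fromℕ (suc j)) ⟩
    - inv j + (inv i * fromℕ (suc i) * inv j + inv j * fromℕ (suc j) * inv i)
      ≡⟨ cong₂ (λ x y → - inv j + (x * inv j + y * inv i)) (inv-* i) (inv-* j) ⟩
    - inv j + (1 * inv j + 1 * inv i)
      ≡⟨ cancel (inv i) (inv j) ⟩
    inv i ∎))
    where
    open ≡-Reasoning
    rearrange : ∀ a b x y → - b + (x + y) * (a * b) ≡ - b + (a * x * b + b * y * a)
    rearrange = Ring.solve-∀ ℚ-ring
    cancel : ∀ a b → - b + (1 * b + 1 * a) ≡ a
    cancel = Ring.solve-∀ ℚ-ring

  inv²-reflect : ∀ {i j} → suc i ℕ.+ suc j ≡ p → inv i * inv i ≈ inv j * inv j [ P ]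
  inv²-reflect {i} {j} eq = ≈-trans (*-cong (invᵢ i<2h) (neg-integral (invᵢ j<2h)) i≈ i≈) (≈-reflexive (neg² (inv j)))
    where
    i+1+j≡2h : suc (i ℕ.+ j) ≡ 2 ℕ.* h
    i+1+j≡2h = ℕ.suc-injective (trans (cong suc (sym (ℕ.+-suc i j))) eq)
    i<2h : i ℕ.< 2 ℕ.* h
    i<2h = ℕ.≤-trans (ℕ.s≤s (ℕ.m≤m+n i j)) (ℕ.≤-reflexive i+1+j≡2h)
    j<2h : j ℕ.< 2 ℕ.* h
    j<2h = ℕ.≤-trans (ℕ.s≤s (ℕ.m≤n+m j i)) (ℕ.≤-reflexive i+1+j≡2h)
    i≈ = inv-reflect eq i<2h j<2h
    neg² : ∀ x → - x * - x ≡ x * x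
    neg² = Ring.solve-∀ ℚ-ring

  ∑-reverse-≈ : ∀ {m} n f g → (∀ i j → suc (i ℕ.+ j) ≡ n → f i ≈ g j [ m ]) → ∑ n f ≈ ∑ n g [ m ]
  ∑-reverse-≈ zero    f g f≈g = ≈-refl
  ∑-reverse-≈ (suc n) f g f≈g = ≈-trans
    (+-cong (∑-reverse-≈ n f (g ∘ suc) λ i j eq → f≈g i (suc j) (cong suc (trans (ℕ.+-suc i j) eq)))
            (f≈g n 0 (cong suc (ℕ.+-identityʳ n))))
    (≈-reflexive (trans (+-comm _ (g 0)) (sym (∑-head n g))))

  H₂-halves : H₂ (2 ℕ.* h) ≈ H₂ h + H₂ h [ P ]
  H₂-halves = ≈-trans (≈-reflexive split) (+-cong (≈-refl {x = H₂ h}) (∑-reverse-≈ h _ _ λ i j eq → inv²-reflect (reflect i j eq)))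
    where
    split : H₂ (2 ℕ.* h) ≡ H₂ h + ∑ h (λ i → inv (i ℕ.+ h) * inv (i ℕ.+ h))
    split = trans (cong (λ n → H₂ (h ℕ.+ n)) (ℕ.+-identityʳ h)) (∑-append h h (λ k → inv k * inv k))
    arith : ∀ i j → suc (i ℕ.+ suc (i ℕ.+ j)) ℕ.+ suc j ≡ suc (2 ℕ.* suc (i ℕ.+ j))
    arith = ℕ.solve-∀
    reflect : ∀ i j → suc (i ℕ.+ j) ≡ h → suc (i ℕ.+ h) ℕ.+ suc j ≡ p
    reflect i j refl = arith i j

  H₂-parity : H₂ (2 ℕ.* h) ≈ ½ * H₂ h [ P ]
  H₂-parity = begin
    H₂ (2 ℕ.* h)
      ≈⟨ ≈-reflexive (∑-parity h (λ k → inv k * inv k)) ⟩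
    ∑ h (λ i → inv (2 ℕ.* i) * inv (2 ℕ.* i)) + odds
      -- Since p is odd, k ↦ p - k exchanges odd and even denominators. By the shift in `inv`, even
      -- indices carry the odd denominators, and `odds` the even ones.
      ≈⟨ +-cong (∑-reverse-≈ h _ _ λ i j eq → inv²-reflect (reflect i j eq)) ≈-refl ⟩
    odds + odds
      ≈⟨ ≈-reflexive (cong (λ x → x + x) (trans (∑-cong h λ i _ → quarter i) (∑-*ˡ h (½ * ½) (λ i → inv i * inv i)))) ⟩
    ½ * ½ * H₂ h + ½ * ½ * H₂ h
      ≈⟨ ≈-reflexive (collect (H₂ h)) ⟩
    ½ * H₂ h ∎
    where
    open SetoidReasoning (≈-setoid P)
    odds = ∑ h (λ i → inv (2 ℕ.* i ℕ.+ 1) * inv (2 ℕ.* i ℕ.+ 1))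
    arith : ∀ i j → suc (2 ℕ.* i) ℕ.+ suc (2 ℕ.* j ℕ.+ 1) ≡ suc (2 ℕ.* suc (i ℕ.+ j))
    arith = ℕ.solve-∀
    reflect : ∀ i j → suc (i ℕ.+ j) ≡ h → suc (2 ℕ.* i) ℕ.+ suc (2 ℕ.* j ℕ.+ 1) ≡ p
    reflect i j refl = arith i j
    regroup : ∀ x → ½ * x * (½ * x) ≡ ½ * ½ * (x * x)
    regroup = Ring.solve-∀ ℚ-ring
    quarter : ∀ i → inv (2 ℕ.* i ℕ.+ 1) * inv (2 ℕ.* i ℕ.+ 1) ≡ ½ * ½ * (inv i * inv i)
    quarter i = trans (cong (λ x → x * x) (inv-double i)) (regroup (inv i))
    collect : ∀ x → ½ * ½ * x + ½ * ½ * x ≡ ½ * x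
    collect = Ring.solve-∀ ℚ-ring

  -- H₂ (p - 1) is 2 H₂ h by the reflection k ↦ p - k, and ½ H₂ h by separating even and odd k.
  H₂-h≈0 : ¬ (p ∣ 3) → H₂ h ≈ 0 [ P ]
  H₂-h≈0 p∤3 = *-cancelˡ (fromℕ-unit p∤3) (begin
    3 * H₂ h                             ≈⟨ ≈-reflexive (r₁ (H₂ h)) ⟩
    2 * (H₂ h + H₂ h + - ½ * H₂ h)       ≈⟨ *-congˡ (fromℕ-integral 2) (+-cong (≈-trans (≈-sym H₂-halves) H₂-parity) ≈-refl) ⟩
    2 * (½ * H₂ h + - ½ * H₂ h)          ≈⟨ ≈-reflexive (r₂ (H₂ h)) ⟩
    3 * 0                                ∎)
    where
    open SetoidReasoning (≈-setoid P)
    r₁ : ∀ x → 3 * x ≡ 2 * (x + x + - ½ * x)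
    r₁ = Ring.solve-∀ ℚ-ring
    r₂ : ∀ x → 2 * (½ * x + - ½ * x) ≡ 3 * 0
    r₂ = Ring.solve-∀ ℚ-ring

  H₂-2h≈0 : ¬ (p ∣ 3) → H₂ (2 ℕ.* h) ≈ 0 [ P ]
  H₂-2h≈0 p∤3 = ≈-trans H₂-parity (≈-trans (*-congˡ ½-integral (H₂-h≈0 p∤3)) (≈-reflexive (*-zeroʳ ½)))

  -- The products behind the central binomial coefficients

  2^[p-1] : ℚ
  2^[p-1] = fromℕ (2 ℕ.^ (2 ℕ.* h))

  -- Up to the sign (-1)^h, `Q` is C(2h, h)/4^h and `C′` is C(p - 1, h); `Y` is C(2p - 1, p - 1) =
  -- C(2p, p)/2. In this form all three are products of factors 1 + P x.
  Q C′ Y : ℚ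
  Q  = ∏ h λ i → 1 + P * (- ½ * inv i)
  C′ = ∏ h λ i → 1 + P * - inv i
  Y  = ∏ (2 ℕ.* h) λ k → 1 + P * inv k

  ∏-odd : ∏ h odd ≡ ∏ h (λ i → P - 2 * (1 + fromℕ i))
  ∏-odd = sym (∏-reverse h _ odd λ i j eq →
    trans (cong (_- 2 * (1 + fromℕ i)) (P-reflect i j eq)) (arith (fromℕ i) (fromℕ j)))
    where
    arith : ∀ x y → 1 + 2 * (1 + x + y) - 2 * (1 + x) ≡ 2 * y + 1
    arith = Ring.solve-∀ ℚ-ring

  ∏-upper : ∏ h (λ i → P - (1 + fromℕ i)) ≡ ∏ h (λ k → 1 + fromℕ h + fromℕ k)
  ∏-upper = ∏-reverse h _ _ λ i j eq →
    trans (cong (_- (1 + fromℕ i)) (P-reflect i j eq))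
      (trans (arith (fromℕ i) (fromℕ j)) (cong (λ x → 1 + x + fromℕ j) (sym (fromℕ-reflect i j eq))))
    where
    arith : ∀ x y → 1 + 2 * (1 + x + y) - (1 + x) ≡ 1 + (1 + x + y) + y
    arith = Ring.solve-∀ ℚ-ring

  normalise-factor : ∀ i → 1 + P * - inv i ≡ (P - (1 + fromℕ i)) * - inv i
  normalise-factor i = trans (cong (_+ P * - inv i) (sym (inv-*′ i))) (arith P (inv i) (fromℕ i))
    where
    arith : ∀ P i x → i * (1 + x) + P * - i ≡ (P - (1 + x)) * - i
    arith = Ring.solve-∀ ℚ-ring

  normalise-factor½ : ∀ i → 1 + P * (- ½ * inv i) ≡ - ½ * ((P - 2 * (1 + fromℕ i)) * inv i)
  normalise-factor½ i = trans (cong (_+ P * (- ½ * inv i)) (sym (inv-*′ i))) (arith P (inv i) (fromℕ i))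
    where
    arith : ∀ P i x → i * (1 + x) + P * (- ½ * i) ≡ - ½ * ((P - 2 * (1 + x)) * i)
    arith = Ring.solve-∀ ℚ-ring

  -- An exact identity: p - 1 = 2h, so C(p - 1, h) is itself the central binomial coefficient, and
  -- 2^(p-1) = 4^h.
  2^[p-1]*Q : 2^[p-1] * Q ≡ C′
  2^[p-1]*Q = sym (begin
    C′
      ≡⟨ trans (∏-cong h λ i _ → normalise-factor i) (∏-* h _ _) ⟩
    ∏ h (λ i → P - (1 + fromℕ i)) * ∏ h (λ i → - inv i)
      ≡⟨ cong (_* ∏ h (λ i → - inv i)) (trans ∏-upper (trans (∏-upper-half h) (∏-* h (λ _ → 2) odd))) ⟩
    ∏ h (λ _ → 2) * ∏ h odd * ∏ h (λ i → - inv i)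
      ≡⟨ cong (λ x → ∏ h (λ _ → 2) * x * ∏ h (λ i → - inv i)) ∏-odd ⟩
    ∏ h (λ _ → 2) * ∏ h (λ i → P - 2 * (1 + fromℕ i)) * ∏ h (λ i → - inv i)
      ≡⟨ trans (∏-* h _ (λ i → - inv i)) (cong (_* ∏ h (λ i → - inv i)) (∏-* h (λ _ → 2) _)) ⟨
    ∏ h (λ i → 2 * (P - 2 * (1 + fromℕ i)) * - inv i)
      ≡⟨ ∏-cong h (λ i _ → trans (arith (P - 2 * (1 + fromℕ i)) (inv i)) (cong (2 * 2 *_) (sym (normalise-factor½ i)))) ⟩
    ∏ h (λ i → 2 * 2 * (1 + P * (- ½ * inv i)))
      ≡⟨ ∏-* h (λ _ → 2 * 2) _ ⟩
    ∏ h (λ _ → 2 * 2) * Q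
      ≡⟨ cong (_* Q) (∏-double-const h 2) ⟨
    ∏ (2 ℕ.* h) (λ _ → 2) * Q
      ≡⟨ cong (_* Q) (∏-const (2 ℕ.* h) 2) ⟩
    2^[p-1] * Q ∎)
    where
    open ≡-Reasoning
    arith : ∀ x i → 2 * x * - i ≡ 2 * 2 * (- ½ * (x * i))
    arith = Ring.solve-∀ ℚ-ring

  central-Q : central h ≡ ∏ h (λ _ → - 1) * Q
  central-Q = begin
    central h
      ≡⟨ central-∏ h ⟩
    ∏ h (λ i → odd i * ½ * inv i)
      ≡⟨ trans (∏-cong h λ i _ → *-assoc (odd i) ½ (inv i)) (∏-* h odd _) ⟩
    ∏ h odd * ∏ h (λ i → ½ * inv i)
      ≡⟨ cong (_* ∏ h (λ i → ½ * inv i)) ∏-odd ⟩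
    ∏ h (λ i → P - 2 * (1 + fromℕ i)) * ∏ h (λ i → ½ * inv i)
      ≡⟨ ∏-* h _ _ ⟨
    ∏ h (λ i → (P - 2 * (1 + fromℕ i)) * (½ * inv i))
      ≡⟨ ∏-cong h (λ i _ → trans (arith (P - 2 * (1 + fromℕ i)) (inv i)) (cong (- 1 *_) (sym (normalise-factor½ i)))) ⟩
    ∏ h (λ i → - 1 * (1 + P * (- ½ * inv i)))
      ≡⟨ ∏-* h (λ _ → - 1) _ ⟩
    ∏ h (λ _ → - 1) * Q ∎
    where
    open ≡-Reasoning
    arith : ∀ x i → x * (½ * i) ≡ - 1 * (- ½ * (x * i))
    arith = Ring.solve-∀ ℚ-ring

  central²≡Q² : central h * central h ≡ Q * Q
  central²≡Q² = trans (cong (λ x → x * x) central-Q)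
    (trans (swap (∏ h (λ _ → - 1)) Q) (trans (cong (_* (Q * Q)) (∏-neg1² h)) (*-identityˡ (Q * Q))))
    where
    swap : ∀ e q → e * q * (e * q) ≡ e * e * (q * q)
    swap = Ring.solve-∀ ℚ-ring

  neg½-integral : Integral (- ½)
  neg½-integral = neg-integral ½-integral

  Q-unit : Unit Q
  Q-unit = unit-factor (∏-integral h λ _ _ → neg-integral 1-integral)
    (∏-integral h λ i i<h → +-integral 1-integral (*-integral P-integral (*-integral neg½-integral (invₕ i<h))))
    (subst Unit central-Q (central-unit h ℕ.≤-refl))

  H₂-integral : ∀ n → n ℕ.≤ 2 ℕ.* h → Integral (H₂ n)
  H₂-integral n n≤2h = ∑-integral n λ i i<n →
    let i∈ = invᵢ (ℕ.≤-trans i<n n≤2h) in *-integral i∈ i∈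

  h≤2h : h ℕ.≤ 2 ℕ.* h
  h≤2h = ℕ.m≤m+n h _

  -- Morley's congruence. The logarithms of C′ and Q² agree in first order, and their second orders
  -- are multiples of `H₂ h`, which vanishes modulo p. So 2^(p-1) Q = C′ ≈ Q², and the unit Q
  -- cancels.
  2^[p-1]≈Q : ¬ (p ∣ 3) → 2^[p-1] ≈ Q [ P³ ]
  2^[p-1]≈Q p∤3 = *-cancelˡ Q-unit (≈-trans (≈-reflexive (trans (*-comm Q 2^[p-1]) 2^[p-1]*Q))
    (∼exp-unique C′∼ Q²∼))
    where
    h₁ = ∑ h inv
    scaled≈0 : ∀ c → Integral c → c * H₂ h ≈ 0 [ P ]
    scaled≈0 c c∈ = ≈-trans (*-congˡ c∈ (H₂-h≈0 p∤3)) (≈-reflexive (*-zeroʳ c))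
    C′∼ : C′ ∼exp[ - 1 * h₁ , 0 ]
    C′∼ = ∼exp-≈ (fromℕ-integral 0) (scaled≈0 (- ½) neg½-integral)
      (∼exp-cong (trans (∑-cong h λ i _ → negate (inv i)) (∑-*ˡ h (- 1) inv))
                 (trans (∑-cong h λ i _ → sq (inv i)) (∑-*ˡ h (- ½) _))
        (∏-∼exp h λ i i<h → ∼exp-linear (neg-integral (invₕ i<h))))
      where
      negate : ∀ x → - x ≡ - 1 * x
      negate = Ring.solve-∀ ℚ-ring
      sq : ∀ x → - ½ * (- x * - x) ≡ - ½ * (x * x)
      sq = Ring.solve-∀ ℚ-ring
    Q∼ : Q ∼exp[ - ½ * h₁ , - ½ * ½ * ½ * H₂ h ]
    Q∼ = ∼exp-cong (∑-*ˡ h (- ½) inv)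
                   (trans (∑-cong h λ i _ → sq (inv i)) (∑-*ˡ h (- ½ * ½ * ½) _))
        (∏-∼exp h λ i i<h → ∼exp-linear (*-integral neg½-integral (invₕ i<h)))
      where
      sq : ∀ x → - ½ * (- ½ * x * (- ½ * x)) ≡ - ½ * ½ * ½ * (x * x)
      sq = Ring.solve-∀ ℚ-ring
    Q²∼ : Q * Q ∼exp[ - 1 * h₁ , 0 ]
    Q²∼ = ∼exp-≈ (fromℕ-integral 0) (+-cong small small) (∼exp-cong (collect h₁) refl (∼exp-* Q∼ Q∼))
      where
      small = scaled≈0 (- ½ * ½ * ½) (*-integral (*-integral neg½-integral ½-integral) ½-integral)
      collect : ∀ x → - ½ * x + - ½ * x ≡ - 1 * x
      collect = Ring.solve-∀ ℚ-ring

  2h-reflect : ∀ i j → suc (i ℕ.+ j) ≡ 2 ℕ.* h → P ≡ 1 + (1 + fromℕ i + fromℕ j)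
  2h-reflect i j eq = trans (fromℕ-suc (2 ℕ.* h)) (cong (λ x → 1 + x) (fromℕ-reflect i j eq))

  -- The product is (-1)^(p-1) C(p - 1, p - 1).
  ∏-full : ∏ (2 ℕ.* h) (λ i → 1 + P * - inv i) ≡ 1
  ∏-full = begin
    ∏ (2 ℕ.* h) (λ i → 1 + P * - inv i)
      ≡⟨ trans (∏-cong (2 ℕ.* h) λ i _ → normalise-factor i) (∏-* (2 ℕ.* h) _ _) ⟩
    ∏ (2 ℕ.* h) (λ i → P - (1 + fromℕ i)) * ∏ (2 ℕ.* h) (λ i → - inv i)
      ≡⟨ cong (_* ∏ (2 ℕ.* h) (λ i → - inv i)) (∏-reverse (2 ℕ.* h) _ (λ j → 1 + fromℕ j) λ i j eq →
           trans (cong (_- (1 + fromℕ i)) (2h-reflect i j eq)) (arith (fromℕ i) (fromℕ j))) ⟩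
    ∏ (2 ℕ.* h) (λ i → 1 + fromℕ i) * ∏ (2 ℕ.* h) (λ i → - inv i)
      ≡⟨ ∏-* (2 ℕ.* h) _ _ ⟨
    ∏ (2 ℕ.* h) (λ i → (1 + fromℕ i) * - inv i)
      ≡⟨ ∏-cong (2 ℕ.* h) (λ i _ → trans (swap (1 + fromℕ i) (inv i)) (cong -_ (inv-*′ i))) ⟩
    ∏ (2 ℕ.* h) (λ _ → - 1)
      ≡⟨ ∏-double-const h (- 1) ⟩
    ∏ h (λ _ → - 1 * - 1)
      ≡⟨ ∏-one h (λ _ _ → refl) ⟩
    1 ∎
    where
    open ≡-Reasoning
    arith : ∀ x y → 1 + (1 + x + y) - (1 + x) ≡ 1 + y
    arith = Ring.solve-∀ ℚ-ring
    swap : ∀ x i → x * - i ≡ - (i * x)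
    swap = Ring.solve-∀ ℚ-ring

  -- Wolstenholme's congruence. Multiplication by the product of `∏-full` turns Y into the product
  -- of the 1 - P²/k². The first order cancels, so the sum of the 1/k² modulo p suffices and H(p -
  -- 1) modulo p² is avoided.
  Y≈1 : ¬ (p ∣ 3) → Y ≈ 1 [ P³ ]
  Y≈1 p∤3 = ≈-trans (≈-reflexive Y-pairs) (∼exp-unique pairs∼ 1-∼exp)
    where
    pairs = ∏ (2 ℕ.* h) λ k → (1 + P * inv k) * (1 + P * - inv k)
    Y-pairs : Y ≡ pairs
    Y-pairs = trans (sym (*-identityʳ Y)) (trans (cong (Y *_) (sym ∏-full)) (sym (∏-* (2 ℕ.* h) _ _)))
    pairs∼ : pairs ∼exp[ 0 , 0 ]
    pairs∼ = ∼exp-≈ (fromℕ-integral 0)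
      (≈-trans (*-congˡ (neg-integral 1-integral) (H₂-2h≈0 p∤3)) (≈-reflexive (*-zeroʳ (- 1))))
      (∼exp-cong (trans (∑-cong (2 ℕ.* h) λ k _ → cancel (inv k)) (trans (∑-*ˡ (2 ℕ.* h) 0 inv) (*-zeroˡ (∑ (2 ℕ.* h) inv))))
                 (trans (∑-cong (2 ℕ.* h) λ k _ → sq (inv k)) (∑-*ˡ (2 ℕ.* h) (- 1) _))
        (∏-∼exp (2 ℕ.* h) λ k k<2h → ∼exp-* (∼exp-linear (invᵢ k<2h)) (∼exp-linear (neg-integral (invᵢ k<2h)))))
      where
      cancel : ∀ x → x + - x ≡ 0 * x
      cancel = Ring.solve-∀ ℚ-ring
      sq : ∀ x → - ½ * (x * x) + - ½ * (- x * - x) ≡ - 1 * (x * x)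
      sq = Ring.solve-∀ ℚ-ring

  1+P*≈1 : ∀ {x} → Integral x → 1 + P * x ≈ 1 [ P ]
  1+P*≈1 x∈ = mod x∈ refl

  ∏≈1 : ∀ {m} n {f} → (∀ i → i ℕ.< n → Integral (f i)) → (∀ i → i ℕ.< n → f i ≈ 1 [ m ]) → ∏ n f ≈ 1 [ m ]
  ∏≈1 n f∈ f≈1 = ≈-trans (∏-≈ n f∈ (λ _ _ → 1-integral) f≈1) (≈-reflexive (∏-one n λ _ _ → refl))

  1+P*-integral : ∀ {x} → Integral x → Integral (1 + P * x)
  1+P*-integral x∈ = +-integral 1-integral (*-integral P-integral x∈)

  Y-integral : Integral Y
  Y-integral = ∏-integral (2 ℕ.* h) λ k k<2h → 1+P*-integral (invᵢ k<2h)

  Y≈1[P] : Y ≈ 1 [ P ]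
  Y≈1[P] = ∏≈1 (2 ℕ.* h) (λ k k<2h → 1+P*-integral (invᵢ k<2h)) λ k k<2h → 1+P*≈1 (invᵢ k<2h)

  -- Fermat's theorem for the base 2, read off from `2^[p-1]*Q`: both Q and C′ are products of
  -- factors that are 1 modulo P.
  2^[p-1]≈1 : 2^[p-1] ≈ 1 [ P ]
  2^[p-1]≈1 = *-cancelˡ Q-unit (begin
    Q * 2^[p-1]   ≈⟨ ≈-reflexive (trans (*-comm Q 2^[p-1]) 2^[p-1]*Q) ⟩
    C′            ≈⟨ ∏≈1 h (λ i i<h → 1+P*-integral (neg-integral (invₕ i<h))) (λ i i<h → 1+P*≈1 (neg-integral (invₕ i<h))) ⟩
    1             ≈⟨ ∏≈1 h (λ i i<h → 1+P*-integral (*-integral neg½-integral (invₕ i<h))) (λ i i<h → 1+P*≈1 (*-integral neg½-integral (invₕ i<h))) ⟨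
    Q             ≈⟨ ≈-reflexive (sym (*-identityʳ Q)) ⟩
    Q * 1         ∎)
    where open SetoidReasoning (≈-setoid P)

  ≈-modulus : ∀ {m n x y} → m ≡ n → x ≈ y [ m ] → x ≈ y [ n ]
  ≈-modulus refl x≈y = x≈y

  unit-cancel : ∀ {c x y} → Unit c → c * x ≡ c * y → x ≡ y
  unit-cancel {c} {x} {y} (unit _ {d} _ eq) cx≡cy =
    trans (undo x) (trans (cong (d *_) cx≡cy) (sym (undo y)))
    where
    undo : ∀ z → z ≡ d * (c * z)
    undo z = sym (trans (sym (*-assoc d c z)) (trans (cong (_* z) eq) (*-identityˡ z)))

  -- S at multiples of p, modulo p³

  2h : ℕ
  2h = 2 ℕ.* h

  central-integral : ∀ n → n ℕ.≤ 2h → Integral (central n)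
  central-integral n n≤2h = subst Integral (sym (central-∏ n)) (∏-integral n λ i i<n →
    *-integral (*-integral (odd-integral i) ½-integral) (invᵢ (ℕ.≤-trans i<n n≤2h)))

  α β : ℚ
  α = ∑ 2h λ j → central (suc j) * inv j
  β = ∑ 2h λ j → central (suc j) * (inv j * inv j)

  α-integral : Integral α
  α-integral = ∑-integral 2h λ j j<2h → *-integral (central-integral (suc j) j<2h) (invᵢ j<2h)

  β-integral : Integral β
  β-integral = ∑-integral 2h λ j j<2h →
    *-integral (central-integral (suc j) j<2h) (*-integral (invᵢ j<2h) (invᵢ j<2h))

  quadratic : ℚ → ℚ
  quadratic t = 1 - P * t * α - P * P * (t * t) * β

  -- In `F-∏` at a = P t one factor P stands in front, so the product of pairs is needed only modulo
  -- P², where it is 1. The remaining factor P t + (j + 1) contributes the linear and the quadratic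
  -- term.
  S-quadratic : ∀ {t} → Integral t → S p (P * t) ≈ quadratic t [ P³ ]
  S-quadratic {t} t∈ = begin
    S p (P * t)
      ≈⟨ ≈-reflexive (trans (S-F p (P * t)) (∑-head 2h (F (P * t)))) ⟩
    1 + ∑ 2h (λ j → F (P * t) (suc j))
      ≈⟨ +-cong (≈-refl {x = 1}) (∑-≈ 2h term) ⟩
    1 + ∑ 2h (λ j → - (P * t) * (central (suc j) * inv j) + - (P * P * (t * t)) * (central (suc j) * (inv j * inv j)))
      ≈⟨ ≈-reflexive (cong (λ x → 1 + x) (trans (∑-+ 2h _ _) (cong₂ _+_ (∑-*ˡ 2h (- (P * t)) _) (∑-*ˡ 2h (- (P * P * (t * t))) _)))) ⟩
    1 + (- (P * t) * α + - (P * P * (t * t)) * β)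
      ≈⟨ ≈-reflexive (regroup P t α β) ⟩
    quadratic t ∎
    where
    open SetoidReasoning (≈-setoid P³)
    regroup : ∀ P t a b → 1 + (- (P * t) * a + - (P * P * (t * t)) * b) ≡ 1 - P * t * a - P * P * (t * t) * b
    regroup = Ring.solve-∀ ℚ-ring
    term : ∀ j → j ℕ.< 2h → F (P * t) (suc j) ≈
      - (P * t) * (central (suc j) * inv j) + - (P * P * (t * t)) * (central (suc j) * (inv j * inv j)) [ P³ ]
    term j j<2h = begin
      F (P * t) (suc j)
        ≈⟨ ≈-reflexive (trans (F-∏ (P * t) j) (factor P t x c i Π)) ⟩
      P * (K * Π)
        ≈⟨ ≈-modulus (sym (*-assoc P P P)) (*-scale P (*-congˡ K∈ Π≈1)) ⟩
      P * (K * 1)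
        ≈⟨ ≈-reflexive (trans (expand P t x c i) (cong (λ y → - (P * t) * (c * i * y) + - (P * P * (t * t)) * (c * (i * i))) (inv-*′ j))) ⟩
      - (P * t) * (c * i * 1) + - (P * P * (t * t)) * (c * (i * i))
        ≈⟨ ≈-reflexive (cong (λ y → - (P * t) * y + - (P * P * (t * t)) * (c * (i * i))) (*-identityʳ (c * i))) ⟩
      - (P * t) * (c * i) + - (P * P * (t * t)) * (c * (i * i)) ∎
      where
      x = fromℕ j
      c = central (suc j)
      i = inv j
      Π = ∏ j λ k → 1 - P * t * (P * t) * (inv k * inv k)
      K = - t * (P * t + (1 + x)) * (c * (i * i))
      K∈ : Integral K
      K∈ = *-integral
        (*-integral (neg-integral t∈) (+-integral (*-integral P-integral t∈) (+-integral 1-integral (fromℕ-integral j))))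
        (*-integral (central-integral (suc j) j<2h) (*-integral (invᵢ j<2h) (invᵢ j<2h)))
      shape : ∀ P t i → 1 - P * t * (P * t) * (i * i) ≡ 1 + P * P * - (t * t * (i * i))
      shape = Ring.solve-∀ ℚ-ring
      Π-factor : ∀ k → k ℕ.< j → 1 - P * t * (P * t) * (inv k * inv k) ≈ 1 [ P * P ]
      Π-factor k k<j = mod (neg-integral (*-integral (*-integral t∈ t∈) (*-integral k∈ k∈))) (shape P t (inv k))
        where k∈ = invᵢ (ℕ.<-trans k<j j<2h)
      Π≈1 : Π ≈ 1 [ P * P ]
      Π≈1 = ∏≈1 j (λ k k<j → ≈-integral (*-integral P-integral P-integral) (Π-factor k k<j) 1-integral) Π-factor
      factor : ∀ P t x c i Π → - (P * t) * (P * t + (1 + x)) * (c * (i * i)) * Π ≡ P * (- t * (P * t + (1 + x)) * (c * (i * i)) * Π)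
      factor = Ring.solve-∀ ℚ-ring
      expand : ∀ P t x c i → P * (- t * (P * t + (1 + x)) * (c * (i * i)) * 1) ≡
        - (P * t) * (c * i * (i * (1 + x))) + - (P * P * (t * t)) * (c * (i * i))
      expand = Ring.solve-∀ ℚ-ring

  S≈1 : ∀ {t} → Integral t → S p (P * t) ≈ 1 [ P ]
  S≈1 {t} t∈ = ≈-trans (≈-weaken {c = P * P} (*-integral P-integral P-integral) (≈-modulus (*-assoc P P P) (S-quadratic t∈)))
    (mod (+-integral (*-integral (neg-integral t∈) α-integral)
                     (neg-integral (*-integral P-integral (*-integral (*-integral t∈ t∈) β-integral))))
         (factor P t α β))
    where
    factor : ∀ P t a b → 1 - P * t * a - P * P * (t * t) * b ≡ 1 + P * (- t * a + - (P * (t * t * b)))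
    factor = Ring.solve-∀ ℚ-ring

  -- Descent in steps of two: each of the first three products of V-split contains a multiple of p.

  triple : ℕ → ℚ
  triple j = ½ * (inv j * inv j * inv j)

  triple-integral : ∀ {j} → j ℕ.< 2h → Integral (triple j)
  triple-integral j<2h = *-integral ½-integral (*-integral (*-integral (invᵢ j<2h) (invᵢ j<2h)) (invᵢ j<2h))

  -- The factor at j = h - 1 is 2h + 1 = p.
  ∏-2j+3≈0 : ∏ 2h (λ j → 2 * fromℕ j + 3) ≈ 0 [ P ]
  ∏-2j+3≈0 = ∏-≈0 2h (ℕ.pred h) (ℕ.≤-trans (ℕ.≤-reflexive suc-pred) h≤2h)
    (λ j _ → +-integral (*-integral (fromℕ-integral 2) (fromℕ-integral j)) (fromℕ-integral 3))
    (mod 1-integral (begin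
      2 * fromℕ (ℕ.pred h) + 3           ≡⟨ arith (fromℕ (ℕ.pred h)) ⟩
      1 + 2 * (1 + fromℕ (ℕ.pred h))     ≡⟨ cong (λ x → 1 + 2 * x) (trans (sym (fromℕ-suc (ℕ.pred h))) (cong fromℕ suc-pred)) ⟩
      1 + 2 * fromℕ h                    ≡⟨ P-odd ⟨
      P                                  ≡⟨ one P ⟩
      0 + P * 1                          ∎))
    where
    open ≡-Reasoning
    suc-pred : suc (ℕ.pred h) ≡ h
    suc-pred = ℕ.suc-pred h {{ℕ.>-nonZero 0<h}}
    arith : ∀ x → 2 * x + 3 ≡ 1 + 2 * (1 + x)
    arith = Ring.solve-∀ ℚ-ring
    one : ∀ x → x ≡ 0 + x * 1
    one = Ring.solve-∀ ℚ-ring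

  -- The residue is written as r + 2 because 0 and 1 are exceptional: for them one of the first two
  -- products would meet its multiple of p only at j = p - 1, just outside the range.
  V≈0 : ∀ r {a t} → suc (suc r) ℕ.≤ 2h → Integral t → a ≡ fromℕ (suc (suc r)) + P * t → V a 2h ≈ 0 [ P³ ]
  V≈0 r {a} {t} 2+r≤2h t∈ refl = ≈-trans (≈-reflexive (V-split a 2h))
    (≈-trans (*-congʳ (∏-integral 2h λ j → triple-integral) (*-≈0 (*-≈0 ∏₁≈0 ∏₂≈0) ∏-2j+3≈0))
             (≈-reflexive (*-zeroˡ (∏ 2h triple))))
    where
    a∈ : Integral a
    a∈ = +-integral (fromℕ-integral (suc (suc r))) (*-integral P-integral t∈)
    -- Chosen so that (r + 2) + j = p, whence a + j = P (1 + t).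
    j = 2h ℕ.∸ suc r
    j+suc-r : j ℕ.+ suc r ≡ 2h
    j+suc-r = ℕ.m∸n+n≡m (ℕ.<⇒≤ 2+r≤2h)
    sum : fromℕ (suc (suc r)) + fromℕ j ≡ P
    sum = trans (sym (fromℕ-+ (suc (suc r)) j)) (cong (fromℕ ∘ suc) (trans (ℕ.+-comm (suc r) j) j+suc-r))
    collect : ∀ r x P t → r + P * t + x ≡ 0 + (r + x) + P * t
    collect = Ring.solve-∀ ℚ-ring
    factor : ∀ P t → 0 + P + P * t ≡ 0 + P * (1 + t)
    factor = Ring.solve-∀ ℚ-ring
    ∏₁≈0 : ∏ 2h (λ j → a + fromℕ j) ≈ 0 [ P ]
    ∏₁≈0 = ∏-≈0 2h j (ℕ.≤-trans (ℕ.m<m+n j (ℕ.s≤s ℕ.z≤n)) (ℕ.≤-reflexive j+suc-r))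
      (λ i _ → +-integral a∈ (fromℕ-integral i))
      (mod (+-integral 1-integral t∈)
        (trans (collect (fromℕ (suc (suc r))) (fromℕ j) P t) (trans (cong (λ y → 0 + y + P * t) sum) (factor P t))))
    cancel : ∀ x P t → x + 1 - (1 + x + P * t) ≡ 0 + P * - t
    cancel = Ring.solve-∀ ℚ-ring
    ∏₂≈0 : ∏ 2h (λ j → fromℕ j + 1 - a) ≈ 0 [ P ]
    -- At index r + 1 the factor is (r + 2) - a = -P t.
    ∏₂≈0 = ∏-≈0 2h (suc r) 2+r≤2h
      (λ i _ → -integral (+-integral (fromℕ-integral i) 1-integral) a∈)
      (mod (neg-integral t∈)
        (trans (cong (λ y → fromℕ (suc r) + 1 - (y + P * t)) (fromℕ-suc (suc r))) (cancel (fromℕ (suc r)) P t)))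

  evens odds : ℚ → ℕ → ℚ
  evens a m = ∏ m λ i → a - 2 * fromℕ i
  odds  a m = ∏ m λ i → a - 1 - 2 * fromℕ i

  odds-integral : ∀ {a} m → Integral a → Integral (odds a m)
  odds-integral m a∈ = ∏-integral m λ i _ → -integral (-integral a∈ 1-integral) (*-integral (fromℕ-integral 2) (fromℕ-integral i))

  -- The product form postpones all inversions. The induction keeps a and trades one step for s + 2,
  -- so the recurrence is always applied at the last value a - 2m = s + 2 + P t, whose residue lies
  -- in the range of `V≈0`.
  descent : ∀ m s {a t} → s ℕ.+ 2 ℕ.* m ℕ.≤ 2h → Integral t → a ≡ fromℕ s + 2 * fromℕ m + P * t →
            S p a * (evens a m * evens a m) ≈ odds a m * odds a m * S p (a - 2 * fromℕ m) [ P³ ]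
  descent zero s {a} _ _ _ = ≈-reflexive (trans (drop (S p a)) (cong (λ b → 1 * 1 * S p b) (sym (a-0 a))))
    where
    drop : ∀ x → x * (1 * 1) ≡ 1 * 1 * x
    drop = Ring.solve-∀ ℚ-ring
    a-0 : ∀ a → a - 2 * 0 ≡ a
    a-0 = Ring.solve-∀ ℚ-ring
  descent (suc m) s {a} {t} s+2m≤2h t∈ a≡ = begin
    S p a * (f * φ * (f * φ))
      ≈⟨ ≈-reflexive (r₁ (S p a) f φ) ⟩
    S p a * (f * f) * (φ * φ)
      ≈⟨ *-congʳ (*-integral φ∈ φ∈) (descent m (suc (suc s)) bound t∈ a≡′) ⟩
    g * g * S p φ * (φ * φ)
      ≈⟨ ≈-reflexive (trans (r₂ g (S p φ) φ) (cong (g * g *_) (S-recurrence φ 2h))) ⟩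
    g * g * ((φ - 1) * (φ - 1) * S p (φ - 2) + (2 * φ - 1) * V φ 2h)
      ≈⟨ *-congˡ (*-integral g∈ g∈) (+-cong (≈-refl {x = (φ - 1) * (φ - 1) * S p (φ - 2)})
           (*-congˡ (-integral (*-integral (fromℕ-integral 2) φ∈) 1-integral)
             (V≈0 s (ℕ.≤-trans (ℕ.m≤m+n (suc (suc s)) (2 ℕ.* m)) bound) t∈ φ≡))) ⟩
    g * g * ((φ - 1) * (φ - 1) * S p (φ - 2) + (2 * φ - 1) * 0)
      ≈⟨ ≈-reflexive (r₃ g φ (S p (φ - 2))) ⟩
    g * (φ - 1) * (g * (φ - 1)) * S p (φ - 2)
      ≈⟨ ≈-reflexive (cong₂ (λ y z → g * y * (g * y) * S p z) (swap a (fromℕ m)) next) ⟩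
    g * (a - 1 - 2 * fromℕ m) * (g * (a - 1 - 2 * fromℕ m)) * S p (a - 2 * fromℕ (suc m)) ∎
    where
    open SetoidReasoning (≈-setoid P³)
    f = evens a m
    g = odds a m
    φ = a - 2 * fromℕ m
    a∈ : Integral a
    a∈ = subst Integral (sym a≡) (+-integral (+-integral (fromℕ-integral s) (*-integral (fromℕ-integral 2) (fromℕ-integral (suc m)))) (*-integral P-integral t∈))
    φ∈ : Integral φ
    φ∈ = -integral a∈ (*-integral (fromℕ-integral 2) (fromℕ-integral m))
    g∈ = odds-integral m a∈
    arithℕ : ∀ s m → suc (suc s) ℕ.+ 2 ℕ.* m ≡ s ℕ.+ 2 ℕ.* suc m
    arithℕ = ℕ.solve-∀
    bound : suc (suc s) ℕ.+ 2 ℕ.* m ℕ.≤ 2h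
    bound = ℕ.≤-trans (ℕ.≤-reflexive (arithℕ s m)) s+2m≤2h
    fromℕ-2+ : ∀ n → fromℕ (suc (suc n)) ≡ 2 + fromℕ n
    fromℕ-2+ n = fromℕ-+ 2 n
    shift : ∀ s m P t → s + 2 * (1 + m) + P * t ≡ 2 + s + 2 * m + P * t
    shift = Ring.solve-∀ ℚ-ring
    a≡′ : a ≡ fromℕ (suc (suc s)) + 2 * fromℕ m + P * t
    a≡′ = trans a≡ (trans (cong (λ y → fromℕ s + 2 * y + P * t) (fromℕ-suc m))
      (trans (shift (fromℕ s) (fromℕ m) P t) (cong (λ y → y + 2 * fromℕ m + P * t) (sym (fromℕ-2+ s)))))
    cancel : ∀ s m P t → s + 2 * m + P * t - 2 * m ≡ s + P * t
    cancel = Ring.solve-∀ ℚ-ring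
    φ≡ : φ ≡ fromℕ (suc (suc s)) + P * t
    φ≡ = trans (cong (_- 2 * fromℕ m) a≡′) (cancel (fromℕ (suc (suc s))) (fromℕ m) P t)
    r₁ : ∀ s f φ → s * (f * φ * (f * φ)) ≡ s * (f * f) * (φ * φ)
    r₁ = Ring.solve-∀ ℚ-ring
    r₂ : ∀ g s φ → g * g * s * (φ * φ) ≡ g * g * (φ * φ * s)
    r₂ = Ring.solve-∀ ℚ-ring
    r₃ : ∀ g φ s → g * g * ((φ - 1) * (φ - 1) * s + (2 * φ - 1) * 0) ≡ g * (φ - 1) * (g * (φ - 1)) * s
    r₃ = Ring.solve-∀ ℚ-ring
    swap : ∀ a x → a - 2 * x - 1 ≡ a - 1 - 2 * x
    swap = Ring.solve-∀ ℚ-ring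
    step : ∀ a x → a - 2 * x - 2 ≡ a - 2 * (1 + x)
    step = Ring.solve-∀ ℚ-ring
    next : φ - 2 ≡ a - 2 * fromℕ (suc m)
    next = trans (step a (fromℕ m)) (cong (λ y → a - 2 * y) (sym (fromℕ-suc m)))

  evens-unit : ∀ n → n ℕ.≤ h → Unit (∏ n λ j → 2 * (1 + fromℕ j))
  evens-unit n n≤h = ∏-unit n λ j j<n → *-unit 2-unit
    (subst Unit (fromℕ-suc j) (fromℕ-unit (>⇒∤ (ℕ.s≤s (double-< (ℕ.≤-trans j<n n≤h))))))

  -- The values at t = -1 and t = 1

  -- The symmetry carries -p to p - 1 = 2h, and h steps of two lead from there to 0, where the sum
  -- is 1. The products collected on the way have the quotient (2h - 1)!!/(2h)!! = `central h`.
  S[-P] : ¬ (p ∣ 3) → S p (P * - 1) ≈ 2^[p-1] * 2^[p-1] [ P³ ]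
  S[-P] p∤3 = begin
    S p (P * - 1)
      ≈⟨ ≈-reflexive (trans (sym (S-symmetric p (P * - 1))) (cong (S p) a≡)) ⟩
    S p a
      ≈⟨ *-cancelˡ (*-unit e-unit e-unit) squared ⟩
    central h * central h
      ≈⟨ ≈-reflexive central²≡Q² ⟩
    Q * Q
      ≈⟨ *-cong (unit-integral Q-unit) (fromℕ-integral (2 ℕ.^ 2h)) (≈-sym (2^[p-1]≈Q p∤3)) (≈-sym (2^[p-1]≈Q p∤3)) ⟩
    2^[p-1] * 2^[p-1] ∎
    where
    open SetoidReasoning (≈-setoid P³)
    -- The summand `P * 0` supplies the shape with t = 0 that `descent` and the reversal lemmas
    -- expect.
    a = 2 * fromℕ h + P * 0
    e = ∏ h λ j → 2 * (1 + fromℕ j)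
    e-unit = evens-unit h ℕ.≤-refl
    rearrange : ∀ x → - 1 - (1 + 2 * x) * - 1 ≡ 2 * x
    rearrange = Ring.solve-∀ ℚ-ring
    a≡ : - 1 - P * - 1 ≡ a
    a≡ = trans (cong (λ y → - 1 - y * - 1) P-odd) (trans (rearrange (fromℕ h)) (pad (fromℕ h) P))
      where
      pad : ∀ x P → 2 * x ≡ 2 * x + P * 0
      pad = Ring.solve-∀ ℚ-ring
    zero+ : ∀ x P → 2 * x + P * 0 ≡ 0 + 2 * x + P * 0
    zero+ = Ring.solve-∀ ℚ-ring
    a-2h : ∀ x P → 2 * x + P * 0 - 2 * x ≡ P * 0
    a-2h = Ring.solve-∀ ℚ-ring
    drop0 : ∀ x P → x + P * 0 ≡ x
    drop0 = Ring.solve-∀ ℚ-ring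
    at-0 : ∀ P a b → 1 - P * 0 * a - P * P * (0 * 0) * b ≡ 1
    at-0 = Ring.solve-∀ ℚ-ring
    evens≡ : evens a h ≡ e
    evens≡ = trans (∏-evens-reverse h (P * 0)) (∏-cong h λ j _ → drop0 (2 * (1 + fromℕ j)) P)
    odds≡ : odds a h ≡ central h * e
    odds≡ = trans (∏-odds-reverse h (P * 0)) (trans (∏-cong h λ j _ → drop0 (odd j) P) (sym (central-*-evens h)))
    r₁ : ∀ c e → c * e * (c * e) * 1 ≡ e * e * (c * c)
    r₁ = Ring.solve-∀ ℚ-ring
    squared : e * e * S p a ≈ e * e * (central h * central h) [ P³ ]
    squared = begin
      e * e * S p a
        ≈⟨ ≈-reflexive (trans (*-comm (e * e) (S p a)) (cong (λ y → S p a * (y * y)) (sym evens≡))) ⟩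
      S p a * (evens a h * evens a h)
        ≈⟨ descent h 0 ℕ.≤-refl (fromℕ-integral 0) (zero+ (fromℕ h) P) ⟩
      odds a h * odds a h * S p (a - 2 * fromℕ h)
        ≈⟨ ≈-reflexive (cong (λ y → odds a h * odds a h * S p y) (a-2h (fromℕ h) P)) ⟩
      odds a h * odds a h * S p (P * 0)
        ≈⟨ *-congˡ (*-integral o∈ o∈) (≈-trans (S-quadratic (fromℕ-integral 0)) (≈-reflexive (at-0 P α β))) ⟩
      odds a h * odds a h * 1
        ≈⟨ ≈-reflexive (trans (cong (λ y → y * y * 1) odds≡) (r₁ (central h) e)) ⟩
      e * e * (central h * central h) ∎
      where
      o∈ : Integral (odds a h)
      o∈ = odds-integral h (+-integral (*-integral (fromℕ-integral 2) (fromℕ-integral h)) (*-integral P-integral (fromℕ-integral 0)))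

  -- At a = 2m + 1 the factor of V with j = 2m is exactly 0, so each value is a multiple of the
  -- preceding one. The chain starts at a = 1, where the coefficient (a - 1)² vanishes.
  S[odd]≡0 : ∀ m → m ℕ.< h → S p (odd m) ≡ 0
  S[odd]≡0 m m<h = unit-cancel (*-unit (odd-unit m<h) (odd-unit m<h)) (begin
    odd m * odd m * S p (odd m)
      ≡⟨ S-recurrence (odd m) 2h ⟩
    (odd m - 1) * (odd m - 1) * S p (odd m - 2) + (2 * odd m - 1) * V (odd m) 2h
      ≡⟨ cong₂ (λ x y → x + (2 * odd m - 1) * y) (previous m m<h) V≡0 ⟩
    0 + (2 * odd m - 1) * 0
      ≡⟨ r (odd m) ⟩
    odd m * odd m * 0 ∎)
    where
    open ≡-Reasoning
    r : ∀ x → 0 + (2 * x - 1) * 0 ≡ x * x * 0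
    r = Ring.solve-∀ ℚ-ring
    vanish : ∀ x y z w → y * (2 * x + 1 - (2 * x + 1)) * z * w ≡ 0
    vanish = Ring.solve-∀ ℚ-ring
    V≡0 : V (odd m) 2h ≡ 0
    V≡0 = ∏-zero 2h (2 ℕ.* m) (ℕ.*-monoʳ-< 2 m<h)
      (trans (cong (λ x → (odd m + fromℕ (2 ℕ.* m)) * (x + 1 - odd m) * (2 * fromℕ (2 ℕ.* m) + 3) * triple (2 ℕ.* m)) (fromℕ-double m))
        (vanish (fromℕ m) (odd m + fromℕ (2 ℕ.* m)) (2 * fromℕ (2 ℕ.* m) + 3) (triple (2 ℕ.* m))))
    previous : ∀ m → m ℕ.< h → (odd m - 1) * (odd m - 1) * S p (odd m - 2) ≡ 0
    previous zero    _   = *-zeroˡ (S p (odd 0 - 2))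
    previous (suc m) m<h = begin
      (odd (suc m) - 1) * (odd (suc m) - 1) * S p (odd (suc m) - 2)
        ≡⟨ cong (λ x → (odd (suc m) - 1) * (odd (suc m) - 1) * S p x) (trans (cong (λ y → 2 * y + 1 - 2) (fromℕ-suc m)) (back (fromℕ m))) ⟩
      (odd (suc m) - 1) * (odd (suc m) - 1) * S p (odd m)
        ≡⟨ cong ((odd (suc m) - 1) * (odd (suc m) - 1) *_) (S[odd]≡0 m (ℕ.<⇒≤ m<h)) ⟩
      (odd (suc m) - 1) * (odd (suc m) - 1) * 0
        ≡⟨ *-zeroʳ ((odd (suc m) - 1) * (odd (suc m) - 1)) ⟩
      0 ∎
      where
      back : ∀ x → 2 * (1 + x) + 1 - 2 ≡ 2 * x + 1
      back = Ring.solve-∀ ℚ-ring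

  W²≡ : 2^[p-1] * 2^[p-1] ≡ ∏ 2h (λ _ → 2 * 2)
  W²≡ = trans (cong (λ x → x * x) (sym (∏-const 2h 2))) (∏-² 2h (λ _ → 2))

  -- U = (2p - 1)!/p!, the numerator of C(2p - 1, p - 1).
  U : ℚ
  U = ∏ 2h λ x → 1 + P + fromℕ x

  Y≡ : Y ≡ U * ∏ 2h inv
  Y≡ = trans (∏-cong 2h λ k _ → trans (cong (_+ P * inv k) (sym (inv-*′ k))) (collect P (fromℕ k) (inv k))) (∏-* 2h _ inv)
    where
    collect : ∀ P x i → i * (1 + x) + P * i ≡ (1 + P + x) * i
    collect = Ring.solve-∀ ℚ-ring

  P≡ : P ≡ 1 + fromℕ 2h
  P≡ = fromℕ-suc 2h

  T : ℚ
  T = ∏ 2h λ x → 2 * (2 * fromℕ x + 3)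

  -- From `∏-upper-half` at p, that is from (2p)!/p!: the left side has the additional first factor
  -- 2, the right side the additional last factor 2p.
  T≡ : T ≡ P * U
  T≡ = unit-cancel 2-unit (begin
    2 * T
      ≡⟨ cong (2 *_) (∏-cong 2h λ x _ → trans (r₁ (fromℕ x)) (cong (λ y → 2 * (2 * y + 1)) (sym (fromℕ-suc x)))) ⟩
    2 * ∏ 2h (λ k → 2 * odd (suc k))
      ≡⟨ ∏-head 2h (λ k → 2 * odd k) ⟨
    ∏ p (λ k → 2 * odd k)
      ≡⟨ ∏-upper-half p ⟨
    U * (1 + P + fromℕ 2h)
      ≡⟨ cong (U *_) (trans (r₂ P (fromℕ 2h)) (cong (λ y → P + y) (sym P≡))) ⟩
    U * (P + P)
      ≡⟨ r₃ U P ⟩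
    2 * (P * U) ∎)
    where
    open ≡-Reasoning
    r₁ : ∀ x → 2 * (2 * x + 3) ≡ 2 * (2 * (1 + x) + 1)
    r₁ = Ring.solve-∀ ℚ-ring
    r₂ : ∀ P x → 1 + P + x ≡ P + (1 + x)
    r₂ = Ring.solve-∀ ℚ-ring
    r₃ : ∀ U P → U * (P + P) ≡ 2 * (P * U)
    r₃ = Ring.solve-∀ ℚ-ring

  ∏-odds : ∏ 2h (λ x → 2 * (2 * fromℕ x + 3) * inv x) ≡ P * Y
  ∏-odds = trans (∏-* 2h _ inv) (trans (cong (_* ∏ 2h inv) T≡)
    (trans (*-assoc P U (∏ 2h inv)) (cong (P *_) (sym Y≡))))

  -- An exact evaluation. The sum vanishes at p - 2, so p² S(p) = (2p - 1) V(p, p - 1). Here 2p - 1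
  -- is the missing top factor of `A` and completes it to P U; `T` is another P U; the factors j + 1
  -- - P disappear by `∏-full`. The power 4^(p-1) lends one 4 to each index, which clears the ½ and
  -- doubles 2j + 3.
  S[P] : S p P * (2^[p-1] * 2^[p-1]) ≡ Y * Y
  S[P] = begin
    S p P * (W * W)
      ≡⟨ undo (S p P * (W * W)) ⟩
    i * i * (P * P * (S p P * (W * W)))
      ≡⟨ cong (i * i *_) scaled ⟩
    i * i * (P * P * (Y * Y))
      ≡⟨ undo (Y * Y) ⟨
    Y * Y ∎
    where
    open ≡-Reasoning
    W = 2^[p-1]
    i = inv 2h
    regroup : ∀ i P x → i * i * (P * P * x) ≡ i * P * (i * P) * x
    regroup = Ring.solve-∀ ℚ-ring
    undo : ∀ x → x ≡ i * i * (P * P * x)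
    undo x = sym (trans (regroup i P x) (trans (cong (λ y → y * y * x) (inv-* 2h)) (*-identityˡ x)))
    A = ∏ 2h λ x → P + fromℕ x
    I = ∏ 2h inv
    [2P-1]A : (2 * P - 1) * A ≡ P * U
    [2P-1]A = begin
      (2 * P - 1) * A
        ≡⟨ *-comm (2 * P - 1) A ⟩
      A * (2 * P - 1)
        ≡⟨ cong (A *_) (trans (split P) (trans (cong (λ y → P + y - 1) P≡) (tail P (fromℕ 2h)))) ⟩
      A * (P + fromℕ 2h)
        ≡⟨ ∏-head 2h (λ x → P + fromℕ x) ⟩
      (P + 0) * ∏ 2h (λ x → P + fromℕ (suc x))
        ≡⟨ cong₂ _*_ (+-identityʳ P) (∏-cong 2h λ x _ → trans (cong (λ y → P + y) (fromℕ-suc x)) (shift P (fromℕ x))) ⟩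
      P * U ∎
      where
      split : ∀ P → 2 * P - 1 ≡ P + P - 1
      split = Ring.solve-∀ ℚ-ring
      tail : ∀ P x → P + (1 + x) - 1 ≡ P + x
      tail = Ring.solve-∀ ℚ-ring
      shift : ∀ P x → P + (1 + x) ≡ 1 + P + x
      shift = Ring.solve-∀ ℚ-ring
    V≡ : V P 2h * (W * W) ≡ A * T * (I * I)
    V≡ = begin
      V P 2h * (W * W)
        ≡⟨ trans (cong (V P 2h *_) W²≡) (sym (∏-* 2h _ _)) ⟩
      ∏ 2h (λ j → (P + fromℕ j) * (fromℕ j + 1 - P) * (2 * fromℕ j + 3) * triple j * (2 * 2))
        ≡⟨ ∏-cong 2h (λ j _ → trans (r₁ P (fromℕ j) (inv j)) (cong (λ y → (P + fromℕ j) * (2 * (2 * fromℕ j + 3)) * (inv j * inv j) * y) (sym (normalise-factor j)))) ⟩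
      ∏ 2h (λ j → (P + fromℕ j) * (2 * (2 * fromℕ j + 3)) * (inv j * inv j) * (1 + P * - inv j))
        ≡⟨ trans (∏-* 2h _ _) (trans (cong₂ _*_ (trans (∏-* 2h _ _) (cong₂ _*_ (∏-* 2h _ _) (∏-* 2h inv inv))) ∏-full) (*-identityʳ _)) ⟩
      A * T * (I * I) ∎
      where
      r₁ : ∀ P x i → (P + x) * (x + 1 - P) * (2 * x + 3) * (½ * (i * i * i)) * (2 * 2) ≡
                     (P + x) * (2 * (2 * x + 3)) * (i * i) * ((P - (1 + x)) * - i)
      r₁ = Ring.solve-∀ ℚ-ring
    P-2 : P - 2 ≡ odd (ℕ.pred h)
    P-2 = trans (cong (_- 2) (trans P-odd (cong (λ y → 1 + 2 * y)
      (trans (cong fromℕ (sym (ℕ.suc-pred h {{ℕ.>-nonZero 0<h}}))) (fromℕ-suc (ℕ.pred h)))))) (r (fromℕ (ℕ.pred h)))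
      where
      r : ∀ x → 1 + 2 * (1 + x) - 2 ≡ 2 * x + 1
      r = Ring.solve-∀ ℚ-ring
    S[P-2]≡0 : S p (P - 2) ≡ 0
    S[P-2]≡0 = trans (cong (S p) P-2) (S[odd]≡0 (ℕ.pred h) (ℕ.≤-reflexive (ℕ.suc-pred h {{ℕ.>-nonZero 0<h}})))
    scaled : P * P * (S p P * (W * W)) ≡ P * P * (Y * Y)
    scaled = begin
      P * P * (S p P * (W * W))
        ≡⟨ *-assoc (P * P) (S p P) (W * W) ⟨
      P * P * S p P * (W * W)
        ≡⟨ cong (_* (W * W)) (trans (S-recurrence P 2h) (cong (λ y → (P - 1) * (P - 1) * y + (2 * P - 1) * V P 2h) S[P-2]≡0)) ⟩
      ((P - 1) * (P - 1) * 0 + (2 * P - 1) * V P 2h) * (W * W)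
        ≡⟨ r₁ P (V P 2h) (W * W) ⟩
      (2 * P - 1) * (V P 2h * (W * W))
        ≡⟨ cong ((2 * P - 1) *_) V≡ ⟩
      (2 * P - 1) * (A * T * (I * I))
        ≡⟨ r₂ (2 * P - 1) A T I ⟩
      (2 * P - 1) * A * T * (I * I)
        ≡⟨ cong₂ (λ x y → x * y * (I * I)) [2P-1]A T≡ ⟩
      P * U * (P * U) * (I * I)
        ≡⟨ r₃ P U I ⟩
      P * P * (U * I * (U * I))
        ≡⟨ cong (λ y → P * P * (y * y)) Y≡ ⟨
      P * P * (Y * Y) ∎
      where
      r₁ : ∀ P v w → ((P - 1) * (P - 1) * 0 + (2 * P - 1) * v) * w ≡ (2 * P - 1) * (v * w)
      r₁ = Ring.solve-∀ ℚ-ring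
      r₂ : ∀ c a b i → c * (a * b * (i * i)) ≡ c * a * b * (i * i)
      r₂ = Ring.solve-∀ ℚ-ring
      r₃ : ∀ P U I → P * U * (P * U) * (I * I) ≡ P * P * (U * I * (U * I))
      r₃ = Ring.solve-∀ ℚ-ring

  -- The Fermat quotient and interpolation in t

  q : ℚ
  q = q₂ p

  2^[p-1]-1≡Pq : 2^[p-1] - 1 ≡ P * q
  2^[p-1]-1≡Pq = trans (sym (÷-*-cancel (2^[p-1] - 1) P)) (*-comm q P)

  2^[p-1]≡1+Pq : 2^[p-1] ≡ 1 + P * q
  2^[p-1]≡1+Pq = trans (split 2^[p-1]) (cong (λ x → 1 + x) 2^[p-1]-1≡Pq)
    where
    split : ∀ w → w ≡ 1 + (w - 1)
    split = Ring.solve-∀ ℚ-ring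

  q-integral : Integral q
  q-integral = subst Integral (sym (÷-unique z*P≡)) quotient-integral
    where
    open _≈_[_] 2^[p-1]≈1
    cancel : ∀ P z → z * P ≡ 1 + P * z - 1
    cancel = Ring.solve-∀ ℚ-ring
    z*P≡ : quotient * P ≡ 2^[p-1] - 1
    z*P≡ = trans (cancel P quotient) (cong (_- 1) (sym difference))

  -- A quadratic polynomial in t is determined by its values at 0, 1 and -1.
  S[Pt] : ¬ (p ∣ 3) → ∀ {t} → Integral t → let u = 2^[p-1] - 1 in
          S p (P * t) ≈ 1 - 2 * t * u + t * (2 * t + 1) * (u * u) [ P³ ]
  S[Pt] p∤3 {t} t∈ = begin
    S p (P * t)
      ≈⟨ S-quadratic t∈ ⟩
    quadratic t
      ≈⟨ ≈-reflexive (interpolate P t α β) ⟩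
    1 + ½ * t * (quadratic 1 + - 1 * quadratic (- 1)) + ½ * (t * t) * (quadratic 1 + quadratic (- 1) - 2)
      ≈⟨ +-cong (+-cong (≈-refl {x = 1}) (*-congˡ ½t∈ (+-cong at+1 (*-congˡ (neg-integral 1-integral) at-1))))
                (*-congˡ (*-integral ½-integral (*-integral t∈ t∈)) (+-cong (+-cong at+1 at-1) (≈-refl {x = - 2}))) ⟩
    1 + ½ * t * (1 - 2 * u + 3 * (u * u) + - 1 * ((1 + u) * (1 + u))) + ½ * (t * t) * (1 - 2 * u + 3 * (u * u) + (1 + u) * (1 + u) - 2)
      ≈⟨ ≈-reflexive (simplify t u) ⟩
    1 - 2 * t * u + t * (2 * t + 1) * (u * u)
      ≈⟨ ≈-reflexive (cong (λ u → 1 - 2 * t * u + t * (2 * t + 1) * (u * u)) (sym 2^[p-1]-1≡Pq)) ⟩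
    1 - 2 * t * (2^[p-1] - 1) + t * (2 * t + 1) * ((2^[p-1] - 1) * (2^[p-1] - 1)) ∎
    where
    open SetoidReasoning (≈-setoid P³)
    u = P * q
    -- The expansion of (1 + u)⁻² without its terms from u³ on, which vanish modulo P³. Multiplying
    -- by it replaces division by 4^(p-1) = (1 + u)².
    K = 1 - 2 * u + 3 * (u * u)
    ½t∈ = *-integral ½-integral t∈
    u∈ : Integral u
    u∈ = *-integral P-integral q-integral
    K∈ : Integral K
    K∈ = +-integral (-integral 1-integral (*-integral (fromℕ-integral 2) u∈)) (*-integral (fromℕ-integral 3) (*-integral u∈ u∈))
    at-1 : quadratic (- 1) ≈ (1 + u) * (1 + u) [ P³ ]
    at-1 = ≈-trans (≈-sym (S-quadratic (neg-integral 1-integral)))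
      (≈-trans (S[-P] p∤3) (≈-reflexive (cong (λ w → w * w) 2^[p-1]≡1+Pq)))
    quadratic-integral : Integral (quadratic 1)
    quadratic-integral = -integral
      (-integral 1-integral (*-integral (*-integral P-integral 1-integral) α-integral))
      (*-integral (*-integral (*-integral P-integral P-integral) (*-integral 1-integral 1-integral)) β-integral)
    inverse-² : ∀ P q f → f * ((1 + P * q) * (1 + P * q)) * (1 - 2 * (P * q) + 3 * (P * q * (P * q))) ≡
      f + P * P * P * (f * (4 * (q * q * q) + 3 * P * (q * q * q * q)))
    inverse-² = Ring.solve-∀ ℚ-ring
    remainder∈ : Integral (quadratic 1 * (4 * (q * q * q) + 3 * P * (q * q * q * q)))
    remainder∈ = *-integral quadratic-integral (+-integral
      (*-integral (fromℕ-integral 4) q³∈)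
      (*-integral (*-integral (fromℕ-integral 3) P-integral) (*-integral q³∈ q-integral)))
      where q³∈ = *-integral (*-integral q-integral q-integral) q-integral
    at+1 : quadratic 1 ≈ K [ P³ ]
    at+1 = begin
      quadratic 1
        ≈⟨ mod remainder∈ (inverse-² P q (quadratic 1)) ⟨
      quadratic 1 * ((1 + u) * (1 + u)) * K
        ≈⟨ *-congʳ K∈ (*-congʳ (*-integral 1+u∈ 1+u∈) (≈-sym (S-quadratic 1-integral))) ⟩
      S p (P * 1) * ((1 + u) * (1 + u)) * K
        ≈⟨ ≈-reflexive (cong₂ (λ x w → S p x * (w * w) * K) (*-identityʳ P) (sym 2^[p-1]≡1+Pq)) ⟩
      S p P * (2^[p-1] * 2^[p-1]) * K
        ≈⟨ ≈-reflexive (cong (_* K) S[P]) ⟩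
      Y * Y * K
        ≈⟨ *-congʳ K∈ (*-cong Y-integral 1-integral (Y≈1 p∤3) (Y≈1 p∤3)) ⟩
      1 * 1 * K
        ≈⟨ ≈-reflexive (*-identityˡ K) ⟩
      K ∎
      where
      1+u∈ = +-integral 1-integral u∈
    interpolate : ∀ P t a b → 1 - P * t * a - P * P * (t * t) * b ≡
      1 + ½ * t * (1 - P * 1 * a - P * P * (1 * 1) * b + - 1 * (1 - P * - 1 * a - P * P * (- 1 * - 1) * b)) +
      ½ * (t * t) * (1 - P * 1 * a - P * P * (1 * 1) * b + (1 - P * - 1 * a - P * P * (- 1 * - 1) * b) - 2)
    interpolate = Ring.solve-∀ ℚ-ring
    simplify : ∀ t u →
      1 + ½ * t * (1 - 2 * u + 3 * (u * u) + - 1 * ((1 + u) * (1 + u))) + ½ * (t * t) * (1 - 2 * u + 3 * (u * u) + (1 + u) * (1 + u) - 2) ≡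
      1 - 2 * t * u + t * (2 * t + 1) * (u * u)
    simplify = Ring.solve-∀ ℚ-ring

  -- Units modulo p and the binomial coefficient C(h, n)

  neg-unit : ∀ {x} → Unit x → Unit (- x)
  neg-unit {x} (unit x∈ {y} y∈ eq) = unit (neg-integral x∈) (neg-integral y∈) (trans (r x y) eq)
    where
    r : ∀ x y → - y * - x ≡ y * x
    r = Ring.solve-∀ ℚ-ring

  fromℤ-unit : ∀ i → ¬ (p ∣ ℤ.∣ i ∣) → Unit (fromℤ i)
  fromℤ-unit (+ n)    p∤i = fromℕ-unit p∤i
  fromℤ-unit -[1+ n ] p∤i = neg-unit (fromℕ-unit p∤i)

  -- With z = i/d the cleared numerator is d + p i, and p dividing it would divide d.
  1+P*-unit : ∀ {z} → Integral z → Unit (1 + P * z)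
  1+P*-unit {z} z∈@(integral {i} {d} p∤d eq) =
    unit-factor (fromℕ-integral d) (1+P*-integral z∈) (subst Unit (sym cleared) (fromℤ-unit (+ d ℤ.+ + p ℤ.* i) p∤N))
    where
    cleared : fromℕ d * (1 + P * z) ≡ fromℤ (+ d ℤ.+ + p ℤ.* i)
    cleared = trans (expand (fromℕ d) P z) (trans (cong (λ x → fromℕ d + P * x) eq)
      (trans (cong (λ x → fromℕ d + x) (sym (fromℤ-* (+ p) i))) (sym (fromℤ-+ (+ d) (+ p ℤ.* i)))))
      where
      expand : ∀ d P z → d * (1 + P * z) ≡ d + P * (z * d)
      expand = Ring.solve-∀ ℚ-ring
    p∤N : ¬ (p ∣ ℤ.∣ + d ℤ.+ + p ℤ.* i ∣)
    p∤N p∣N = p∤d (ℤ.∣⇒∣ᵤ (ℤ.∣m+n∣n⇒∣m {+ p} {+ d} {+ p ℤ.* i} (ℤ.∣ᵤ⇒∣ p∣N) (ℤ.∣m⇒∣m*n {m = + p} i ℤ.∣-refl)))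

  -- y + P z = y (1 + P y⁻¹ z).
  ≈-unit : ∀ {x y} → Unit y → x ≈ y [ P ] → Unit x
  ≈-unit {y = y} y-unit@(unit _ {y′} y′∈ eq) (mod {z} z∈ refl) =
    subst Unit (sym factor) (*-unit y-unit (1+P*-unit (*-integral y′∈ z∈)))
    where
    r₁ : ∀ y z P y′ → y * (1 + P * (y′ * z)) ≡ y + P * (y′ * y * z)
    r₁ = Ring.solve-∀ ℚ-ring
    factor : y + P * z ≡ y * (1 + P * (y′ * z))
    factor = sym (trans (r₁ y z P y′) (cong (λ x → y + P * x) (trans (cong (_* z) eq) (*-identityˡ z))))

  unit-quotient : ∀ {c x} → Unit c → Integral (c * x) → Integral x
  unit-quotient {c} {x} (unit _ {d} d∈ eq) cx∈ =
    subst Integral (trans (sym (*-assoc d c x)) (trans (cong (_* x) eq) (*-identityˡ x))) (*-integral d∈ cx∈)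

  Congruent : ℚ → ℚ → Set
  Congruent x y = Integral x × Integral y × x ≈ y [ P³ ]

  -- 2(h - i) = p - (2i + 1), so each factor (h - i)/(i + 1) is -(2i + 1)/(2i + 2) times 1 - P/(2i +
  -- 1).
  C-factor : ∀ n → n ℕ.≤ h → fromℕ (h C n) ≡ ∏ n (λ _ → - 1) * central n * ∏ n (λ i → 1 + P * - inv (2 ℕ.* i))
  C-factor n n≤h = begin
    fromℕ (h C n)
      ≡⟨ C-∏ h n n≤h ⟩
    ∏ n (λ i → (fromℕ h - fromℕ i) * inv i)
      ≡⟨ ∏-cong n (λ i _ → factor i) ⟩
    ∏ n (λ i → - 1 * (odd i * ½ * inv i) * (1 + P * - inv (2 ℕ.* i)))
      ≡⟨ trans (∏-* n _ _) (cong (_* ∏ n (λ i → 1 + P * - inv (2 ℕ.* i))) (∏-* n _ _)) ⟩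
    ∏ n (λ _ → - 1) * ∏ n (λ i → odd i * ½ * inv i) * ∏ n (λ i → 1 + P * - inv (2 ℕ.* i))
      ≡⟨ cong (λ c → ∏ n (λ _ → - 1) * c * ∏ n (λ i → 1 + P * - inv (2 ℕ.* i))) (central-∏ n) ⟨
    ∏ n (λ _ → - 1) * central n * ∏ n (λ i → 1 + P * - inv (2 ℕ.* i)) ∎
    where
    open ≡-Reasoning
    r₁ : ∀ h x i → (h - x) * i ≡ - 1 * ((2 * x + 1) * ½ * i) + ½ * i * (1 + 2 * h) * 1
    r₁ = Ring.solve-∀ ℚ-ring
    r₂ : ∀ P o i j → - 1 * (o * ½ * i) + ½ * i * P * (j * o) ≡ - 1 * (o * ½ * i) * (1 + P * - j)
    r₂ = Ring.solve-∀ ℚ-ring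
    factor : ∀ i → (fromℕ h - fromℕ i) * inv i ≡ - 1 * (odd i * ½ * inv i) * (1 + P * - inv (2 ℕ.* i))
    factor i = trans (r₁ (fromℕ h) (fromℕ i) (inv i))
      (trans (cong₂ (λ x y → - 1 * (odd i * ½ * inv i) + ½ * inv i * x * y) (sym P-odd) (sym (inv-even-* i)))
             (r₂ P (odd i) (inv i) (inv (2 ℕ.* i))))

  inv-evenᵢ : ∀ {n i} → n ℕ.≤ h → i ℕ.< n → Integral (inv (2 ℕ.* i))
  inv-evenᵢ n≤h i<n = invᵢ (ℕ.*-monoʳ-< 2 (ℕ.≤-trans i<n n≤h))

  -- ⟨ a ⟩ₚ even

  module Even (p∤3 : ¬ (p ∣ 3)) (n : ℕ) (n≤h : n ℕ.≤ h) {a t : ℚ} (t∈ : Integral t) (a≡ : a ≡ 2 * fromℕ n + P * t) where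

    -- At t = 0 the products `E` and `O` are `e` and `central n * e`; `B` and `A` are what t ≠ 0
    -- adds to them. `D` is the corresponding correction of C(h, n), and `K` truncates 2^(-2t(p-1)).
    e E O A B D K : ℚ
    e = ∏ n λ j → 2 * (1 + fromℕ j)
    E = evens a n
    O = odds a n
    A = ∏ n λ j → 1 + P * (t * inv (2 ℕ.* j))
    B = ∏ n λ j → 1 + P * (½ * t * inv j)
    D = ∏ n λ j → 1 + P * - inv (2 ℕ.* j)
    K = 1 - 2 * t * (2^[p-1] - 1) + t * (2 * t + 1) * ((2^[p-1] - 1) * (2^[p-1] - 1))

    K≡ : K ≡ 1 - 2 * t * (P * q) + t * (2 * t + 1) * (P * q * (P * q))
    K≡ = cong (λ u → 1 - 2 * t * u + t * (2 * t + 1) * (u * u)) 2^[p-1]-1≡Pq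

    a∈ : Integral a
    a∈ = subst Integral (sym a≡) (+-integral (*-integral (fromℕ-integral 2) (fromℕ-integral n)) (*-integral P-integral t∈))

    ½t∈ = *-integral ½-integral t∈

    invₙ : ∀ {j} → j ℕ.< n → Integral (inv j)
    invₙ j<n = invₕ (ℕ.≤-trans j<n n≤h)

    O≡ : O ≡ central n * e * A
    O≡ = begin
      O                                      ≡⟨ trans (cong (λ a → odds a n) a≡) (∏-odds-reverse n (P * t)) ⟩
      ∏ n (λ j → odd j + P * t)              ≡⟨ ∏-cong n (λ j _ → factor j) ⟩
      ∏ n (λ j → odd j * (1 + P * (t * inv (2 ℕ.* j))))  ≡⟨ ∏-* n odd _ ⟩
      ∏ n odd * A                            ≡⟨ cong (_* A) (central-*-evens n) ⟨
      central n * e * A                      ∎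
      where
      open ≡-Reasoning
      r₁ : ∀ o P t → o + P * t ≡ o + P * t * 1
      r₁ = Ring.solve-∀ ℚ-ring
      r₂ : ∀ o P t i → o + P * t * (i * o) ≡ o * (1 + P * (t * i))
      r₂ = Ring.solve-∀ ℚ-ring
      factor : ∀ j → odd j + P * t ≡ odd j * (1 + P * (t * inv (2 ℕ.* j)))
      factor j = trans (r₁ (odd j) P t) (trans (cong (λ x → odd j + P * t * x) (sym (inv-even-* j))) (r₂ (odd j) P t (inv (2 ℕ.* j))))

    E≡ : E ≡ e * B
    E≡ = trans (trans (cong (λ a → evens a n) a≡) (∏-evens-reverse n (P * t))) (trans (∏-cong n λ j _ → factor j) (∏-* n _ _))
      where
      r₁ : ∀ s P t → 2 * s + P * t ≡ 2 * s + P * t * 1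
      r₁ = Ring.solve-∀ ℚ-ring
      r₂ : ∀ s P t i → 2 * s + P * t * (i * s) ≡ 2 * s * (1 + P * (½ * t * i))
      r₂ = Ring.solve-∀ ℚ-ring
      factor : ∀ j → 2 * (1 + fromℕ j) + P * t ≡ 2 * (1 + fromℕ j) * (1 + P * (½ * t * inv j))
      factor j = trans (r₁ (1 + fromℕ j) P t)
        (trans (cong (λ x → 2 * (1 + fromℕ j) + P * t * x) (sym (inv-*′ j))) (r₂ (1 + fromℕ j) P t (inv j)))

    B-unit : Unit B
    B-unit = ∏-unit n λ j j<n → 1+P*-unit (*-integral ½t∈ (invₙ j<n))

    E-unit : Unit E
    E-unit = subst Unit (sym E≡) (*-unit (evens-unit n n≤h) B-unit)

    K∈ : Integral K
    K∈ = +-integral (-integral 1-integral (*-integral (*-integral (fromℕ-integral 2) t∈) u∈))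
      (*-integral (*-integral t∈ (+-integral (*-integral (fromℕ-integral 2) t∈) 1-integral)) (*-integral u∈ u∈))
      where u∈ = -integral (fromℕ-integral (2 ℕ.^ 2h)) 1-integral

    descended : E * E * S p a ≈ O * O * K [ P³ ]
    descended = begin
      E * E * S p a
        ≈⟨ ≈-reflexive (*-comm (E * E) (S p a)) ⟩
      S p a * (E * E)
        ≈⟨ descent n 0 (ℕ.*-monoʳ-≤ 2 n≤h) t∈ (trans a≡ (zero+ (fromℕ n) P t)) ⟩
      O * O * S p (a - 2 * fromℕ n)
        ≈⟨ ≈-reflexive (cong (λ y → O * O * S p y) (trans (cong (_- 2 * fromℕ n) a≡) (cancel (fromℕ n) P t))) ⟩
      O * O * S p (P * t)
        ≈⟨ *-congˡ (*-integral O∈ O∈) (S[Pt] p∤3 t∈) ⟩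
      O * O * K ∎
      where
      open SetoidReasoning (≈-setoid P³)
      O∈ = odds-integral n a∈
      zero+ : ∀ x P t → 2 * x + P * t ≡ 0 + 2 * x + P * t
      zero+ = Ring.solve-∀ ℚ-ring
      cancel : ∀ x P t → 2 * x + P * t - 2 * x ≡ P * t
      cancel = Ring.solve-∀ ℚ-ring

    L X : ℚ
    L = (2 * t + 2) * H (2 ℕ.* n) - (2 * t + 1) * H n - 2 * t * q
    X = 1 + P * L + ½ * (P * P) * (2 * t * (q * q) + L * L + ½ * (2 * (t * t) - 1) * H⁽²⁾ n + 2 * (1 - t * t) * H⁽²⁾ (2 ℕ.* n))

    -- M is the middle term of the statement, known only through its cross-multiplied equation. This
    -- keeps the nonvanishing proof of the statement out of the calculation.
    module _ {M} (M≡ : M * (binom (½ * a) n * binom (½ * a) n) ≡ binom (½ * (a - 1)) n * binom (½ * (a - 1)) n * K) where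

      E²M : E * E * M ≡ O * O * K
      E²M = unit-cancel (*-unit κ-unit κ-unit) (begin
        κ * κ * (E * E * M)
          ≡⟨ r₁ κ E M ⟩
        M * (κ * E * (κ * E))
          ≡⟨ cong (λ x → M * (x * x)) (binom-½ a n) ⟨
        M * (binom (½ * a) n * binom (½ * a) n)
          ≡⟨ M≡ ⟩
        binom (½ * (a - 1)) n * binom (½ * (a - 1)) n * K
          ≡⟨ cong (λ x → x * x * K) (binom-½ (a - 1) n) ⟩
        κ * O * (κ * O) * K
          ≡⟨ r₂ κ O K ⟩
        κ * κ * (O * O * K) ∎)
        where
        open ≡-Reasoning
        κ = ∏ n λ i → ½ * inv i
        κ-unit : Unit κ
        κ-unit = ∏-unit n λ i i<n → *-unit (inv-unit p∤2) (inv-unit (>⇒∤ (ℕ.s≤s (double-< (ℕ.≤-trans i<n n≤h)))))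
        r₁ : ∀ κ E M → κ * κ * (E * E * M) ≡ M * (κ * E * (κ * E))
        r₁ = Ring.solve-∀ ℚ-ring
        r₂ : ∀ κ O K → κ * O * (κ * O) * K ≡ κ * κ * (O * O * K)
        r₂ = Ring.solve-∀ ℚ-ring

      M∈ : Integral M
      M∈ = unit-quotient (*-unit E-unit E-unit) (subst Integral (sym E²M) (*-integral (*-integral O∈ O∈) K∈))
        where O∈ = odds-integral n a∈

      S≈M : Congruent (S p a) M
      S≈M = ≈-integral P³-integral S≈ M∈ , M∈ , S≈
        where
        S≈ : S p a ≈ M [ P³ ]
        S≈ = *-cancelˡ (*-unit E-unit E-unit) (≈-trans descended (≈-reflexive (sym E²M)))

      B²M : B * B * M ≡ central n * central n * (A * A * K)
      B²M = unit-cancel (*-unit e-unit e-unit) (begin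
        e * e * (B * B * M)
          ≡⟨ r₁ e B M ⟩
        e * B * (e * B) * M
          ≡⟨ cong (λ x → x * x * M) E≡ ⟨
        E * E * M
          ≡⟨ E²M ⟩
        O * O * K
          ≡⟨ cong (λ x → x * x * K) O≡ ⟩
        central n * e * A * (central n * e * A) * K
          ≡⟨ r₂ (central n) e A K ⟩
        e * e * (central n * central n * (A * A * K)) ∎)
        where
        open ≡-Reasoning
        e-unit = evens-unit n n≤h
        r₁ : ∀ e B M → e * e * (B * B * M) ≡ e * B * (e * B) * M
        r₁ = Ring.solve-∀ ℚ-ring
        r₂ : ∀ c e A K → c * e * A * (c * e * A) * K ≡ e * e * (c * c * (A * A * K))
        r₂ = Ring.solve-∀ ℚ-ring

      M≈R : Congruent M (fromℕ (h C n) * fromℕ (h C n) * X)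
      M≈R = M∈ , ≈-integral P³-integral (≈-sym M≈) M∈ , M≈
        where
        -- `inv (2 * i)` is 1/(2i + 1): these sums run over the odd denominators below 2n, those
        -- that occur in A and D.
        o₁ = ∑ n λ i → inv (2 ℕ.* i)
        o₂ = ∑ n λ i → inv (2 ℕ.* i) * inv (2 ℕ.* i)
        h₁ = H n
        h₂ = H₂ n

        H-2n : H (2 ℕ.* n) ≡ o₁ + ½ * h₁
        H-2n = trans (∑-parity n inv) (cong (λ x → o₁ + x) (trans (∑-cong n λ i _ → inv-double i) (∑-*ˡ n ½ inv)))

        H₂-2n : H₂ (2 ℕ.* n) ≡ o₂ + ½ * ½ * h₂
        H₂-2n = trans (∑-parity n (λ k → inv k * inv k)) (cong (λ x → o₂ + x)
          (trans (∑-cong n λ i _ → trans (cong (λ x → x * x) (inv-double i)) (r (inv i))) (∑-*ˡ n (½ * ½) (λ k → inv k * inv k))))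
          where
          r : ∀ x → ½ * x * (½ * x) ≡ ½ * ½ * (x * x)
          r = Ring.solve-∀ ℚ-ring

        y : ℚ
        y = t * (q * q) + ½ * (½ * (2 * (t * t) - 1) * h₂ + 2 * (1 - t * t) * H₂ (2 ℕ.* n))

        -- The L² in the statement is the square that exponentiation produces, so L is the
        -- first-order logarithm of X and y gathers the other second-order terms.
        X≡ : X ≡ exp L y
        X≡ = trans (cong₂ (λ u v → 1 + P * L + ½ * (P * P) * (2 * t * (q * q) + L * L + ½ * (2 * (t * t) - 1) * u + 2 * (1 - t * t) * v))
                     (H⁽²⁾≡H₂ n) (H⁽²⁾≡H₂ (2 ℕ.* n)))
                   (r P L t q h₂ (H₂ (2 ℕ.* n)))
          where
          r : ∀ P L t q u v →
            1 + P * L + ½ * (P * P) * (2 * t * (q * q) + L * L + ½ * (2 * (t * t) - 1) * u + 2 * (1 - t * t) * v) ≡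
            1 + P * L + P * P * (½ * (L * L) + (t * (q * q) + ½ * (½ * (2 * (t * t) - 1) * u + 2 * (1 - t * t) * v)))
          r = Ring.solve-∀ ℚ-ring

        2n≤2h = ℕ.*-monoʳ-≤ 2 n≤h
        H-integral : ∀ m → m ℕ.≤ 2 ℕ.* h → Integral (H m)
        H-integral m m≤2h = ∑-integral m λ k k<m → invᵢ (ℕ.≤-trans k<m m≤2h)
        2t∈ = *-integral (fromℕ-integral 2) t∈

        L∈ : Integral L
        L∈ = -integral (-integral
          (*-integral (+-integral 2t∈ (fromℕ-integral 2)) (H-integral (2 ℕ.* n) 2n≤2h))
          (*-integral (+-integral 2t∈ 1-integral) (H-integral n (ℕ.≤-trans n≤h h≤2h))))
          (*-integral 2t∈ q-integral)

        y∈ : Integral y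
        y∈ = +-integral (*-integral t∈ (*-integral q-integral q-integral))
          (*-integral ½-integral (+-integral
            (*-integral (*-integral ½-integral (-integral (*-integral (fromℕ-integral 2) (*-integral t∈ t∈)) 1-integral)) (H₂-integral n (ℕ.≤-trans n≤h h≤2h)))
            (*-integral (*-integral (fromℕ-integral 2) (-integral 1-integral (*-integral t∈ t∈))) (H₂-integral (2 ℕ.* n) 2n≤2h))))

        X∼ : X ∼exp[ L , y ]
        X∼ = expansion L∈ y∈ (≈-reflexive X≡)

        A∼ : A ∼exp[ t * o₁ , - ½ * (t * t) * o₂ ]
        A∼ = ∼exp-cong (∑-*ˡ n t _) (trans (∑-cong n λ i _ → r t (inv (2 ℕ.* i))) (∑-*ˡ n (- ½ * (t * t)) _))
          (∏-∼exp n λ i i<n → ∼exp-linear (*-integral t∈ (inv-evenᵢ n≤h i<n)))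
          where
          r : ∀ t x → - ½ * (t * x * (t * x)) ≡ - ½ * (t * t) * (x * x)
          r = Ring.solve-∀ ℚ-ring

        B∼ : B ∼exp[ ½ * t * h₁ , - ½ * (½ * t * (½ * t)) * h₂ ]
        B∼ = ∼exp-cong (∑-*ˡ n (½ * t) inv) (trans (∑-cong n λ i _ → r t (inv i)) (∑-*ˡ n (- ½ * (½ * t * (½ * t))) _))
          (∏-∼exp n λ i i<n → ∼exp-linear (*-integral ½t∈ (invₙ i<n)))
          where
          r : ∀ t x → - ½ * (½ * t * x * (½ * t * x)) ≡ - ½ * (½ * t * (½ * t)) * (x * x)
          r = Ring.solve-∀ ℚ-ring

        D∼ : D ∼exp[ - 1 * o₁ , - ½ * o₂ ]
        D∼ = ∼exp-cong (trans (∑-cong n λ i _ → negate (inv (2 ℕ.* i))) (∑-*ˡ n (- 1) _))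
                       (trans (∑-cong n λ i _ → r (inv (2 ℕ.* i))) (∑-*ˡ n (- ½) _))
          (∏-∼exp n λ i i<n → ∼exp-linear (neg-integral (inv-evenᵢ n≤h i<n)))
          where
          negate : ∀ x → - x ≡ - 1 * x
          negate = Ring.solve-∀ ℚ-ring
          r : ∀ x → - ½ * (- x * - x) ≡ - ½ * (x * x)
          r = Ring.solve-∀ ℚ-ring

        -- -2t log (1 + P q) = -2t P q + t P² q² + ...
        K∼ : K ∼exp[ - (2 * t * q) , t * (q * q) ]
        K∼ = expansion (neg-integral (*-integral 2t∈ q-integral)) (*-integral t∈ (*-integral q-integral q-integral)) (≈-reflexive (trans K≡ (r P t q)))
          where
          r : ∀ P t q → 1 - 2 * t * (P * q) + t * (2 * t + 1) * (P * q * (P * q)) ≡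
            1 + P * - (2 * t * q) + P * P * (½ * (- (2 * t * q) * - (2 * t * q)) + t * (q * q))
          r = Ring.solve-∀ ℚ-ring

        -- Once H(2n) and H⁽²⁾(2n) are split by parity, the two logarithms agree exactly in both
        -- orders; no further congruence for harmonic sums is used.
        A²K≈ : A * A * K ≈ D * D * X * (B * B) [ P³ ]
        A²K≈ = ∼exp-unique (∼exp-* (∼exp-* A∼ A∼) K∼)
          (∼exp-cong (sym x-match) (sym y-match) (∼exp-* (∼exp-* (∼exp-* D∼ D∼) X∼) (∼exp-* B∼ B∼)))
          where
          r₁ : ∀ t o₁ h₁ q → t * o₁ + t * o₁ + - (2 * t * q) ≡
            - 1 * o₁ + - 1 * o₁ + ((2 * t + 2) * (o₁ + ½ * h₁) - (2 * t + 1) * h₁ - 2 * t * q) + (½ * t * h₁ + ½ * t * h₁)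
          r₁ = Ring.solve-∀ ℚ-ring
          x-match : t * o₁ + t * o₁ + - (2 * t * q) ≡ - 1 * o₁ + - 1 * o₁ + L + (½ * t * h₁ + ½ * t * h₁)
          x-match = trans (r₁ t o₁ h₁ q)
            (cong (λ z → - 1 * o₁ + - 1 * o₁ + ((2 * t + 2) * z - (2 * t + 1) * h₁ - 2 * t * q) + (½ * t * h₁ + ½ * t * h₁)) (sym H-2n))
          r₂ : ∀ t o₂ h₂ q → - ½ * (t * t) * o₂ + - ½ * (t * t) * o₂ + t * (q * q) ≡
            - ½ * o₂ + - ½ * o₂ + (t * (q * q) + ½ * (½ * (2 * (t * t) - 1) * h₂ + 2 * (1 - t * t) * (o₂ + ½ * ½ * h₂))) +
            (- ½ * (½ * t * (½ * t)) * h₂ + - ½ * (½ * t * (½ * t)) * h₂)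
          r₂ = Ring.solve-∀ ℚ-ring
          y-match : - ½ * (t * t) * o₂ + - ½ * (t * t) * o₂ + t * (q * q) ≡
            - ½ * o₂ + - ½ * o₂ + y + (- ½ * (½ * t * (½ * t)) * h₂ + - ½ * (½ * t * (½ * t)) * h₂)
          y-match = trans (r₂ t o₂ h₂ q)
            (cong (λ z → - ½ * o₂ + - ½ * o₂ + (t * (q * q) + ½ * (½ * (2 * (t * t) - 1) * h₂ + 2 * (1 - t * t) * z)) +
              (- ½ * (½ * t * (½ * t)) * h₂ + - ½ * (½ * t * (½ * t)) * h₂)) (sym H₂-2n))

        binomial² : fromℕ (h C n) * fromℕ (h C n) ≡ central n * central n * (D * D)
        binomial² = trans (cong (λ x → x * x) (C-factor n n≤h))
          (trans (r (∏ n (λ _ → - 1)) (central n) D) (trans (cong (_* (central n * central n * (D * D))) (∏-neg1² n)) (*-identityˡ (central n * central n * (D * D)))))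
          where
          r : ∀ s c d → s * c * d * (s * c * d) ≡ s * s * (c * c * (d * d))
          r = Ring.solve-∀ ℚ-ring

        c∈ = unit-integral (central-unit n n≤h)

        M≈ : M ≈ fromℕ (h C n) * fromℕ (h C n) * X [ P³ ]
        M≈ = *-cancelˡ (*-unit B-unit B-unit) (begin
          B * B * M
            ≈⟨ ≈-reflexive B²M ⟩
          central n * central n * (A * A * K)
            ≈⟨ *-congˡ (*-integral c∈ c∈) A²K≈ ⟩
          central n * central n * (D * D * X * (B * B))
            ≈⟨ ≈-reflexive (r (central n) D X B) ⟩
          B * B * (central n * central n * (D * D) * X)
            ≈⟨ ≈-reflexive (cong (λ x → B * B * (x * X)) (sym binomial²)) ⟩
          B * B * (fromℕ (h C n) * fromℕ (h C n) * X) ∎)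
          where
          open SetoidReasoning (≈-setoid P³)
          r : ∀ c d X B → c * c * (d * d * X * (B * B)) ≡ B * B * (c * c * (d * d) * X)
          r = Ring.solve-∀ ℚ-ring

  -- ⟨ a ⟩ₚ odd

  P²-integral : Integral (P * P)
  P²-integral = *-integral P-integral P-integral

  -- Both quotients carry the factor P², so replacing the unit d by d′ costs only a congruence
  -- modulo P.
  compare-quotients : ∀ {m d d′ x y} → Unit d → Unit d′ → d ≈ d′ [ P ] → Integral m →
                      d * x ≡ P * P * m → d′ * y ≈ P * P * m [ P³ ] → x ≈ y [ P³ ]
  compare-quotients {m} {d} {d′} {x} {y} d-unit d′-unit d≈d′ m∈ dx≡ d′y≈ = *-cancelˡ (*-unit d-unit d′-unit) (begin
    d * d′ * x          ≈⟨ ≈-reflexive (trans (r₁ d d′ x) (trans (cong (d′ *_) dx≡) (r₂ d′ P m))) ⟩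
    P * P * (m * d′)    ≈⟨ *-scale (P * P) (*-congˡ m∈ (≈-sym d≈d′)) ⟩
    P * P * (m * d)     ≈⟨ ≈-reflexive (sym (r₂ d P m)) ⟩
    d * (P * P * m)     ≈⟨ *-congˡ (unit-integral d-unit) (≈-sym d′y≈) ⟩
    d * (d′ * y)        ≈⟨ ≈-reflexive (sym (*-assoc d d′ y)) ⟩
    d * d′ * y          ∎)
    where
    open SetoidReasoning (≈-setoid P³)
    r₁ : ∀ d d′ x → d * d′ * x ≡ d′ * (d * x)
    r₁ = Ring.solve-∀ ℚ-ring
    r₂ : ∀ d P m → d * (P * P * m) ≡ P * P * (m * d)
    r₂ = Ring.solve-∀ ℚ-ring

  ²-≈ : ∀ {x y} → Integral x → Integral y → x ≈ y [ P ] → x * x ≈ y * y [ P ]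
  ²-≈ x∈ y∈ x≈y = *-cong x∈ y∈ x≈y x≈y

  module _ {t : ℚ} (t∈ : Integral t) where

    pt∈ : Integral (P * t)
    pt∈ = *-integral P-integral t∈

    b : ℚ
    b = 1 + P * t

    k : ℕ
    k = ℕ.pred 2h

    suc-k : suc k ≡ 2h
    suc-k = ℕ.suc-pred 2h {{ℕ.>-nonZero (ℕ.≤-trans 0<h h≤2h)}}

    k<2h : k ℕ.< 2h
    k<2h = ℕ.≤-reflexive suc-k

    v a₁ d₁ : ℚ
    a₁ = ∏ 2h λ x → 1 + P * (t * inv x)
    d₁ = ∏ k λ x → 1 + P * - (t * inv x)
    v  = - t * a₁ * d₁ * inv k * Y

    below-k : ∀ {x} → x ℕ.< k → Integral (inv x)
    below-k x<k = invᵢ (ℕ.<-trans x<k k<2h)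

    -- `a₁`, `d₁` and `Y` are 1 modulo P, and `inv k` is 1/(p - 1), hence -1, which cancels the sign
    -- of -t.
    v≈t : v ≈ t [ P ]
    v≈t = ≈-trans (*-cong lhs∈ 1-integral
        (*-cong (*-integral (*-integral (neg-integral t∈) a₁∈) d₁∈) (neg-integral 1-integral)
          (*-cong (*-integral (neg-integral t∈) a₁∈) 1-integral (*-congˡ (neg-integral t∈) a₁≈1) d₁≈1)
          inv-k≈)
        Y≈1[P])
      (≈-reflexive (r t))
      where
      a₁≈1 : a₁ ≈ 1 [ P ]
      a₁≈1 = ∏≈1 2h (λ x x<2h → 1+P*-integral (*-integral t∈ (invᵢ x<2h))) (λ x x<2h → 1+P*≈1 (*-integral t∈ (invᵢ x<2h)))
      a₁∈ = ≈-integral P-integral a₁≈1 1-integral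
      d₁≈1 : d₁ ≈ 1 [ P ]
      d₁≈1 = ∏≈1 k (λ x x<k → 1+P*-integral (neg-integral (*-integral t∈ (below-k x<k)))) (λ x x<k → 1+P*≈1 (neg-integral (*-integral t∈ (below-k x<k))))
      d₁∈ = ≈-integral P-integral d₁≈1 1-integral
      lhs∈ = *-integral (*-integral (*-integral (neg-integral t∈) a₁∈) d₁∈) (invᵢ k<2h)
      r : ∀ t → - t * 1 * 1 * - 1 * 1 ≡ t
      r = Ring.solve-∀ ℚ-ring
      r₁ : ∀ i s → i ≡ - (i * s) + (1 + s) * i
      r₁ = Ring.solve-∀ ℚ-ring
      inv-k≈ : inv k ≈ - 1 [ P ]
      inv-k≈ = mod (invᵢ k<2h) (trans (r₁ (inv k) (fromℕ (suc k)))
        (cong₂ (λ x y → - x + y * inv k) (inv-* k) (trans (sym (fromℕ-suc (suc k))) (cong (fromℕ ∘ suc) suc-k))))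

    -- The factor at x = 0 is -P t. Dividing the others by 1, ..., p - 2 in turn leaves the
    -- reciprocal of p - 1 unmatched.
    ∏-[x-Pt] : ∏ 2h (λ x → fromℕ x + 1 - b) * ∏ 2h inv ≡ - (P * t) * d₁ * inv k
    ∏-[x-Pt] = subst (λ n → ∏ n (λ x → fromℕ x + 1 - b) * ∏ n inv ≡ - (P * t) * d₁ * inv k) suc-k (begin
      ∏ (suc k) (λ x → fromℕ x + 1 - b) * (∏ k inv * inv k)
        ≡⟨ cong (_* (∏ k inv * inv k)) (∏-head k (λ x → fromℕ x + 1 - b)) ⟩
      (0 + 1 - b) * ∏ k (λ x → fromℕ (suc x) + 1 - b) * (∏ k inv * inv k)
        ≡⟨ r₁ P t (∏ k (λ x → fromℕ (suc x) + 1 - b)) (∏ k inv) (inv k) ⟩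
      - (P * t) * (∏ k (λ x → fromℕ (suc x) + 1 - b) * ∏ k inv) * inv k
        ≡⟨ cong (λ y → - (P * t) * y * inv k) (trans (sym (∏-* k _ inv)) (∏-cong k λ x _ → factor x)) ⟩
      - (P * t) * d₁ * inv k ∎)
      where
      open ≡-Reasoning
      r₁ : ∀ P t c d i → (0 + 1 - (1 + P * t)) * c * (d * i) ≡ - (P * t) * (c * d) * i
      r₁ = Ring.solve-∀ ℚ-ring
      r₂ : ∀ P t x i → (1 + x + 1 - (1 + P * t)) * i ≡ i * (1 + x) + P * - (t * i)
      r₂ = Ring.solve-∀ ℚ-ring
      factor : ∀ x → (fromℕ (suc x) + 1 - b) * inv x ≡ 1 + P * - (t * inv x)
      factor x = trans (cong (λ y → (y + 1 - b) * inv x) (fromℕ-suc x))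
        (trans (r₂ P t (fromℕ x) (inv x)) (cong (_+ P * - (t * inv x)) (inv-*′ x)))

    -- For b = 1 + P t the product of the b + j stops just before its multiple of p at j = p - 1.
    -- Two factors P remain, one in -P t and one from `∏-odds`.
    V≡ : 2^[p-1] * 2^[p-1] * V b 2h ≡ P * P * v
    V≡ = begin
      2^[p-1] * 2^[p-1] * V b 2h
        ≡⟨ trans (*-comm (2^[p-1] * 2^[p-1]) (V b 2h)) (trans (cong (V b 2h *_) W²≡) (sym (∏-* 2h _ _))) ⟩
      ∏ 2h (λ j → (b + fromℕ j) * (fromℕ j + 1 - b) * (2 * fromℕ j + 3) * triple j * (2 * 2))
        ≡⟨ ∏-cong 2h (λ j _ → factor j) ⟩
      ∏ 2h (λ j → (1 + P * (t * inv j)) * ((fromℕ j + 1 - b) * inv j) * (2 * (2 * fromℕ j + 3) * inv j))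
        ≡⟨ trans (∏-* 2h _ _) (cong₂ _*_ (trans (∏-* 2h _ _) (cong (a₁ *_) (∏-* 2h _ inv))) ∏-odds) ⟩
      a₁ * (∏ 2h (λ x → fromℕ x + 1 - b) * ∏ 2h inv) * (P * Y)
        ≡⟨ cong (λ y → a₁ * y * (P * Y)) ∏-[x-Pt] ⟩
      a₁ * (- (P * t) * d₁ * inv k) * (P * Y)
        ≡⟨ r₁ P t a₁ d₁ (inv k) Y ⟩
      P * P * v ∎
      where
      open ≡-Reasoning
      r₁ : ∀ P t a d i y → a * (- (P * t) * d * i) * (P * y) ≡ P * P * (- t * a * d * i * y)
      r₁ = Ring.solve-∀ ℚ-ring
      r₂ : ∀ P t x i c → (1 + P * t + x) * c * (2 * x + 3) * (½ * (i * i * i)) * (2 * 2) ≡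
                         (i * (1 + x) + P * (t * i)) * (c * i) * (2 * (2 * x + 3) * i)
      r₂ = Ring.solve-∀ ℚ-ring
      factor : ∀ j → (b + fromℕ j) * (fromℕ j + 1 - b) * (2 * fromℕ j + 3) * triple j * (2 * 2) ≡
                     (1 + P * (t * inv j)) * ((fromℕ j + 1 - b) * inv j) * (2 * (2 * fromℕ j + 3) * inv j)
      factor j = trans (r₂ P t (fromℕ j) (inv j) (fromℕ j + 1 - b))
        (cong (λ y → (y + P * (t * inv j)) * ((fromℕ j + 1 - b) * inv j) * (2 * (2 * fromℕ j + 3) * inv j)) (inv-*′ j))

    V≈ : V b 2h ≈ P * P * t [ P³ ]
    V≈ = *-cancelˡ W²-unit (begin
      W² * V b 2h           ≈⟨ ≈-reflexive V≡ ⟩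
      P * P * v             ≈⟨ *-scale (P * P) v≈t ⟩
      P * P * t             ≈⟨ *-scale (P * P) (≈-trans (≈-reflexive (sym (*-identityˡ t))) (*-congʳ t∈ (≈-sym W²≈1))) ⟩
      P * P * (W² * t)      ≈⟨ ≈-reflexive (r P W² t) ⟩
      W² * (P * P * t)      ∎)
      where
      open SetoidReasoning (≈-setoid P³)
      W² = 2^[p-1] * 2^[p-1]
      W²≈1 : W² ≈ 1 [ P ]
      W²≈1 = ²-≈ (fromℕ-integral (2 ℕ.^ 2h)) 1-integral 2^[p-1]≈1
      W²-unit : Unit W²
      W²-unit = ≈-unit (fromℕ-unit p∤1) W²≈1
      r : ∀ P w t → P * P * (w * t) ≡ w * (P * P * t)
      r = Ring.solve-∀ ℚ-ring

    -- Since b - 1 = P t, the preceding value is multiplied by P² t² and is needed only modulo P;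
    -- the symmetry moves its argument b - 2 to -P t.
    S[1+Pt] : b * b * S p b ≈ P * P * (t * (t + 1)) [ P³ ]
    S[1+Pt] = begin
      b * b * S p b
        ≈⟨ ≈-reflexive (S-recurrence b 2h) ⟩
      (b - 1) * (b - 1) * S p (b - 2) + (2 * b - 1) * V b 2h
        ≈⟨ +-cong (≈-reflexive (cong ((b - 1) * (b - 1) *_) (trans (cong (S p) (reflect P t)) (S-symmetric p (P * - t)))))
                  (*-congˡ (-integral (*-integral (fromℕ-integral 2) (1+P*-integral t∈)) 1-integral) V≈) ⟩
      (b - 1) * (b - 1) * S p (P * - t) + (2 * b - 1) * (P * P * t)
        ≈⟨ ≈-reflexive (r₁ P t (S p (P * - t))) ⟩
      P * P * (t * t * S p (P * - t) + (t + P * (2 * t * t)))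
        ≈⟨ *-scale (P * P) (+-cong (*-congˡ (*-integral t∈ t∈) (S≈1 (neg-integral t∈)))
             (mod (*-integral (*-integral (fromℕ-integral 2) t∈) t∈) refl)) ⟩
      P * P * (t * t * 1 + t)
        ≈⟨ ≈-reflexive (r₂ P t) ⟩
      P * P * (t * (t + 1)) ∎
      where
      open SetoidReasoning (≈-setoid P³)
      reflect : ∀ P t → 1 + P * t - 2 ≡ - 1 - P * - t
      reflect = Ring.solve-∀ ℚ-ring
      r₁ : ∀ P t s → (1 + P * t - 1) * (1 + P * t - 1) * s + (2 * (1 + P * t) - 1) * (P * P * t) ≡
                     P * P * (t * t * s + (t + P * (2 * t * t)))
      r₁ = Ring.solve-∀ ℚ-ring
      r₂ : ∀ P t → P * P * (t * t * 1 + t) ≡ P * P * (t * (t + 1))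
      r₂ = Ring.solve-∀ ℚ-ring

    module Odd (m : ℕ) (m<h : m ℕ.< h) {a : ℚ} (a≡ : a ≡ 1 + 2 * fromℕ m + P * t) where

      m≤h = ℕ.<⇒≤ m<h

      N : ℚ
      N = t * (t + 1)

      N∈ : Integral N
      N∈ = *-integral t∈ (+-integral t∈ 1-integral)

      1+2m∈ : Integral (1 + 2 * fromℕ m)
      1+2m∈ = +-integral 1-integral (*-integral (fromℕ-integral 2) (fromℕ-integral m))

      a∈ : Integral a
      a∈ = subst Integral (sym a≡) (+-integral 1+2m∈ pt∈)

      c : ℚ
      c = central m

      c-unit : Unit c
      c-unit = central-unit m m≤h

      a-unit : Unit a
      a-unit = ≈-unit (subst Unit (+-comm (2 * fromℕ m) 1) (odd-unit m<h)) (mod t∈ a≡)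

      e o E O G : ℚ
      e = ∏ m λ j → 2 * (1 + fromℕ j)
      o = ∏ m odd
      E = evens a m
      O = odds a m
      G = ∏ m λ i → a - 2 - 2 * fromℕ i

      G≈o : G ≈ o [ P ]
      G≈o = ≈-trans (≈-reflexive (∏-reverse m _ (λ j → odd j + P * t) λ i j eq →
              trans (cong (λ a → a - 2 - 2 * fromℕ i) (trans a≡ (cong (λ y → 1 + 2 * y + P * t) (fromℕ-reflect i j eq)))) (r (fromℕ i) (fromℕ j) P t)))
            (∏-≈ m (λ j _ → +-integral (odd-integral j) pt∈) (λ j _ → odd-integral j) λ j _ → mod t∈ refl)
        where
        r : ∀ i j P t → 1 + 2 * (1 + i + j) + P * t - 2 - 2 * i ≡ 2 * j + 1 + P * t
        r = Ring.solve-∀ ℚ-ring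

      even∈ : ∀ j → Integral (2 * (1 + fromℕ j))
      even∈ j = *-integral (fromℕ-integral 2) (+-integral 1-integral (fromℕ-integral j))

      O≈e : O ≈ e [ P ]
      O≈e = ≈-trans (≈-reflexive (∏-reverse m _ (λ j → 2 * (1 + fromℕ j) + P * t) λ i j eq →
              trans (cong (λ a → a - 1 - 2 * fromℕ i) (trans a≡ (cong (λ y → 1 + 2 * y + P * t) (fromℕ-reflect i j eq)))) (r (fromℕ i) (fromℕ j) P t)))
            (∏-≈ m (λ j _ → +-integral (even∈ j) pt∈) (λ j _ → even∈ j) λ j _ → mod t∈ refl)
        where
        r : ∀ i j P t → 1 + 2 * (1 + i + j) + P * t - 1 - 2 * i ≡ 2 * (1 + j) + P * t
        r = Ring.solve-∀ ℚ-ring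

      -- b = a - 2m is the next factor of the descending product `E`, and the longer product is
      -- split at its first factor instead. This is the origin of the a² in the denominators of the
      -- statement.
      E*b : E * b ≡ a * G
      E*b = begin
        E * b
          ≡⟨ cong (E *_) (trans (r₁ (fromℕ m) P t) (cong (_- 2 * fromℕ m) (sym a≡))) ⟩
        ∏ (suc m) (λ i → a - 2 * fromℕ i)
          ≡⟨ ∏-head m (λ i → a - 2 * fromℕ i) ⟩
        (a - 2 * 0) * ∏ m (λ i → a - 2 * fromℕ (suc i))
          ≡⟨ cong₂ _*_ (r₂ a) (∏-cong m λ i _ → trans (cong (λ y → a - 2 * y) (fromℕ-suc i)) (r₃ a (fromℕ i))) ⟩
        a * G ∎
        where
        open ≡-Reasoning
        r₁ : ∀ m P t → 1 + P * t ≡ 1 + 2 * m + P * t - 2 * m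
        r₁ = Ring.solve-∀ ℚ-ring
        r₂ : ∀ a → a - 2 * 0 ≡ a
        r₂ = Ring.solve-∀ ℚ-ring
        r₃ : ∀ a i → a - 2 * (1 + i) ≡ a - 2 - 2 * i
        r₃ = Ring.solve-∀ ℚ-ring

      O∈ : Integral O
      O∈ = odds-integral m a∈

      e∈ : Integral e
      e∈ = ∏-integral m λ j _ → even∈ j

      o-unit : Unit o
      o-unit = ∏-unit m λ j j<m → odd-unit (ℕ.<-trans j<m m<h)

      G-unit : Unit G
      G-unit = ≈-unit o-unit G≈o

      2m+1≤2h : 1 ℕ.+ 2 ℕ.* m ℕ.≤ 2h
      2m+1≤2h = ℕ.*-monoʳ-< 2 m<h

      S≈ : a * a * (G * G) * S p a ≈ P * P * (N * (e * e)) [ P³ ]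
      S≈ = begin
        a * a * (G * G) * S p a
          ≈⟨ ≈-reflexive (trans (r₁ a G (S p a)) (trans (cong (λ x → x * x * S p a) (sym E*b)) (r₂ E b (S p a)))) ⟩
        b * b * (S p a * (E * E))
          ≈⟨ *-congˡ b²∈ (descent m 1 2m+1≤2h t∈ a≡) ⟩
        b * b * (O * O * S p (a - 2 * fromℕ m))
          ≈⟨ ≈-reflexive (trans (cong (λ x → b * b * (O * O * S p x)) (trans (cong (_- 2 * fromℕ m) a≡) (r₃ (fromℕ m) P t))) (r₄ b O (S p b))) ⟩
        O * O * (b * b * S p b)
          ≈⟨ *-congˡ (*-integral O∈ O∈) S[1+Pt] ⟩
        O * O * (P * P * N)
          ≈⟨ ≈-reflexive (r₅ O P N) ⟩
        P * P * (N * (O * O))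
          ≈⟨ *-scale (P * P) (*-congˡ N∈ (²-≈ O∈ e∈ O≈e)) ⟩
        P * P * (N * (e * e)) ∎
        where
        open SetoidReasoning (≈-setoid P³)
        b²∈ = *-integral (1+P*-integral t∈) (1+P*-integral t∈)
        r₁ : ∀ a g s → a * a * (g * g) * s ≡ a * g * (a * g) * s
        r₁ = Ring.solve-∀ ℚ-ring
        r₂ : ∀ f b s → f * b * (f * b) * s ≡ b * b * (s * (f * f))
        r₂ = Ring.solve-∀ ℚ-ring
        r₃ : ∀ m P t → 1 + 2 * m + P * t - 2 * m ≡ 1 + P * t
        r₃ = Ring.solve-∀ ℚ-ring
        r₄ : ∀ b o s → b * b * (o * o * s) ≡ o * o * (b * b * s)
        r₄ = Ring.solve-∀ ℚ-ring
        r₅ : ∀ o P n → o * o * (P * P * n) ≡ P * P * (n * (o * o))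
        r₅ = Ring.solve-∀ ℚ-ring

      -- With ⟨a⟩ₚ - 1 = 2m, the power of 4 and the binomial coefficient of the statement combine to
      -- c² = (C(2m, m)/4^m)².
      module _ {M} (M≡ : a * a * (c * c) * M ≡ P * P * N) where

        M∈ : Integral M
        M∈ = unit-quotient (*-unit (*-unit a-unit a-unit) (*-unit c-unit c-unit)) (subst Integral (sym M≡) (*-integral P²-integral N∈))

        S≈M : Congruent (S p a) M
        S≈M = ≈-integral P³-integral M≈ M∈ , M∈ , M≈
          where
          M≡′ : a * a * (o * o) * M ≡ P * P * (N * (e * e))
          M≡′ = trans (cong (λ x → a * a * (x * x) * M) (sym (central-*-evens m)))
            (trans (r₁ a c e M) (trans (cong (_* (e * e)) M≡) (*-assoc (P * P) N (e * e))))
            where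
            r₁ : ∀ a c e M → a * a * (c * e * (c * e)) * M ≡ a * a * (c * c) * M * (e * e)
            r₁ = Ring.solve-∀ ℚ-ring
          M≈ : S p a ≈ M [ P³ ]
          M≈ = ≈-sym (compare-quotients
            (*-unit (*-unit a-unit a-unit) (*-unit o-unit o-unit)) (*-unit (*-unit a-unit a-unit) (*-unit G-unit G-unit))
            (*-congˡ (*-integral a∈ a∈) (≈-sym (²-≈ (unit-integral G-unit) (unit-integral o-unit) G≈o)))
            (*-integral N∈ (*-integral e∈ e∈)) M≡′ S≈)

        -- By `C-factor`, C(h, m) is C(2m, m)/4^m up to sign modulo p, and squaring removes the
        -- sign.
        M≈R : ∀ {R} → a * a * (fromℕ (h C m) * fromℕ (h C m)) * R ≡ P * P * N → Congruent M R
        M≈R {R} R≡ = M∈ , ≈-integral P³-integral (≈-sym M≈) M∈ , M≈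
          where
          d : ℚ
          d = ∏ m λ i → 1 + P * - inv (2 ℕ.* i)
          C² = fromℕ (h C m) * fromℕ (h C m)
          d≈1 : d ≈ 1 [ P ]
          d≈1 = ∏≈1 m (λ i i<m → 1+P*-integral (neg-integral (inv-evenᵢ m≤h i<m))) (λ i i<m → 1+P*≈1 (neg-integral (inv-evenᵢ m≤h i<m)))
          d∈ = ≈-integral P-integral d≈1 1-integral
          c∈ = unit-integral c-unit
          C²≡ : C² ≡ c * c * (d * d)
          C²≡ = trans (cong (λ x → x * x) (C-factor m m≤h))
            (trans (r (∏ m (λ _ → - 1)) c d) (trans (cong (_* (c * c * (d * d))) (∏-neg1² m)) (*-identityˡ (c * c * (d * d)))))
            where
            r : ∀ s c d → s * c * d * (s * c * d) ≡ s * s * (c * c * (d * d))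
            r = Ring.solve-∀ ℚ-ring
          c²≈C² : c * c ≈ C² [ P ]
          c²≈C² = begin
            c * c              ≈⟨ ≈-reflexive (sym (*-identityʳ (c * c))) ⟩
            c * c * (1 * 1)    ≈⟨ *-congˡ (*-integral c∈ c∈) (²-≈ d∈ 1-integral d≈1) ⟨
            c * c * (d * d)    ≈⟨ ≈-reflexive (sym C²≡) ⟩
            C²                 ∎
            where open SetoidReasoning (≈-setoid P)
          M≈ : M ≈ R [ P³ ]
          M≈ = compare-quotients
            (*-unit (*-unit a-unit a-unit) (*-unit c-unit c-unit))
            (*-unit (*-unit a-unit a-unit) (≈-unit (*-unit c-unit c-unit) (≈-sym c²≈C²)))
            (*-congˡ (*-integral a∈ a∈) c²≈C²) N∈ M≡ (≈-reflexive R≡)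

  -- Return to the notions of the statement

  fromIntegralCongruence : ∀ {x y} k → Integral x → Integral y → x ≈ y [ fromℕ (p ℕ.^ k) ] → x ≡ y [mod p ^ k ]
  fromIntegralCongruence {x} {y} k x∈ y∈ (mod {z} z∈ refl) = congruent (fromIntegral x∈) (fromIntegral y∈)
    (fromIntegral (subst Integral (sym (÷-unique {{ℕ.m^n≢0 p k}} (r y (fromℕ (p ℕ.^ k)) z))) z∈))
    where
    r : ∀ y m z → z * m ≡ y + m * z - y
    r = Ring.solve-∀ ℚ-ring

  p^1 : fromℕ (p ℕ.^ 1) ≡ P
  p^1 = cong fromℕ (ℕ.*-identityʳ p)

  Congruent⇒mod : ∀ {x y} → Congruent x y → x ≡ y [mod p ^ 3 ]
  Congruent⇒mod (x∈ , y∈ , x≈y) = fromIntegralCongruence 3 x∈ y∈ (≈-modulus (sym p^3) x≈y)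
    where
    p^3 : fromℕ (p ℕ.^ 3) ≡ P³
    p^3 = trans (fromℕ-* p (p ℕ.* (p ℕ.* 1))) (trans (cong (P *_) (trans (fromℕ-* p (p ℕ.* 1)) (cong (P *_) p^1))) (sym (*-assoc P P P)))

  module Residue {a r} (a-res : r IsResidueOf a Mod p) where

    open _IsResidueOf_Mod_ a-res

    a′ : ℚ
    a′ = (a - fromℕ r) ÷ P

    a′-integral : Integral a′
    a′-integral = subst Integral (sym (÷-unique {a - fromℕ r} {P} {x} x*P≡)) (toIntegral (_≡_[mod_^_].quotient residue))
      where
      x : ℚ
      x = ((a - fromℕ r) ÷ fromℕ (p ℕ.^ 1)) {{ℕ.m^n≢0 p 1}}
      x*P≡ : x * P ≡ a - fromℕ r
      x*P≡ = trans (cong (x *_) (sym p^1)) (÷-*-cancel (a - fromℕ r) (fromℕ (p ℕ.^ 1)) {{ℕ.m^n≢0 p 1}})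

    a≡r+Pa′ : a ≡ fromℕ r + P * a′
    a≡r+Pa′ = trans (split a (fromℕ r)) (cong (λ x → fromℕ r + x) (trans (sym (÷-*-cancel (a - fromℕ r) P)) (*-comm a′ P)))
      where
      split : ∀ a r → a ≡ r + (a - r)
      split = Ring.solve-∀ ℚ-ring

    r≢0 : ¬ (a ≡ 0 [mod p ^ 1 ]) → r ≢ 0
    r≢0 a≢0 refl = a≢0 residue

    -- (p - 1) + P a′ = -1 + P (1 + a′).
    r≢p-1 : ¬ (a ≡ - 1 [mod p ^ 1 ]) → r ≢ 2h
    r≢p-1 a≢-1 refl = a≢-1 (fromIntegralCongruence 1 (toIntegral (_≡_[mod_^_].integralˡ residue)) (neg-integral 1-integral)
      (≈-modulus (sym p^1) (mod (+-integral 1-integral a′-integral) (trans a≡r+Pa′ (trans (shift (fromℕ 2h) (P * a′))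
        (trans (cong (λ x → - 1 + (x + P * a′)) (sym P≡)) (collect P a′)))))))
      where
      shift : ∀ x y → x + y ≡ - 1 + (1 + x + y)
      shift = Ring.solve-∀ ℚ-ring
      collect : ∀ P t → - 1 + (P + P * t) ≡ - 1 + P * (1 + t)
      collect = Ring.solve-∀ ℚ-ring

-- The two parities of ⟨a⟩ₚ

even-case : ∀ {p h a r} .{{_ : ℕ.NonZero p}} → p ≡ suc (2 ℕ.* h) → Prime p → r IsResidueOf a Mod p →
  ¬ (a ≡ 0 [mod p ^ 1 ]) → ¬ (a ≡ - 1 [mod p ^ 1 ]) → ∀ n → r ≡ 2 ℕ.* n → (nz : NonZero (binom (½ * a) n ²)) →
  let a′ = (a - fromℕ r) ÷ fromℕ p
      P  = fromℕ p
      q  = q₂ p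
      u  = fromℕ (2 ℕ.^ (p ℕ.∸ 1)) - 1
      L  = (2 * a′ + 2) * H (2 ℕ.* n) - (2 * a′ + 1) * H n - 2 * a′ * q
      M  = (binom (½ * (a - 1)) n ² ÷ binom (½ * a) n ²) {{nz}} * (1 - 2 * a′ * u + a′ * (2 * a′ + 1) * u ²)
      R  = fromℕ (ℕ.⌊ p ℕ.∸ 1 /2⌋ C n) ²
             * (1 + P * L + ½ * P ² * (2 * a′ * q ² + L ² + ½ * (2 * a′ ² - 1) * H⁽²⁾ n + 2 * (1 - a′ ²) * H⁽²⁾ (2 ℕ.* n)))
  in (S p a ≡ M [mod p ^ 3 ]) × (M ≡ R [mod p ^ 3 ])
even-case {h = h} {a} refl p-prime a-res a≢0 a≢-1 n refl nz = Congruent⇒mod (S≈M {M} M≡) ,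
  Congruent⇒mod (subst (λ k → Congruent M (fromℕ (k C n) * fromℕ (k C n) * X)) (sym (⌊2*n/2⌋ h)) (M≈R {M} M≡))
  where
  open OddPrime h p-prime
  open Residue a-res
  open _IsResidueOf_Mod_ a-res using (bounded)
  n≤h : n ℕ.≤ h
  n≤h = ℕ.*-cancelˡ-≤ 2 {{ℕ.nonZero}} (ℕ.s≤s⁻¹ bounded)
  n≢0 : n ≢ 0
  n≢0 n≡0 = r≢0 a≢0 (cong (2 ℕ.*_) n≡0)
  n≢h : n ≢ h
  n≢h n≡h = r≢p-1 a≢-1 (cong (2 ℕ.*_) n≡h)
  -- The residue 2n is neither 0 nor p - 1, so 0 < n < h. This gives p ≥ 5, hence p does not divide
  -- 3.
  2≤h : 2 ℕ.≤ h
  2≤h = ℕ.≤-<-trans (ℕ.n≢0⇒n>0 n≢0) (ℕ.≤∧≢⇒< n≤h n≢h)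
  open Even (>⇒∤ (ℕ.s≤s (ℕ.≤-trans (ℕ.n≤1+n 3) (ℕ.*-monoʳ-≤ 2 2≤h)))) n n≤h a′-integral
    (trans a≡r+Pa′ (cong (_+ P * a′) (fromℕ-double n))) using (K; X; S≈M; M≈R)
  b₁ b₂ M : ℚ
  b₁ = binom (½ * (a - 1)) n
  b₂ = binom (½ * a) n
  M = (b₁ ² ÷ b₂ ²) {{nz}} * K
  swap : ∀ x k y → x * k * y ≡ x * y * k
  swap = Ring.solve-∀ ℚ-ring
  M≡ : M * (b₂ * b₂) ≡ b₁ * b₁ * K
  M≡ = trans (swap ((b₁ ² ÷ b₂ ²) {{nz}}) K (b₂ * b₂)) (cong (_* K) (÷-*-cancel (b₁ ²) (b₂ ²) {{nz}}))

odd-case : ∀ {p h a r m} .{{_ : ℕ.NonZero p}} → p ≡ suc (2 ℕ.* h) → Prime p → r IsResidueOf a Mod p → r ≡ suc (2 ℕ.* m) →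
  let a′ = (a - fromℕ r) ÷ fromℕ p
      h  = ℕ.⌊ p ℕ.∸ 1 /2⌋
      s  = ℕ.⌊ r ℕ.∸ 1 /2⌋
      N  = a′ * (a′ + 1) * fromℕ p ²
  in
  (nz : NonZero (a ² * fromℕ ((r ℕ.∸ 1) C s) ²)) (nz′ : NonZero (a ² * fromℕ (h C s) ²)) →
  let M = (fromℕ (4 ℕ.^ (r ℕ.∸ 1)) * N ÷ (a ² * fromℕ ((r ℕ.∸ 1) C s) ²)) {{nz}}
      R = (N ÷ (a ² * fromℕ (h C s) ²)) {{nz′}}
  in (S p a ≡ M [mod p ^ 3 ]) × (M ≡ R [mod p ^ 3 ])
odd-case {h = h} {a} {m = m} refl p-prime a-res refl nz nz′ =
  Congruent⇒mod (S≈M {M} M≡) , Congruent⇒mod (M≈R {M} M≡ {R} R≡)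
  where
  open OddPrime h p-prime
  open Residue a-res
  open _IsResidueOf_Mod_ a-res using (bounded)
  open Odd a′-integral m (ℕ.*-cancelˡ-< 2 m h (ℕ.s≤s⁻¹ bounded)) (trans a≡r+Pa′ (cong (_+ P * a′) (fromℕ-1+2* m))) using (c; N; S≈M; M≈R)
  s : ℕ
  s = ℕ.⌊ 2 ℕ.* m /2⌋
  f D D′ M R : ℚ
  f  = fromℕ (4 ℕ.^ m)
  D  = a ² * fromℕ ((2 ℕ.* m) C s) ²
  D′ = a ² * fromℕ (ℕ.⌊ 2 ℕ.* h /2⌋ C s) ²
  M  = (fromℕ (4 ℕ.^ (2 ℕ.* m)) * (N * P ²) ÷ D) {{nz}}
  R  = (N * P ² ÷ D′) {{nz′}}
  instance _ = ℕ.m^n≢0 4 m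
  C≡ : fromℕ ((2 ℕ.* m) C s) ≡ c * f
  C≡ = trans (cong (λ s → fromℕ ((2 ℕ.* m) C s)) (⌊2*n/2⌋ m)) (sym (÷-*-cancel (fromℕ ((2 ℕ.* m) C m)) f))
  4^2m : fromℕ (4 ℕ.^ (2 ℕ.* m)) ≡ f * f
  4^2m = trans (cong fromℕ (trans (cong (λ k → 4 ℕ.^ (m ℕ.+ k)) (ℕ.+-identityʳ m)) (ℕ.^-distribˡ-+-* 4 m m))) (fromℕ-* (4 ℕ.^ m) (4 ℕ.^ m))
  M≡ : a * a * (c * c) * M ≡ P * P * N
  -- The numerator 4^(2m) is f² and the denominator contains (c f)², so f is cancelled twice.
  M≡ = *-cancelʳ f (*-cancelʳ f (begin
    a * a * (c * c) * M * f * f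
      ≡⟨ r₁ a c M f ⟩
    M * (a * a * (c * f * (c * f)))
      ≡⟨ cong (λ x → M * (a * a * (x * x))) C≡ ⟨
    M * D
      ≡⟨ ÷-*-cancel (fromℕ (4 ℕ.^ (2 ℕ.* m)) * (N * P ²)) D {{nz}} ⟩
    fromℕ (4 ℕ.^ (2 ℕ.* m)) * (N * P ²)
      ≡⟨ cong (_* (N * P ²)) 4^2m ⟩
    f * f * (N * (P * P))
      ≡⟨ r₂ f N P ⟩
    P * P * N * f * f ∎))
    where
    open ≡-Reasoning
    r₁ : ∀ a c M f → a * a * (c * c) * M * f * f ≡ M * (a * a * (c * f * (c * f)))
    r₁ = Ring.solve-∀ ℚ-ring
    r₂ : ∀ f N P → f * f * (N * (P * P)) ≡ P * P * N * f * f
    r₂ = Ring.solve-∀ ℚ-ring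
  R≡ : a * a * (fromℕ (h C m) * fromℕ (h C m)) * R ≡ P * P * N
  R≡ = begin
    a * a * (fromℕ (h C m) * fromℕ (h C m)) * R
      ≡⟨ *-comm (a * a * (fromℕ (h C m) * fromℕ (h C m))) R ⟩
    R * (a * a * (fromℕ (h C m) * fromℕ (h C m)))
      ≡⟨ cong₂ (λ k s → R * (a * a * (fromℕ (k C s) * fromℕ (k C s)))) (⌊2*n/2⌋ h) (⌊2*n/2⌋ m) ⟨
    R * D′
      ≡⟨ ÷-*-cancel (N * P ²) D′ {{nz′}} ⟩
    N * (P * P)
      ≡⟨ *-comm N (P * P) ⟩
    P * P * N ∎
    where open ≡-Reasoning

theorem2p1 :
  ∀ (p : ℕ) .{{_ : ℕ.NonZero p}} (a : ℚ) (r : ℕ) →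
  (p-prime : Prime p) → ¬ (2 ∣ p) →
  (a∈ℤₚ : a ∈ℤ₍ p ₎) →
  (a≢0 : ¬ (a ≡ 0 [mod p ^ 1 ])) → ¬ (a ≡ - 1 [mod p ^ 1 ]) →
  (a-res : r IsResidueOf a Mod p) →
  let a′ = (a - fromℕ r) ÷ fromℕ p
      P  = fromℕ p
      q  = q₂ p
      u  = fromℕ (2 ℕ.^ (p ℕ.∸ 1)) - 1
      h  = ℕ.⌊ p ℕ.∸ 1 /2⌋
      s  = ℕ.⌊ r ℕ.∸ 1 /2⌋
  in
  ( ∀ (n : ℕ) (r≡2n : r ≡ 2 ℕ.* n) →
    let L = (2 * a′ + 2) * H (2 ℕ.* n) - (2 * a′ + 1) * H n - 2 * a′ * q
        M = (binom (½ * (a - 1)) n ² ÷ binom (½ * a) n ²) {{binom[½a,n]²-nonZero n p-prime a-res r≡2n}}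
              * (1 - 2 * a′ * u + a′ * (2 * a′ + 1) * u ²)
        R = fromℕ (h C n) ²
              * (1 + P * L
                   + ½ * P ² * (2 * a′ * q ² + L ²
                                  + ½ * (2 * a′ ² - 1) * H⁽²⁾ n
                                  + 2 * (1 - a′ ²) * H⁽²⁾ (2 ℕ.* n)))
    in (S p a ≡ M [mod p ^ 3 ]) × (M ≡ R [mod p ^ 3 ]) )
  ×
  ( ¬ (2 ∣ r) →
    let N = a′ * (a′ + 1) * P ²
        M = (fromℕ (4 ℕ.^ (r ℕ.∸ 1)) * N ÷ (a ² * fromℕ ((r ℕ.∸ 1) C s) ²))
              {{a²C²-nonZero (r ℕ.∸ 1) s a∈ℤₚ a≢0 (⌊n/2⌋≤n (r ℕ.∸ 1))}}
        R = (N ÷ (a ² * fromℕ (h C s) ²))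
              {{a²C²-nonZero h s a∈ℤₚ a≢0 (⌊[r∸1]/2⌋≤⌊[p∸1]/2⌋ a-res)}}
    in (S p a ≡ M [mod p ^ 3 ]) × (M ≡ R [mod p ^ 3 ]) )
theorem2p1 p a r p-prime p-odd a∈ℤₚ a≢0 a≢-1 a-res =
  (λ n r≡2n → even-case {h = h} p≡1+2h p-prime a-res a≢0 a≢-1 n r≡2n (binom[½a,n]²-nonZero n p-prime a-res r≡2n)) ,
  (λ r-odd → odd-case {h = h} {m = proj₁ (odd⇒1+2* r r-odd)} p≡1+2h p-prime a-res (proj₂ (odd⇒1+2* r r-odd))
    (a²C²-nonZero (r ℕ.∸ 1) ℕ.⌊ r ℕ.∸ 1 /2⌋ a∈ℤₚ a≢0 (⌊n/2⌋≤n (r ℕ.∸ 1)))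
    (a²C²-nonZero ℕ.⌊ p ℕ.∸ 1 /2⌋ ℕ.⌊ r ℕ.∸ 1 /2⌋ a∈ℤₚ a≢0 (⌊[r∸1]/2⌋≤⌊[p∸1]/2⌋ a-res)))
  where
  h = proj₁ (odd⇒1+2* p p-odd)
  p≡1+2h = proj₂ (odd⇒1+2* p p-odd)
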